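{- For $2w\le n$, let $\mathbb{F}_2^{n,w}$ be the set of binary vectors of length $n$ with exactly $w$ ones, with distance $\tau(x,y)=|\{i:x_i\ne y_i\}|/2$, and let $A(\mathbb{F}_2^{n,w},s)$ be the maximum cardinality of a subset $X\subset\mathbb{F}_2^{n,w}$ whose set of distances between distinct elements has exactly $s$ elements. (1) For $14\le n\le 58$ and $5\le w\le n/2$, $A(\mathbb{F}_2^{n,w},4)\le \binom{n}{4}-\binom{n}{3}+\binom{n}{2}$. (2) If $n,w$ satisfy one of: $15\le n\le 16$ and $w=5$; $17\le n\le 19$ and $5\le w\le 6$; $20\le n\le 24$ and $5\le w\le 7$; $25\le n\le 29$ and $5\le w\le 8$; ($30\le n\le 34$ or $41\le n\le 47$) and $5\le w\le 9$; ($35\le n\le 40$ or $48\le n\le 59$) and $5\le w\le 10$; $60\le n\le 70$ and $5\le w\le 11$; then $A(\mathbb{F}_2^{n,w},4)=\binom{n-w+4}{4}$.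
   Context: None beyond the definitions in the claim. -}

module Defs where

open import Data.Bool using (Bool; true; false; _xor_)
open import Data.Nat using (ℕ; zero; suc; _+_; _≤_; _/_)
open import Data.Vec using (Vec; []; _∷_)
open import Data.List using (List; length)
open import Data.List.Membership.Propositional using (_∈_)
open import Data.List.Relation.Unary.All using (All)
open import Data.List.Relation.Unary.Unique.Propositional using (Unique)
open import Data.Product using (Σ; ∃; _×_)
open import Data.Sum using (_⊎_)
open import Function.Bundles using (_⇔_)
open import Relation.Binary.PropositionalEquality using (_≡_; _≢_)

weight : ∀ {n} → Vec Bool n → ℕ
weight [] = 0
weight (true ∷ x) = suc (weight x)
weight (false ∷ x) = weight x

hamming : ∀ {n} → Vec Bool n → Vec Bool n → ℕ
hamming [] [] = 0
hamming (a ∷ x) (b ∷ y) with a xor b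
... | true = suc (hamming x y)
... | false = hamming x y

-- τ(x,y) = |{i : x_i ≠ y_i}| / 2  (always an integer on F_2^{n,w})
τ : ∀ {n} → Vec Bool n → Vec Bool n → ℕ
τ x y = hamming x y / 2

IsSubsetFnw : (n w : ℕ) → List (Vec Bool n) → Set
IsSubsetFnw n w X = Unique X × All (λ x → weight x ≡ w) X

HasDistanceCount : ∀ {n} → ℕ → List (Vec Bool n) → Set
HasDistanceCount {n} s X =
  Σ (List ℕ) λ D → Unique D × length D ≡ s ×
    (∀ d → (d ∈ D) ⇔ (Σ (Vec Bool n) λ x → Σ (Vec Bool n) λ y →
                        x ∈ X × y ∈ X × x ≢ y × τ x y ≡ d))

IsSDistanceSet : (n w s : ℕ) → List (Vec Bool n) → Set
IsSDistanceSet n w s X = IsSubsetFnw n w X × HasDistanceCount s X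

IsA : (n w s m : ℕ) → Set
IsA n w s m =
  (Σ (List (Vec Bool n)) λ X → IsSDistanceSet n w s X × length X ≡ m) ×
  (∀ X → IsSDistanceSet n w s X → length X ≤ m)

Cond2 : ℕ → ℕ → Set
Cond2 n w =
     (15 ≤ n × n ≤ 16 × 5 ≤ w × w ≤ 5)
  ⊎ (17 ≤ n × n ≤ 19 × 5 ≤ w × w ≤ 6)
  ⊎ (20 ≤ n × n ≤ 24 × 5 ≤ w × w ≤ 7)
  ⊎ (25 ≤ n × n ≤ 29 × 5 ≤ w × w ≤ 8)
  ⊎ (((30 ≤ n × n ≤ 34) ⊎ (41 ≤ n × n ≤ 47)) × 5 ≤ w × w ≤ 9)
  ⊎ (((35 ≤ n × n ≤ 40) ⊎ (48 ≤ n × n ≤ 59)) × 5 ≤ w × w ≤ 10)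
  ⊎ (60 ≤ n × n ≤ 70 × 5 ≤ w × w ≤ 11)

{-# OPTIONS --safe #-}
module Submission where

-- Let X be a 4-distance set larger than claimed, with distances d₁ < d₂ < d₃ < d₄. As X is large, there is a
-- nonzero integer vector v on X orthogonal to all monomials of degree at most 3. Applying ∏_{j≠i} (d_j − τ) to v
-- shows that −∏_{j≠i} d_j / (d_j − d_i) is an eigenvalue of an integer matrix, hence an integer (the argument of
-- Larman, Rogers and Seidel), which leaves finitely many quadruples. For each of them, either the third
-- harmonic has a nonpositive coefficient in ∏ (d_j − τ), and counting dimensions without that harmonic gives (1),
-- or Delsarte's linear programming bound is good enough. The latter also covers the distances 1, 2, 3, 4 in (2),
-- that is, Wilson's form of the Erdős–Ko–Rado theorem. Padding with zeros treats many lengths at once.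
-- The bound in (2) is attained by the vectors with w − 4 prescribed ones.

open import Defs
open import Data.Bool using (Bool; true; false; T; _∧_; _∨_; if_then_else_)
open import Data.Bool.ListAction using (all; any)
open import Data.Bool.Properties using (T-∧; T-∨)
open import Data.Empty using (⊥)
open import Data.Integer as ℤ using (ℤ; +_; -[1+_]; 0ℤ; 1ℤ; ∣_∣)
import Data.Integer.Properties as ℤ
open import Data.Integer.Tactic.RingSolver using (solve-∀)
open import Data.List using (List; []; _∷_; _++_; map; length)
open import Data.List.Membership.Propositional using (_∈_; find)
open import Data.List.Membership.Propositional.Properties using (∈-map⁻; ∈-map⁺; ∈-++⁻; ∈-++⁺ˡ; ∈-++⁺ʳ)
open import Data.List.Properties using (length-map; length-++; map-tabulate)
open import Data.List.Relation.Binary.Permutation.Propositional using (↭-sym; ↭⇒↭ₛ)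
open import Data.List.Relation.Binary.Permutation.Propositional.Properties using (∈-resp-↭; ↭-length)
open import Data.List.Relation.Unary.All as All using (All; []; _∷_)
import Data.List.Relation.Unary.All.Properties as All
open import Data.List.Relation.Unary.AllPairs using ([]; _∷_)
open import Data.List.Relation.Unary.Any using (Any; here; there)
import Data.List.Relation.Unary.Any.Properties as Any
open import Data.List.Relation.Unary.Linked using (Linked; [-]; _∷_)
open import Data.List.Relation.Unary.Unique.Propositional using (Unique)
import Data.List.Relation.Unary.Unique.Propositional.Properties as Unique
open import Data.Nat using (ℕ; zero; suc)
open import Data.Nat.Combinatorics using (_C_; nCk+nC[k+1]≡[n+1]C[k+1])
open import Data.Nat.Divisibility using (_∣_; _∣0; ∣-trans; *-cancelˡ-∣; 0∣⇒≡0; n∣m⇒m%n≡0)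
open import Data.Product using (Σ; ∃; _×_; _,_; proj₁; proj₂)
open import Data.Sum using (_⊎_; inj₁; inj₂; [_,_]′)
open import Data.Unit using (tt)
open import Data.Vec using (Vec; []; _∷_; lookup; removeAt; replicate)
import Data.Vec.Properties as Vec
open import Function using (_∘_; id)
open import Function.Bundles using (Equivalence; mk⇔)
open import Relation.Binary.PropositionalEquality
open import Relation.Nullary using (Dec; yes; no; does; ¬_; contradiction)
open import Relation.Nullary.Decidable using (from-yes)
import Data.List.Relation.Binary.Permutation.Setoid.Properties (setoid ℕ) as Permutation

-- On the vectors of weight w, the polynomials of degree at most 4 have dimension C(n,4) and the
-- third harmonic has dimension C(n,3) - C(n,2); the difference is the bound in (1). It holds
-- because ∏ (d_j - τ) is a positive multiple of the identity on X, so its form cannot be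
-- nonpositive at a nonzero combination that only the third harmonic sees. The linear algebra stays
-- over the integers, and this shapes the argument: the eigenvalue gives way to the gcd of the
-- entries of a kernel vector, harmonic subspaces to conditions on functions on the 2-, 3- and
-- 4-sets joined by the up and down operators, definiteness to sums of squares. The integrality
-- argument needs more points than there are monomials of degree at most 3; that the claimed bounds
-- are at least that number is part of the evaluation. Distances are at most w, and w ≤ 29 in both
-- statements, whence the limit 30 of the table.

module Forms where
  import Data.Bool.Properties as Bool
  open import Data.Fin using (Fin; zero; suc)
  open import Data.Integer using (-_; _+_; _*_; _-_; _≤_; +≤+)
  open import Data.Integer.Divisibility.Signed using (divides; ∣⇒∣ᵤ; ∣ᵤ⇒∣) renaming (_∣_ to _∣ℤ_)
  open import Data.Integer.Properties
  open import Data.List using (allFin; applyUpTo)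
  open import Data.Nat as ℕ using (_∸_)
  open import Data.Nat.DivMod using (m*n/n≡m)
  open import Data.Nat.GCD using (gcd; gcd[m,n]∣m; gcd[m,n]∣n; gcd-greatest; c*gcd[m,n]≡gcd[cm,cn])
  import Data.Nat.Properties as ℕ

  private variable
    n k w : ℕ
    A B : Set

  -- Sums, combinations and linear systems.

  ∑ : List A → (A → ℤ) → ℤ
  ∑ []       f = 0ℤ
  ∑ (x ∷ xs) f = f x + ∑ xs f

  ∑-cong : ∀ (xs : List A) {f g : A → ℤ} → (∀ {x} → x ∈ xs → f x ≡ g x) → ∑ xs f ≡ ∑ xs g
  ∑-cong []       eq = refl
  ∑-cong (x ∷ xs) eq = cong₂ _+_ (eq (here refl)) (∑-cong xs (eq ∘ there))

  ∑-++ : ∀ (xs ys : List A) (f : A → ℤ) → ∑ (xs ++ ys) f ≡ ∑ xs f + ∑ ys f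
  ∑-++ []       ys f = sym (+-identityˡ _)
  ∑-++ (x ∷ xs) ys f = trans (cong (_+_ (f x)) (∑-++ xs ys f)) (sym (+-assoc (f x) _ _))

  ∑-map : ∀ (g : A → B) xs (f : B → ℤ) → ∑ (map g xs) f ≡ ∑ xs (f ∘ g)
  ∑-map g []       f = refl
  ∑-map g (x ∷ xs) f = cong (_+_ (f (g x))) (∑-map g xs f)

  ∑-zero : ∀ (xs : List A) {f : A → ℤ} → (∀ {x} → x ∈ xs → f x ≡ 0ℤ) → ∑ xs f ≡ 0ℤ
  ∑-zero []       eq = refl
  ∑-zero (x ∷ xs) eq rewrite eq (here refl) | ∑-zero xs (eq ∘ there) = refl

  ∑-+ : ∀ (xs : List A) (f g : A → ℤ) → ∑ xs (λ x → f x + g x) ≡ ∑ xs f + ∑ xs g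
  ∑-+ []       f g = refl
  ∑-+ (x ∷ xs) f g rewrite ∑-+ xs f g = interchange (f x) (g x) (∑ xs f) (∑ xs g)
    where interchange : ∀ a b c d → (a + b) + (c + d) ≡ (a + c) + (b + d)
          interchange = solve-∀

  ∑-*ˡ : ∀ (c : ℤ) (xs : List A) (f : A → ℤ) → ∑ xs (λ x → c * f x) ≡ c * ∑ xs f
  ∑-*ˡ c []       f = sym (*-zeroʳ c)
  ∑-*ˡ c (x ∷ xs) f = trans (cong (_+_ (c * f x)) (∑-*ˡ c xs f)) (sym (*-distribˡ-+ c (f x) _))

  ∑-*ʳ : ∀ (c : ℤ) (xs : List A) (f : A → ℤ) → ∑ xs (λ x → f x * c) ≡ ∑ xs f * c
  ∑-*ʳ c []       f = refl
  ∑-*ʳ c (x ∷ xs) f = trans (cong (_+_ (f x * c)) (∑-*ʳ c xs f)) (sym (*-distribʳ-+ c (f x) _))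

  ∑-swap : ∀ (xs : List A) (ys : List B) (f : A → B → ℤ) →
           ∑ xs (λ x → ∑ ys (f x)) ≡ ∑ ys (λ y → ∑ xs (λ x → f x y))
  ∑-swap []       ys f = sym (∑-zero ys (λ _ → refl))
  ∑-swap (x ∷ xs) ys f =
    trans (cong (_+_ (∑ ys (f x))) (∑-swap xs ys f)) (sym (∑-+ ys (f x) _))

  ∑-mono-≤ : ∀ (xs : List A) {f g : A → ℤ} → (∀ {x} → x ∈ xs → f x ≤ g x) → ∑ xs f ≤ ∑ xs g
  ∑-mono-≤ []       le = ≤-refl
  ∑-mono-≤ (x ∷ xs) le = +-mono-≤ (le (here refl)) (∑-mono-≤ xs (le ∘ there))

  ∑-nonneg : ∀ (xs : List A) {f : A → ℤ} → (∀ {x} → x ∈ xs → 0ℤ ≤ f x) → 0ℤ ≤ ∑ xs f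
  ∑-nonneg xs {f} pos = subst (_≤ ∑ xs f) (∑-zero xs {λ _ → 0ℤ} (λ _ → refl)) (∑-mono-≤ xs pos)

  ∑-const : ∀ (xs : List A) c → ∑ xs (λ _ → c) ≡ + length xs * c
  ∑-const []       c = refl
  ∑-const (x ∷ xs) c = trans (cong (_+_ c) (∑-const xs c)) (sym (suc-* (+ length xs) c))

  -- A vector indexed by a list of points: each point is paired with its coefficient.
  Combination : Set → Set
  Combination A = List (ℤ × A)

  infix 8 _∙_
  _∙_ : Combination A → (A → ℤ) → ℤ
  L ∙ f = ∑ L (λ p → proj₁ p * f (proj₂ p))

  Nonzero : Combination A → Set
  Nonzero L = Any (λ p → proj₁ p ≢ 0ℤ) L

  scale : ℤ → Combination A → Combination A
  scale c = map (λ p → c * proj₁ p , proj₂ p)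

  ∙-scale : ∀ c (L : Combination A) f → scale c L ∙ f ≡ c * L ∙ f
  ∙-scale c L f = trans (∑-map _ L _)
    (trans (∑-cong L (λ {p} _ → *-assoc c (proj₁ p) _)) (∑-*ˡ c L _))

  ∙-+ : ∀ (L : Combination A) f g → L ∙ (λ x → f x + g x) ≡ L ∙ f + L ∙ g
  ∙-+ L f g = trans (∑-cong L (λ {p} _ → *-distribˡ-+ (proj₁ p) _ _)) (∑-+ L _ _)

  ∙-* : ∀ (L : Combination A) c f → L ∙ (λ x → c * f x) ≡ c * L ∙ f
  ∙-* L c f = trans (∑-cong L (λ {p} _ → lemma (proj₁ p) c _)) (∑-*ˡ c L _)
    where lemma : ∀ a b d → a * (b * d) ≡ b * (a * d)
          lemma = solve-∀

  ∙-cong : ∀ (L : Combination A) {f g} → (∀ {p} → p ∈ L → f (proj₂ p) ≡ g (proj₂ p)) → L ∙ f ≡ L ∙ g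
  ∙-cong L eq = ∑-cong L (λ {p} p∈L → cong (proj₁ p *_) (eq p∈L))

  map-scale : ∀ c (L : Combination A) → map proj₂ (scale c L) ≡ map proj₂ L
  map-scale c []      = refl
  map-scale c (p ∷ L) = cong (proj₂ p ∷_) (map-scale c L)

  scale-nonzero : ∀ {c} (L : Combination A) → c ≢ 0ℤ → Nonzero L → Nonzero (scale c L)
  scale-nonzero {c = c} (p ∷ L) c≢0 (here nz) = here λ eq → case (i*j≡0⇒i≡0∨j≡0 c eq)
    where case : c ≡ 0ℤ ⊎ proj₁ p ≡ 0ℤ → _
          case (inj₁ e) = c≢0 e
          case (inj₂ e) = nz e
  scale-nonzero (p ∷ L) c≢0 (there nz) = there (scale-nonzero L c≢0 nz)

  private
    -- The last field of `some` says that `rows` is `r` inserted somewhere into `rest`, in the form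
    -- in which it is used: the pivot row and the other rows are treated separately.
    data Pivot {A : Set} (x : A) (rows : List (A → ℤ)) : Set₁ where
      none : All (λ r → r x ≡ 0ℤ) rows → Pivot x rows
      some : ∀ r rest → r x ≢ 0ℤ → length rows ≡ suc (length rest) →
             (∀ {P : (A → ℤ) → Set} → P r → All P rest → All P rows) → Pivot x rows

    pivot : ∀ (x : A) rows → Pivot x rows
    pivot x [] = none []
    pivot x (r ∷ rows) with r x ≟ 0ℤ
    ... | no  rx≢0 = some r rows rx≢0 refl _∷_
    ... | yes rx≡0 with pivot x rows
    ...   | none zs = none (rx≡0 ∷ zs)
    ...   | some r′ rest nz len all = some r′ (r ∷ rest) nz (cong suc len) λ { p (q ∷ qs) → q ∷ all p qs }

    zeros : List A → Combination A
    zeros = map (0ℤ ,_)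

    map-zeros : ∀ (xs : List A) → map proj₂ (zeros xs) ≡ xs
    map-zeros []       = refl
    map-zeros (x ∷ xs) = cong (x ∷_) (map-zeros xs)

  -- Fraction-free Gaussian elimination.
  kernel-vector : ∀ (rows : List (A → ℤ)) (xs : List A) → length rows ℕ.< length xs →
                  Σ (Combination A) λ L → map proj₂ L ≡ xs × Nonzero L × All (λ r → L ∙ r ≡ 0ℤ) rows
  kernel-vector rows (x ∷ xs) lt with pivot x rows
  ... | none zs = (1ℤ , x) ∷ zeros xs , cong (x ∷_) (map-zeros xs) , here (λ ()) , All.map (λ {r} → unit r) zs
    where
    unit : ∀ r → r x ≡ 0ℤ → ((1ℤ , x) ∷ zeros xs) ∙ r ≡ 0ℤ
    unit r rx rewrite rx = trans (+-identityˡ _)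
      (trans (∑-map _ xs _) (∑-zero xs (λ {y} _ → *-zeroˡ (r y))))
  ... | some r rest rx≢0 len all
      with kernel-vector (map (λ r′ y → r x * r′ y + (- r′ x) * r y) rest) xs
             (subst (ℕ._< _) (sym (length-map _ rest)) (ℕ.s<s⁻¹ (subst (ℕ._< _) len lt)))
  ... | L , eq , nz , zs = L′ , cong (x ∷_) (trans (map-scale (r x) L) eq) , there (scale-nonzero L rx≢0 nz)
      , all pivot-row (All.map (λ {r′} → other-row r′) (All.map⁻ zs))
    where
    -- Back substitution without division: the solution of the eliminated rows is multiplied by the
    -- pivot `r x`, and the coefficient at x then makes the pivot row vanish.
    L′ = (- (L ∙ r) , x) ∷ scale (r x) L
    pivot-row : L′ ∙ r ≡ 0ℤ
    pivot-row rewrite ∙-scale (r x) L r = lemma (L ∙ r) (r x)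
      where lemma : ∀ a b → (- a) * b + b * a ≡ 0ℤ
            lemma = solve-∀
    other-row : ∀ r′ → L ∙ (λ y → r x * r′ y + (- r′ x) * r y) ≡ 0ℤ → L′ ∙ r′ ≡ 0ℤ
    other-row r′ z rewrite ∙-scale (r x) L r′ = trans (lemma (L ∙ r) (r′ x) (r x) (L ∙ r′))
      (trans (sym (trans (∙-+ L _ _) (cong₂ _+_ (∙-* L (r x) r′) (∙-* L (- r′ x) r)))) z)
      where lemma : ∀ a b c d → (- a) * b + c * d ≡ c * d + (- b) * a
            lemma = solve-∀

  -- Isolates a diagonal term: since the points are distinct, every point left in `M` differs from
  -- that of `p`. Quantifying over `f` takes the place of a permutation.
  split-off : ∀ {L : Combination A} {p} → Unique (map proj₂ L) → p ∈ L →
              Σ (Combination A) λ M → (∀ f → ∑ L f ≡ f p + ∑ M f) × length L ≡ suc (length M) ×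
                (∀ {q} → q ∈ M → q ∈ L × proj₂ p ≢ proj₂ q)
  split-off {L = p ∷ L} (px ∷ _) (here refl) =
    L , (λ f → refl) , refl , λ q∈L → there q∈L , All.lookup (All.map⁻ px) q∈L
  split-off {L = q ∷ L} {p} (qx ∷ un) (there p∈L) with split-off un p∈L
  ... | M , eq , len , sep = q ∷ M
      , (λ f → trans (cong (_+_ (f q)) (eq f)) (lemma (f q) (f p) (∑ M f))) , cong suc len
      , λ { (here refl) → here refl , λ e → All.lookup (All.map⁻ qx) p∈L (sym e)
          ; (there r∈M) → there (proj₁ (sep r∈M)) , proj₂ (sep r∈M) }
    where lemma : ∀ a b c → a + (b + c) ≡ b + (a + c)
          lemma = solve-∀

  -- The Boolean lattice.

  layer : ∀ n → ℕ → List (Vec Bool n)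
  layer zero    zero    = [] ∷ []
  layer zero    (suc k) = []
  layer (suc n) zero    = map (false ∷_) (layer n zero)
  layer (suc n) (suc k) = map (true ∷_) (layer n k) ++ map (false ∷_) (layer n (suc k))

  length-layer : ∀ n k → length (layer n k) ≡ n C k
  length-layer zero    zero    = refl
  length-layer zero    (suc k) = refl
  length-layer (suc n) zero    = trans (length-map _ (layer n zero)) (length-layer n zero)
  length-layer (suc n) (suc k) = trans (length-++ (map (true ∷_) (layer n k)))
    (trans (cong₂ ℕ._+_ (trans (length-map _ (layer n k)) (length-layer n k))
                        (trans (length-map _ (layer n (suc k))) (length-layer n (suc k))))
           (nCk+nC[k+1]≡[n+1]C[k+1] n k))

  weight-layer : ∀ n k {x} → x ∈ layer n k → weight x ≡ k
  weight-layer zero    zero    (here refl) = refl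
  weight-layer (suc n) zero    x∈ with ∈-map⁻ (false ∷_) x∈
  ... | y , y∈ , refl = weight-layer n zero y∈
  weight-layer (suc n) (suc k) x∈ with ∈-++⁻ (map (true ∷_) (layer n k)) x∈
  ... | inj₁ x∈ˡ with ∈-map⁻ (true ∷_) x∈ˡ
  ...   | y , y∈ , refl = cong suc (weight-layer n k y∈)
  weight-layer (suc n) (suc k) x∈ | inj₂ x∈ʳ with ∈-map⁻ (false ∷_) x∈ʳ
  ...   | y , y∈ , refl = weight-layer n (suc k) y∈

  unique-layer : ∀ n k → Unique (layer n k)
  unique-layer zero    zero    = [] ∷ []
  unique-layer zero    (suc k) = []
  unique-layer (suc n) zero    = Unique.map⁺ Vec.∷-injectiveʳ (unique-layer n zero)
  unique-layer (suc n) (suc k) = Unique.++⁺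
    (Unique.map⁺ Vec.∷-injectiveʳ (unique-layer n k))
    (Unique.map⁺ Vec.∷-injectiveʳ (unique-layer n (suc k)))
    λ (x∈ˡ , x∈ʳ) → disjoint (∈-map⁻ (true ∷_) x∈ˡ) (∈-map⁻ (false ∷_) x∈ʳ)
    where
    disjoint : ∀ {x} → (∃ λ y → y ∈ layer n k × x ≡ true ∷ y) →
               (∃ λ y → y ∈ layer n (suc k) × x ≡ false ∷ y) → _
    disjoint (_ , _ , refl) (_ , _ , ())

  ∑-layer : ∀ n k (f : Vec Bool (suc n) → ℤ) →
            ∑ (layer (suc n) (suc k)) f ≡ ∑ (layer n k) (f ∘ (true ∷_)) + ∑ (layer n (suc k)) (f ∘ (false ∷_))
  ∑-layer n k f = trans (∑-++ (map (true ∷_) (layer n k)) _ f) (cong₂ _+_ (∑-map _ (layer n k) f) (∑-map _ (layer n (suc k)) f))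

  -- Sets are 0/1 vectors: U sums over the sets with one element fewer, D over those with one more.
  U D : (Vec Bool n → ℤ) → Vec Bool n → ℤ
  U f []          = 0ℤ
  U f (true ∷ T)  = f (false ∷ T) + U (f ∘ (true ∷_)) T
  U f (false ∷ T) = U (f ∘ (false ∷_)) T
  D f []          = 0ℤ
  D f (true ∷ T)  = D (f ∘ (true ∷_)) T
  D f (false ∷ T) = f (true ∷ T) + D (f ∘ (false ∷_)) T

  private
    interchange : ∀ a b c d → (a + b) + (c + d) ≡ (a + c) + (b + d)
    interchange = solve-∀

  U-+ : ∀ (f g : Vec Bool n → ℤ) T → U (λ S → f S + g S) T ≡ U f T + U g T
  U-+ f g []          = refl
  U-+ f g (true ∷ T)  = trans (cong (_+_ (f (false ∷ T) + g (false ∷ T))) (U-+ _ _ T)) (interchange (f (false ∷ T)) _ _ _)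
  U-+ f g (false ∷ T) = U-+ _ _ T

  D-+ : ∀ (f g : Vec Bool n → ℤ) T → D (λ S → f S + g S) T ≡ D f T + D g T
  D-+ f g []          = refl
  D-+ f g (true ∷ T)  = D-+ _ _ T
  D-+ f g (false ∷ T) = trans (cong (_+_ (f (true ∷ T) + g (true ∷ T))) (D-+ _ _ T)) (interchange (f (true ∷ T)) _ _ _)

  U-0 : ∀ (T : Vec Bool n) → U (λ _ → 0ℤ) T ≡ 0ℤ
  U-0 []          = refl
  U-0 (true ∷ T)  = trans (+-identityˡ _) (U-0 T)
  U-0 (false ∷ T) = U-0 T

  D-0 : ∀ (T : Vec Bool n) → D (λ _ → 0ℤ) T ≡ 0ℤ
  D-0 []          = refl
  D-0 (true ∷ T)  = D-0 T
  D-0 (false ∷ T) = trans (+-identityˡ _) (D-0 T)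

  U-* : ∀ c (f : Vec Bool n → ℤ) T → U (λ S → c * f S) T ≡ c * U f T
  U-* c f []          = sym (*-zeroʳ c)
  U-* c f (true ∷ T)  = trans (cong (_+_ (c * f (false ∷ T))) (U-* c _ T)) (sym (*-distribˡ-+ c _ _))
  U-* c f (false ∷ T) = U-* c _ T

  D-* : ∀ c (f : Vec Bool n → ℤ) T → D (λ S → c * f S) T ≡ c * D f T
  D-* c f []          = sym (*-zeroʳ c)
  D-* c f (true ∷ T)  = D-* c _ T
  D-* c f (false ∷ T) = trans (cong (_+_ (c * f (true ∷ T))) (D-* c _ T)) (sym (*-distribˡ-+ c _ _))

  U-∙ : ∀ {A : Set} (L : Combination A) (f : A → Vec Bool n → ℤ) T → U (λ S → L ∙ λ a → f a S) T ≡ L ∙ λ a → U (f a) T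
  U-∙ []      f T = U-0 T
  U-∙ (p ∷ L) f T = trans (U-+ _ _ T) (cong₂ _+_ (U-* (proj₁ p) _ T) (U-∙ L f T))

  D-∙ : ∀ {A : Set} (L : Combination A) (f : A → Vec Bool n → ℤ) T → D (λ S → L ∙ λ a → f a S) T ≡ L ∙ λ a → D (f a) T
  D-∙ []      f T = D-0 T
  D-∙ (p ∷ L) f T = trans (D-+ _ _ T) (cong₂ _+_ (D-* (proj₁ p) _ T) (D-∙ L f T))

  -- Both composites exchange an element of T for one outside, and do so alike. They differ in how
  -- often they return to T itself: n - |T| times for `D (U f)`, |T| times for `U (D f)`. This is
  -- the sl₂ relation of the Boolean lattice.
  DU-UD : ∀ (f : Vec Bool n → ℤ) T → D (U f) T ≡ U (D f) T + (+ n - + 2 * + weight T) * f T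
  DU-UD f []          = sym (trans (+-identityˡ _) (*-zeroˡ (f [])))
  DU-UD {suc n} f (true ∷ T) = trans (D-+ _ _ T) (trans
    (cong (_+_ (D (f ∘ (false ∷_)) T)) (DU-UD (f ∘ (true ∷_)) T))
    (lemma (D (f ∘ (false ∷_)) T) _ (f (true ∷ T)) (+ n) (+ weight T)))
    where lemma : ∀ a b c m t → a + (b + (m - + 2 * t) * c) ≡ (c + a + b) + ((1ℤ + m) - + 2 * (1ℤ + t)) * c
          lemma = solve-∀
  DU-UD {suc n} f (false ∷ T) = trans
    (cong (_+_ (f (false ∷ T) + U (f ∘ (true ∷_)) T)) (DU-UD (f ∘ (false ∷_)) T))
    (trans (lemma (f (false ∷ T)) (U (f ∘ (true ∷_)) T) _ (+ n) (+ weight T))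
      (cong (λ s → s + (+ suc n - + 2 * + weight T) * f (false ∷ T)) (sym (U-+ _ _ T))))
    where lemma : ∀ c a b m t → (c + a) + (b + (m - + 2 * t) * c) ≡ (a + b) + ((1ℤ + m) - + 2 * t) * c
          lemma = solve-∀

  -- Double counting of the pairs S ⊂ T where T has one element more. In the recursion, `s₁`, `s₂`
  -- and `s₃` collect the pairs whose first coordinate lies in T only, in both, and in neither.
  U-D-adjoint : ∀ n k (f g : Vec Bool n → ℤ) →
                ∑ (layer n (suc k)) (λ T → g T * U f T) ≡ ∑ (layer n k) (λ S → D g S * f S)
  U-D-adjoint zero    zero    f g = sym (trans (+-identityʳ _) (*-zeroˡ (f [])))
  U-D-adjoint zero    (suc k) f g = refl
  U-D-adjoint (suc n) zero    f g = begin
    ∑ (layer (suc n) 1) (λ T → g T * U f T)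
      ≡⟨ ∑-layer n 0 _ ⟩
    ∑ (layer n 0) (λ T → g (true ∷ T) * (f (false ∷ T) + U (f ∘ (true ∷_)) T)) + ∑ (layer n 1) (λ T → g (false ∷ T) * U (f ∘ (false ∷_)) T)
      ≡⟨ cong₂ _+_ (∑-cong (layer n 0) (λ {T} T∈ → cong (λ u → g (true ∷ T) * u)
           (trans (cong (_+_ (f (false ∷ T))) (U-layer0 n (f ∘ (true ∷_)) T∈)) (+-identityʳ _))))
           (U-D-adjoint n 0 (f ∘ (false ∷_)) (g ∘ (false ∷_))) ⟩
    ∑ (layer n 0) (λ T → g (true ∷ T) * f (false ∷ T)) + ∑ (layer n 0) (λ T → D (g ∘ (false ∷_)) T * f (false ∷ T))
      ≡⟨ sym (∑-+ (layer n 0) _ _) ⟩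
    ∑ (layer n 0) (λ T → g (true ∷ T) * f (false ∷ T) + D (g ∘ (false ∷_)) T * f (false ∷ T))
      ≡⟨ ∑-cong (layer n 0) (λ {T} _ → sym (*-distribʳ-+ (f (false ∷ T)) (g (true ∷ T)) _)) ⟩
    ∑ (layer n 0) (λ T → D g (false ∷ T) * f (false ∷ T))
      ≡⟨ sym (∑-map _ (layer n 0) _) ⟩
    ∑ (layer (suc n) 0) (λ S → D g S * f S) ∎
    where
    open ≡-Reasoning
    U-layer0 : ∀ n (f : Vec Bool n → ℤ) {T} → T ∈ layer n 0 → U f T ≡ 0ℤ
    U-layer0 zero    f (here refl) = refl
    U-layer0 (suc n) f T∈ with ∈-map⁻ (false ∷_) T∈
    ... | S , S∈ , refl = U-layer0 n _ S∈
  U-D-adjoint (suc n) (suc k) f g = begin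
    ∑ (layer (suc n) (2 ℕ.+ k)) (λ T → g T * U f T)
      ≡⟨ ∑-layer n (suc k) _ ⟩
    ∑ (layer n (suc k)) (λ T → g (true ∷ T) * (f (false ∷ T) + U (f ∘ (true ∷_)) T)) + ∑ (layer n (2 ℕ.+ k)) (λ T → g (false ∷ T) * U (f ∘ (false ∷_)) T)
      ≡⟨ cong₂ _+_ (trans (∑-cong (layer n (suc k)) (λ {T} _ → *-distribˡ-+ (g (true ∷ T)) _ _)) (∑-+ (layer n (suc k)) _ _))
           (U-D-adjoint n (suc k) (f ∘ (false ∷_)) (g ∘ (false ∷_))) ⟩
    (s₁ + ∑ (layer n (suc k)) (λ T → g (true ∷ T) * U (f ∘ (true ∷_)) T)) + s₃
      ≡⟨ cong (λ s → (s₁ + s) + s₃) (U-D-adjoint n k (f ∘ (true ∷_)) (g ∘ (true ∷_))) ⟩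
    (s₁ + s₂) + s₃
      ≡⟨ lemma s₁ s₂ s₃ ⟩
    s₂ + (s₁ + s₃)
      ≡⟨ cong (_+_ s₂) (sym (∑-+ (layer n (suc k)) _ _)) ⟩
    s₂ + ∑ (layer n (suc k)) (λ T → g (true ∷ T) * f (false ∷ T) + D (g ∘ (false ∷_)) T * f (false ∷ T))
      ≡⟨ cong (_+_ s₂) (∑-cong (layer n (suc k)) (λ {T} _ → sym (*-distribʳ-+ (f (false ∷ T)) (g (true ∷ T)) _))) ⟩
    s₂ + ∑ (layer n (suc k)) (λ T → D g (false ∷ T) * f (false ∷ T))
      ≡⟨ sym (∑-layer n k _) ⟩
    ∑ (layer (suc n) (suc k)) (λ S → D g S * f S) ∎
    where
    open ≡-Reasoning
    s₁  = ∑ (layer n (suc k)) (λ T → g (true ∷ T) * f (false ∷ T))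
    s₂  = ∑ (layer n k) (λ S → D (g ∘ (true ∷_)) S * f (true ∷ S))
    s₃ = ∑ (layer n (suc k)) (λ S → D (g ∘ (false ∷_)) S * f (false ∷ S))
    lemma : ∀ a b c → (a + b) + c ≡ b + (a + c)
    lemma = solve-∀

  -- The indicator of T ⊆ x.
  ζ : Vec Bool n → Vec Bool n → ℤ
  ζ []          []          = 1ℤ
  ζ (true ∷ T)  (true ∷ x)  = ζ T x
  ζ (true ∷ T)  (false ∷ x) = 0ℤ
  ζ (false ∷ T) (_ ∷ x)     = ζ T x

  -- If S ⊆ x, exactly |x| - |S| one-element extensions of S stay inside x; otherwise none does and
  -- `ζ S x` is zero. The factor depends on x through its weight only, so it is constant on a code.
  D-ζ : ∀ (S x : Vec Bool n) → D (λ T → ζ T x) S ≡ (+ weight x - + weight S) * ζ S x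
  D-ζ []          []          = refl
  D-ζ (true ∷ S)  (true ∷ x)  = trans (D-ζ S x) (lemma (+ weight x) (+ weight S) (ζ S x))
    where lemma : ∀ a b c → (a - b) * c ≡ ((1ℤ + a) - (1ℤ + b)) * c
          lemma = solve-∀
  D-ζ (true ∷ S)  (false ∷ x) = trans (D-0 S) (sym (*-zeroʳ (+ weight x - + suc (weight S))))
  D-ζ (false ∷ S) (true ∷ x)  = trans (cong (_+_ (ζ S x)) (D-ζ S x)) (lemma (+ weight x) (+ weight S) (ζ S x))
    where lemma : ∀ a b c → c + (a - b) * c ≡ ((1ℤ + a) - b) * c
          lemma = solve-∀
  D-ζ (false ∷ S) (false ∷ x) = trans (+-identityˡ _) (D-ζ S x)

  meet : Vec Bool n → Vec Bool n → ℕ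
  meet []          []         = 0
  meet (true ∷ x)  (true ∷ y) = suc (meet x y)
  meet (true ∷ x)  (false ∷ y) = meet x y
  meet (false ∷ x) (_ ∷ y)    = meet x y

  -- T lies in x and in y exactly when it lies in their intersection. This Gram factorisation links
  -- polynomials in `meet` with the monomials `ζ T`.
  ∑-ζζ : ∀ n k (x y : Vec Bool n) → ∑ (layer n k) (λ T → ζ T x * ζ T y) ≡ + (meet x y C k)
  ∑-ζζ zero    zero    [] [] = refl
  ∑-ζζ zero    (suc k) [] [] = refl
  ∑-ζζ (suc n) zero (a ∷ x) (b ∷ y) = trans (∑-map _ (layer n 0) _) (∑-ζζ n 0 x y)
  ∑-ζζ (suc n) (suc k) (true ∷ x) (true ∷ y) = trans (∑-layer n k _)
    (trans (cong₂ _+_ (∑-ζζ n k x y) (∑-ζζ n (suc k) x y)) (cong +_ (nCk+nC[k+1]≡[n+1]C[k+1] (meet x y) k)))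
  ∑-ζζ (suc n) (suc k) (true ∷ x) (false ∷ y) = trans (∑-layer n k _)
    (trans (cong₂ _+_ (∑-zero (layer n k) (λ {T} _ → *-zeroʳ (ζ T x))) (∑-ζζ n (suc k) x y)) (+-identityˡ _))
  ∑-ζζ (suc n) (suc k) (false ∷ x) (b ∷ y) = trans (∑-layer n k _)
    (trans (cong₂ _+_ (∑-zero (layer n k) (λ {T} _ → *-zeroˡ (ζ (true ∷ T) (b ∷ y)))) (∑-ζζ n (suc k) x y)) (+-identityˡ _))

  -- Integrality of the distances.

  hamming+2meet : ∀ (x y : Vec Bool n) → hamming x y ℕ.+ meet x y ℕ.* 2 ≡ weight x ℕ.+ weight y
  hamming+2meet []          []          = refl
  hamming+2meet (true ∷ x)  (true ∷ y)  = begin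
    hamming x y ℕ.+ (2 ℕ.+ meet x y ℕ.* 2) ≡⟨ ℕ.+-suc (hamming x y) _ ⟩
    suc (hamming x y ℕ.+ (1 ℕ.+ meet x y ℕ.* 2)) ≡⟨ cong suc (ℕ.+-suc (hamming x y) _) ⟩
    2 ℕ.+ (hamming x y ℕ.+ meet x y ℕ.* 2) ≡⟨ cong (2 ℕ.+_) (hamming+2meet x y) ⟩
    2 ℕ.+ (weight x ℕ.+ weight y) ≡⟨ cong suc (sym (ℕ.+-suc (weight x) _)) ⟩
    suc (weight x) ℕ.+ suc (weight y) ∎
    where open ≡-Reasoning
  hamming+2meet (true ∷ x)  (false ∷ y) = cong suc (hamming+2meet x y)
  hamming+2meet (false ∷ x) (true ∷ y)  = trans (cong suc (hamming+2meet x y)) (sym (ℕ.+-suc (weight x) _))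
  hamming+2meet (false ∷ x) (false ∷ y) = hamming+2meet x y

  meet≤weight : ∀ (x y : Vec Bool n) → meet x y ℕ.≤ weight x
  meet≤weight []          []          = ℕ.z≤n
  meet≤weight (true ∷ x)  (true ∷ y)  = ℕ.s≤s (meet≤weight x y)
  meet≤weight (true ∷ x)  (false ∷ y) = ℕ.m≤n⇒m≤1+n (meet≤weight x y)
  meet≤weight (false ∷ x) (b ∷ y)     = meet≤weight x y

  τ+meet : ∀ (x y : Vec Bool n) → weight x ≡ w → weight y ≡ w → τ x y ℕ.+ meet x y ≡ w
  τ+meet x y refl wy = begin
    hamming x y ℕ./ 2 ℕ.+ meet x y ≡⟨ cong (λ h → h ℕ./ 2 ℕ.+ meet x y) twice ⟩
    ((weight x ℕ.∸ meet x y) ℕ.* 2) ℕ./ 2 ℕ.+ meet x y ≡⟨ cong (ℕ._+ meet x y) (m*n/n≡m _ 2) ⟩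
    weight x ℕ.∸ meet x y ℕ.+ meet x y ≡⟨ ℕ.m∸n+n≡m (meet≤weight x y) ⟩
    weight x ∎
    where
    open ≡-Reasoning
    twice : hamming x y ≡ (weight x ℕ.∸ meet x y) ℕ.* 2
    twice = trans (sym (ℕ.m+n∸n≡m (hamming x y) (meet x y ℕ.* 2)))
      (trans (cong (ℕ._∸ meet x y ℕ.* 2) (trans (hamming+2meet x y)
        (trans (cong (weight x ℕ.+_) (trans wy (sym (ℕ.+-identityʳ (weight x))))) (ℕ.*-comm 2 (weight x)))))
        (sym (ℕ.*-distribʳ-∸ 2 (weight x) (meet x y))))

  meet-self : ∀ (x : Vec Bool n) → meet x x ≡ weight x
  meet-self []          = refl
  meet-self (true ∷ x)  = cong suc (meet-self x)
  meet-self (false ∷ x) = meet-self x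

  τ-self : ∀ (x : Vec Bool n) → τ x x ≡ 0
  τ-self x = ℕ.+-cancelʳ-≡ (meet x x) (τ x x) 0 (trans (τ+meet x x refl refl) (sym (meet-self x)))

  -- Newton's basis: a list of coefficients stands for Σ cᵢ (m C (k + i)).
  newton : ℕ → List ℤ → ℕ → ℤ
  newton k []       m = 0ℤ
  newton k (c ∷ cs) m = c * + (m C k) + newton (suc k) cs m

  absorption : ∀ m k → + suc k * + (m C suc k) ≡ (+ m - + k) * + (m C k)
  absorption zero    zero    = refl
  absorption zero    (suc k) = trans (*-zeroʳ (+ (2 ℕ.+ k))) (sym (*-zeroʳ (+ 0 - + suc k)))
  absorption (suc m) zero    = begin
    1ℤ * + (suc m C 1) ≡⟨ cong (λ c → 1ℤ * + c) (sym (nCk+nC[k+1]≡[n+1]C[k+1] m 0)) ⟩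
    1ℤ * (1ℤ + + (m C 1)) ≡⟨ l₁ (+ (m C 1)) ⟩
    1ℤ + 1ℤ * + (m C 1) ≡⟨ cong (_+_ 1ℤ) (absorption m 0) ⟩
    1ℤ + (+ m - + 0) * 1ℤ ≡⟨ l₂ (+ m) ⟩
    (1ℤ + + m - + 0) * 1ℤ ∎
    where
    open ≡-Reasoning
    l₁ : ∀ c → 1ℤ * (1ℤ + c) ≡ 1ℤ + 1ℤ * c
    l₁ = solve-∀
    l₂ : ∀ c → 1ℤ + (c - 0ℤ) * 1ℤ ≡ (1ℤ + c - 0ℤ) * 1ℤ
    l₂ = solve-∀
  absorption (suc m) (suc k) = begin
    + (2 ℕ.+ k) * + (suc m C (2 ℕ.+ k)) ≡⟨ cong (λ c → + (2 ℕ.+ k) * + c) (sym (nCk+nC[k+1]≡[n+1]C[k+1] m (suc k))) ⟩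
    + (2 ℕ.+ k) * (c₁ + c₂) ≡⟨ *-distribˡ-+ (+ (2 ℕ.+ k)) c₁ c₂ ⟩
    + (2 ℕ.+ k) * c₁ + + (2 ℕ.+ k) * c₂ ≡⟨ cong (_+_ (+ (2 ℕ.+ k) * c₁)) (absorption m (suc k)) ⟩
    + (2 ℕ.+ k) * c₁ + (+ m - + suc k) * c₁ ≡⟨ l₁ (+ k) (+ m) c₁ ⟩
    + suc k * c₁ + (+ m - + k) * c₁ ≡⟨ cong (λ s → s + (+ m - + k) * c₁) (absorption m k) ⟩
    (+ m - + k) * c₀ + (+ m - + k) * c₁ ≡⟨ l₂ (+ k) (+ m) c₀ c₁ ⟩
    (+ suc m - + suc k) * (c₀ + c₁) ≡⟨ cong (λ c → (+ suc m - + suc k) * + c) (nCk+nC[k+1]≡[n+1]C[k+1] m k) ⟩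
    (+ suc m - + suc k) * + (suc m C suc k) ∎
    where
    open ≡-Reasoning
    c₀ = + (m C k)
    c₁ = + (m C suc k)
    c₂ = + (m C (2 ℕ.+ k))
    l₁ : ∀ k m c → (+ 2 + k) * c + (m - (1ℤ + k)) * c ≡ (1ℤ + k) * c + (m - k) * c
    l₁ = solve-∀
    l₂ : ∀ k m c d → (m - k) * c + (m - k) * d ≡ ((1ℤ + m) - (1ℤ + k)) * (c + d)
    l₂ = solve-∀

  -- Multiplication by m - a in Newton's basis: m C(m,k) = k C(m,k) + (k + 1) C(m,k+1), so a
  -- coefficient c leaves (k - a) c in its place and passes (k + 1) c on as `carry`.
  times : ℤ → ℕ → ℤ → List ℤ → List ℤ
  times a k carry []       = carry ∷ []
  times a k carry (c ∷ cs) = (carry + (+ k - a) * c) ∷ times a (suc k) (+ suc k * c) cs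

  newton-times : ∀ a k carry cs m →
    newton k (times a k carry cs) m ≡ carry * + (m C k) + (+ m - a) * newton k cs m
  newton-times a k carry [] m = cong (_+_ (carry * + (m C k))) (sym (*-zeroʳ (+ m - a)))
  newton-times a k carry (c ∷ cs) m = begin
    (carry + (+ k - a) * c) * b + newton (suc k) (times a (suc k) (+ suc k * c) cs) m
      ≡⟨ cong (_+_ ((carry + (+ k - a) * c) * b)) (newton-times a (suc k) (+ suc k * c) cs m) ⟩
    (carry + (+ k - a) * c) * b + (+ suc k * c * + (m C suc k) + rest)
      ≡⟨ cong (λ s → (carry + (+ k - a) * c) * b + (s + rest))
           (trans (l₁ (+ suc k) c (+ (m C suc k))) (cong (λ s → c * s) (absorption m k))) ⟩
    (carry + (+ k - a) * c) * b + (c * ((+ m - + k) * b) + rest)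
      ≡⟨ l₂ carry (+ k) a c b (+ m) (newton (suc k) cs m) ⟩
    carry * b + (+ m - a) * (c * b + newton (suc k) cs m) ∎
    where
    open ≡-Reasoning
    b    = + (m C k)
    rest = (+ m - a) * newton (suc k) cs m
    l₁ : ∀ s c t → s * c * t ≡ c * (s * t)
    l₁ = solve-∀
    l₂ : ∀ y k a c b m r → (y + (k - a) * c) * b + (c * ((m - k) * b) + (m - a) * r) ≡ y * b + (m - a) * (c * b + r)
    l₂ = solve-∀

  monic : List ℤ → ℕ → ℤ
  monic []       m = 1ℤ
  monic (a ∷ as) m = (+ m - a) * monic as m

  coefficients : List ℤ → List ℤ
  coefficients []       = 1ℤ ∷ []
  coefficients (a ∷ as) = times a 0 0ℤ (coefficients as)

  newton-coefficients : ∀ as m → newton 0 (coefficients as) m ≡ monic as m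
  newton-coefficients []       m = refl
  newton-coefficients (a ∷ as) m = trans (newton-times a 0 0ℤ (coefficients as) m)
    (trans (+-identityˡ _) (cong (λ s → (+ m - a) * s) (newton-coefficients as m)))

  ∙-meet : ∀ k (L : Combination (Vec Bool n)) x →
           L ∙ (λ y → + (meet x y C k)) ≡ ∑ (layer n k) (λ T → ζ T x * L ∙ ζ T)
  ∙-meet {n} k L x = begin
    L ∙ (λ y → + (meet x y C k)) ≡⟨ ∙-cong L (λ {p} _ → sym (∑-ζζ n k x (proj₂ p))) ⟩
    L ∙ (λ y → ∑ (layer n k) (λ T → ζ T x * ζ T y))
      ≡⟨ ∑-cong L (λ {p} _ → sym (∑-*ˡ (proj₁ p) (layer n k) _)) ⟩
    ∑ L (λ p → ∑ (layer n k) (λ T → proj₁ p * (ζ T x * ζ T (proj₂ p)))) ≡⟨ ∑-swap L (layer n k) _ ⟩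
    ∑ (layer n k) (λ T → L ∙ λ y → ζ T x * ζ T y) ≡⟨ ∑-cong (layer n k) (λ {T} _ → ∙-* L (ζ T x) (ζ T)) ⟩
    ∑ (layer n k) (λ T → ζ T x * L ∙ ζ T) ∎
    where open ≡-Reasoning

  -- Each binomial in `meet x y` is a combination of the monomials `ζ T y` with |T| equal to its
  -- lower index, so orthogonality to these monomials suffices.
  ∙-newton : ∀ k cs (L : Combination (Vec Bool n)) x →
             (∀ {i T} → i ℕ.< length cs → T ∈ layer n (k ℕ.+ i) → L ∙ ζ T ≡ 0ℤ) →
             L ∙ (λ y → newton k cs (meet x y)) ≡ 0ℤ
  ∙-newton k []       L x z = ∑-zero L (λ {p} _ → *-zeroʳ (proj₁ p))
  ∙-newton {n} k (c ∷ cs) L x z = begin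
    L ∙ (λ y → c * + (meet x y C k) + newton (suc k) cs (meet x y)) ≡⟨ ∙-+ L _ _ ⟩
    L ∙ (λ y → c * + (meet x y C k)) + L ∙ (λ y → newton (suc k) cs (meet x y))
      ≡⟨ cong₂ _+_ (trans (∙-* L c (λ y → + (meet x y C k))) (trans (cong (λ s → c * s) first) (*-zeroʳ c)))
           (∙-newton (suc k) cs L x λ {i} {T} i< T∈ → z (ℕ.s<s i<) (subst (λ j → T ∈ layer n j) (sym (ℕ.+-suc k i)) T∈)) ⟩
    0ℤ ∎
    where
    open ≡-Reasoning
    first : L ∙ (λ y → + (meet x y C k)) ≡ 0ℤ
    first = trans (∙-meet k L x) (∑-zero (layer n k) λ {T} T∈ →
      trans (cong (λ s → ζ T x * s) (z ℕ.z<s (subst (λ j → T ∈ layer n j) (sym (ℕ.+-identityʳ k)) T∈))) (*-zeroʳ (ζ T x)))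

  -- Divisibility by the gcd of the coefficients

  content : ∀ {A : Set} → Combination A → ℕ
  content []      = 0
  content (p ∷ L) = gcd ∣ proj₁ p ∣ (content L)

  content∣ : ∀ {A : Set} (L : Combination A) {p} → p ∈ L → content L ∣ ∣ proj₁ p ∣
  content∣ (p ∷ L) (here refl) = gcd[m,n]∣m ∣ proj₁ p ∣ (content L)
  content∣ (q ∷ L) (there p∈L) = ∣-trans (gcd[m,n]∣n ∣ proj₁ q ∣ (content L)) (content∣ L p∈L)

  -- Multiplication by a commutes with the gcd. The factor is carried along because `integrality`
  -- obtains divisors of α times each coefficient, not of the coefficient.
  content-greatest : ∀ {A : Set} (L : Combination A) a {d} → (∀ {p} → p ∈ L → d ∣ a ℕ.* ∣ proj₁ p ∣) → d ∣ a ℕ.* content L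
  content-greatest []      a {d} div = subst (d ∣_) (sym (ℕ.*-zeroʳ a)) (d Data.Nat.Divisibility.∣0)
  content-greatest (p ∷ L) a {d} div = subst (d ∣_) (sym (c*gcd[m,n]≡gcd[cm,cn] a ∣ proj₁ p ∣ (content L)))
    (gcd-greatest (div (here refl)) (content-greatest L a (div ∘ there)))

  content≢0 : ∀ {A : Set} {L : Combination A} → Nonzero L → content L ≢ 0
  content≢0 {L = L} nz c≡0 = go L (λ {p} p∈L → 0∣⇒≡0 (subst (_∣ ∣ proj₁ p ∣) c≡0 (content∣ L p∈L))) nz
    where
    go : ∀ (L : Combination _) → (∀ {p} → p ∈ L → ∣ proj₁ p ∣ ≡ 0) → ¬ Nonzero L
    go (p ∷ L) z (here p≢0) = p≢0 (∣i∣≡0⇒i≡0 (z (here refl)))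
    go (p ∷ L) z (there nz) = go L (z ∘ there) nz

  ∑-divisible : ∀ {A : Set} (xs : List A) {f : A → ℤ} {d} → (∀ {x} → x ∈ xs → d ∣ℤ f x) → d ∣ℤ ∑ xs f
  ∑-divisible []       div = divides 0ℤ refl
  ∑-divisible (x ∷ xs) {d = d} div with div (here refl) | ∑-divisible xs (div ∘ there)
  ... | divides q eq | divides r eq′ = divides (q + r) (trans (cong₂ _+_ eq eq′) (sym (*-distribʳ-+ d q r)))

  -- `ds` lists admissible distances in any order, so a code can be reordered to bring any distance
  -- to the front, and padded with zeros.
  record Code (n w : ℕ) (ds : List ℕ) (X : List (Vec Bool n)) : Set where
    field
      unique   : Unique X
      weights  : ∀ {x} → x ∈ X → weight x ≡ w
      distance : ∀ {x y} → x ∈ X → y ∈ X → x ≢ y → τ x y ∈ ds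

  gap : List ℕ → ℕ → ℤ
  gap []       t = 1ℤ
  gap (d ∷ ds) t = (+ d - + t) * gap ds t

  gap-∈ : ∀ {ds t} → t ∈ ds → gap ds t ≡ 0ℤ
  gap-∈ {d ∷ ds}     (here refl) = trans (cong (λ s → s * gap ds d) (+-inverseʳ (+ d))) (*-zeroˡ (gap ds d))
  gap-∈ {d ∷ ds} {t} (there t∈)  = trans (cong (λ s → (+ d - + t) * s) (gap-∈ t∈)) (*-zeroʳ (+ d - + t))

  roots : ℕ → List ℕ → List ℤ
  roots w = map (λ d → + w - + d)

  -- With m = w - t, the factor m - (w - d) equals d - t. So the product that vanishes at the
  -- distances is a monic polynomial in `meet`, of one degree per distance.
  monic-roots : ∀ {t m} ds → t ℕ.+ m ≡ w → monic (roots w ds) m ≡ gap ds t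
  monic-roots []               eq   = refl
  monic-roots {t = t} {m} (d ∷ ds) refl = cong₂ _*_ (lemma (+ t) (+ m) (+ d)) (monic-roots {t = t} ds refl)
    where lemma : ∀ t m d → m - (t + m - d) ≡ d - t
          lemma = solve-∀

  -- The Larman-Rogers-Seidel argument with a gcd in place of an eigenvalue. Let g be the content of
  -- a kernel vector c. For every x in X the cubic `P` gives α c_x + Σ P x y c_y = 0, the sum being
  -- over y ≠ x, where P x y is β or 0 and g divides every c_y. So g β divides α c_x for all x,
  -- hence also α g, and g ≠ 0 cancels.
  integrality : ∀ {X : List (Vec Bool n)} {e a b c} → Code n w (e ∷ a ∷ b ∷ c ∷ []) X →
                n C 0 ℕ.+ (n C 1 ℕ.+ (n C 2 ℕ.+ n C 3)) ℕ.< length X →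
                ∣ gap (a ∷ b ∷ c ∷ []) e ∣ ∣ ∣ gap (a ∷ b ∷ c ∷ []) 0 ∣
  integrality {n} {w} {X} {e} {a} {b} {c} code large = conclude
    (kernel-vector (map ζ sets) X (subst (ℕ._< length X) (sym number) large))
    where
    open Code code
    sets : List (Vec Bool n)
    sets = layer n 0 ++ (layer n 1 ++ (layer n 2 ++ layer n 3))
    number : length (map ζ sets) ≡ n C 0 ℕ.+ (n C 1 ℕ.+ (n C 2 ℕ.+ n C 3))
    number = trans (length-map ζ sets) (trans (length-++ (layer n 0)) (cong₂ ℕ._+_ (length-layer n 0)
      (trans (length-++ (layer n 1)) (cong₂ ℕ._+_ (length-layer n 1)
      (trans (length-++ (layer n 2)) (cong₂ ℕ._+_ (length-layer n 2) (length-layer n 3)))))))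
    in-sets : ∀ {i T} → i ℕ.< 4 → T ∈ layer n i → T ∈ sets
    in-sets {0} _ T∈ = ∈-++⁺ˡ T∈
    in-sets {1} _ T∈ = ∈-++⁺ʳ (layer n 0) (∈-++⁺ˡ T∈)
    in-sets {2} _ T∈ = ∈-++⁺ʳ (layer n 0) (∈-++⁺ʳ (layer n 1) (∈-++⁺ˡ T∈))
    in-sets {3} _ T∈ = ∈-++⁺ʳ (layer n 0) (∈-++⁺ʳ (layer n 1) (∈-++⁺ʳ (layer n 2) T∈))
    in-sets {suc (suc (suc (suc _)))} (ℕ.s≤s (ℕ.s≤s (ℕ.s≤s (ℕ.s≤s ())))) T∈
    β α : ℤ
    β = gap (a ∷ b ∷ c ∷ []) e
    α = gap (a ∷ b ∷ c ∷ []) 0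
    abc = a ∷ b ∷ c ∷ []
    P : Vec Bool n → Vec Bool n → ℤ
    P x y = monic (roots w abc) (meet x y)

    conclude : (Σ (Combination (Vec Bool n)) λ L → map proj₂ L ≡ X × Nonzero L × All (λ r → L ∙ r ≡ 0ℤ) (map ζ sets)) →
               ∣ β ∣ ∣ ∣ α ∣
    conclude (L , points , nz , zs) = *-cancelˡ-∣ (content L) {{ℕ.≢-nonZero (content≢0 nz)}}
        (subst₂ _∣_ refl (ℕ.*-comm ∣ α ∣ (content L)) (content-greatest L ∣ α ∣ each))
      where
      point∈ : ∀ {p} → p ∈ L → proj₂ p ∈ X
      point∈ p∈L = subst (_ ∈_) points (∈-map⁺ proj₂ p∈L)
      eq-τ : ∀ {p q} → p ∈ L → q ∈ L → τ (proj₂ p) (proj₂ q) ℕ.+ meet (proj₂ p) (proj₂ q) ≡ w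
      eq-τ {p} {q} p∈L q∈L = τ+meet (proj₂ p) (proj₂ q) (weights (point∈ p∈L)) (weights (point∈ q∈L))
      annihilated : ∀ x → L ∙ P x ≡ 0ℤ
      annihilated x = trans (∙-cong L (λ {p} _ → sym (newton-coefficients (roots w abc) (meet x (proj₂ p)))))
        (∙-newton 0 (coefficients (roots w abc)) L x (λ i< T∈ → All.lookup (All.map⁻ zs) (in-sets i< T∈)))
      off-diagonal : ∀ (x y : Vec Bool n) {t} → t ℕ.+ meet x y ≡ w → t ∈ e ∷ abc → ∃ λ s → P x y ≡ s * β
      off-diagonal x y eq (here refl) = 1ℤ , trans (monic-roots abc eq) (sym (*-identityˡ β))
      off-diagonal x y eq (there t∈)  = 0ℤ , trans (monic-roots abc eq) (gap-∈ t∈)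
      each : ∀ {p} → p ∈ L → content L ℕ.* ∣ β ∣ ∣ ∣ α ∣ ℕ.* ∣ proj₁ p ∣
      each {p} p∈L = finish (split-off (subst Unique (sym points) unique) p∈L)
        where
        c₀ = proj₁ p
        x  = proj₂ p
        term : ∀ q → q ∈ L → x ≢ proj₂ q → (+ content L * β) ∣ℤ (proj₁ q * P x (proj₂ q))
        term q q∈L x≢y = product (off-diagonal x (proj₂ q) (eq-τ p∈L q∈L) (distance (point∈ p∈L) (point∈ q∈L) x≢y))
            (∣ᵤ⇒∣ {+ content L} {proj₁ q} (content∣ L q∈L))
          where
          lemma : ∀ r g s b → (r * g) * (s * b) ≡ (r * s) * (g * b)
          lemma = solve-∀
          product : (∃ λ s → P x (proj₂ q) ≡ s * β) → + content L ∣ℤ proj₁ q → (+ content L * β) ∣ℤ (proj₁ q * P x (proj₂ q))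
          product (s , eq) (divides r eq′) = divides (r * s) (trans (cong₂ _*_ eq′ eq) (lemma r (+ content L) s β))
        diagonal : P x x ≡ α
        diagonal = monic-roots abc (trans (cong (ℕ._+ meet x x) (sym (τ-self x))) (eq-τ p∈L p∈L))
        combine : ∀ s → c₀ * P x x + s ≡ 0ℤ → (+ content L * β) ∣ℤ s → content L ℕ.* ∣ β ∣ ∣ ∣ α ∣ ℕ.* ∣ c₀ ∣
        combine s zero-sum (divides r eq) = subst₂ _∣_ (abs-* (+ content L) β) (trans (abs-* c₀ α) (ℕ.*-comm ∣ c₀ ∣ ∣ α ∣))
          (∣⇒∣ᵤ {+ content L * β} {c₀ * α} (divides (- r) (begin
            c₀ * α                      ≡⟨ cong (λ t → c₀ * t) (sym diagonal) ⟩
            c₀ * P x x                  ≡⟨ lemma (c₀ * P x x) s ⟩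
            (c₀ * P x x + s) + - s      ≡⟨ cong₂ (λ t u → t + - u) zero-sum eq ⟩
            0ℤ + - (r * (+ content L * β)) ≡⟨ +-identityˡ _ ⟩
            - (r * (+ content L * β))   ≡⟨ neg-distribˡ-* r (+ content L * β) ⟩
            - r * (+ content L * β)     ∎)))
          where
          open ≡-Reasoning
          lemma : ∀ u v → u ≡ (u + v) + - v
          lemma = solve-∀
        finish : (Σ (Combination (Vec Bool n)) λ M → (∀ f → ∑ L f ≡ f p + ∑ M f) × length L ≡ suc (length M) ×
                   (∀ {q} → q ∈ M → q ∈ L × x ≢ proj₂ q)) → content L ℕ.* ∣ β ∣ ∣ ∣ α ∣ ℕ.* ∣ c₀ ∣
        finish (M , sum , _ , sep) = combine (∑ M (λ q → proj₁ q * P x (proj₂ q)))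
          (trans (sym (sum (λ q → proj₁ q * P x (proj₂ q)))) (annihilated x))
          (∑-divisible M (λ {q} q∈M → term q (proj₁ (sep q∈M)) (proj₂ (sep q∈M))))

  -- The rank bound.

  0≤i*i : ∀ i → 0ℤ ≤ i * i
  0≤i*i (+ zero)   = +≤+ ℕ.z≤n
  0≤i*i (+ suc n)  = +≤+ ℕ.z≤n
  0≤i*i -[1+ n ]   = +≤+ ℕ.z≤n

  i*i≡0⇒i≡0 : ∀ i → i * i ≡ 0ℤ → i ≡ 0ℤ
  i*i≡0⇒i≡0 i eq = [ (λ z → z) , (λ z → z) ]′ (i*j≡0⇒i≡0∨j≡0 i eq)

  ∑-squares≤0 : ∀ (xs : List A) (f : A → ℤ) → ∑ xs (λ x → f x * f x) ≤ 0ℤ → ∀ {x} → x ∈ xs → f x ≡ 0ℤ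
  ∑-squares≤0 (x ∷ xs) f le (here refl) = i*i≡0⇒i≡0 (f x) (≤-antisym
    (≤-trans (≤-trans (≤-reflexive (sym (+-identityʳ _))) (+-monoʳ-≤ (f x * f x) (∑-nonneg xs (λ {y} _ → 0≤i*i (f y))))) le)
    (0≤i*i (f x)))
  ∑-squares≤0 (x ∷ xs) f le (there y∈) = ∑-squares≤0 xs f
    (≤-trans (≤-trans (≤-reflexive (sym (+-identityˡ _))) (+-monoˡ-≤ (∑ xs (λ y → f y * f y)) (0≤i*i (f x)))) le) y∈

  positive-cancel : ∀ {a s} → 0ℤ ≤ s → + suc a * s ≤ 0ℤ → s ≤ 0ℤ
  positive-cancel {a} {s} _ le = *-cancelˡ-≤-pos s 0ℤ (+ suc a) (≤-trans le (≤-reflexive (sym (*-zeroʳ (+ suc a)))))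

  -- The image of L under the inclusion matrix between sets and points: a function on the Boolean
  -- lattice, to which `U` and `D` apply.
  _^ζ : Combination (Vec Bool n) → Vec Bool n → ℤ
  (L ^ζ) T = L ∙ ζ T

  Φ : ℕ → Combination (Vec Bool n) → ℤ
  Φ {n} k L = ∑ (layer n k) (λ T → (L ^ζ) T * (L ^ζ) T)

  Φ-meet : ∀ k (L : Combination (Vec Bool n)) → L ∙ (λ x → L ∙ λ y → + (meet x y C k)) ≡ Φ k L
  Φ-meet {n} k L = begin
    L ∙ (λ x → L ∙ λ y → + (meet x y C k))
      ≡⟨ ∙-cong L (λ {p} _ → ∙-meet k L (proj₂ p)) ⟩
    L ∙ (λ x → ∑ (layer n k) (λ T → ζ T x * L ∙ ζ T))
      ≡⟨ ∑-cong L (λ {p} _ → sym (∑-*ˡ (proj₁ p) (layer n k) _)) ⟩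
    ∑ L (λ p → ∑ (layer n k) (λ T → proj₁ p * (ζ T (proj₂ p) * L ∙ ζ T)))
      ≡⟨ ∑-swap L (layer n k) _ ⟩
    ∑ (layer n k) (λ T → ∑ L (λ p → proj₁ p * (ζ T (proj₂ p) * L ∙ ζ T)))
      ≡⟨ ∑-cong (layer n k) (λ {T} _ → trans (∑-cong L (λ {p} _ → sym (*-assoc (proj₁ p) (ζ T (proj₂ p)) (L ∙ ζ T))))
           (∑-*ʳ (L ∙ ζ T) L _)) ⟩
    Φ k L ∎
    where open ≡-Reasoning

  newton-form : ℕ → List ℤ → Combination (Vec Bool n) → ℤ
  newton-form k []       L = 0ℤ
  newton-form k (c ∷ cs) L = c * Φ k L + newton-form (suc k) cs L

  ∙∙-newton : ∀ k cs (L : Combination (Vec Bool n)) →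
              L ∙ (λ x → L ∙ λ y → newton k cs (meet x y)) ≡ newton-form k cs L
  ∙∙-newton k []       L = ∑-zero L (λ {p} _ → trans (cong (λ s → proj₁ p * s) (∑-zero L (λ {q} _ → *-zeroʳ (proj₁ q)))) (*-zeroʳ (proj₁ p)))
  ∙∙-newton k (c ∷ cs) L = begin
    L ∙ (λ x → L ∙ λ y → c * + (meet x y C k) + newton (suc k) cs (meet x y))
      ≡⟨ ∙-cong L (λ {p} _ → trans (∙-+ L (λ y → c * + (meet (proj₂ p) y C k)) (λ y → newton (suc k) cs (meet (proj₂ p) y)))
           (cong (λ s → s + L ∙ λ y → newton (suc k) cs (meet (proj₂ p) y)) (∙-* L c (λ y → + (meet (proj₂ p) y C k))))) ⟩
    L ∙ (λ x → c * (L ∙ λ y → + (meet x y C k)) + L ∙ λ y → newton (suc k) cs (meet x y))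
      ≡⟨ ∙-+ L (λ x → c * (L ∙ λ y → + (meet x y C k))) (λ x → L ∙ λ y → newton (suc k) cs (meet x y)) ⟩
    L ∙ (λ x → c * (L ∙ λ y → + (meet x y C k))) + L ∙ (λ x → L ∙ λ y → newton (suc k) cs (meet x y))
      ≡⟨ cong₂ _+_ (trans (∙-* L c (λ x → L ∙ λ y → + (meet x y C k))) (cong (λ s → c * s) (Φ-meet k L))) (∙∙-newton (suc k) cs L) ⟩
    c * Φ k L + newton-form (suc k) cs L ∎
    where open ≡-Reasoning

  ∙∙-diagonal : ∀ (L : Combination A) (P : A → A → ℤ) a → Unique (map proj₂ L) →
                (∀ {p} → p ∈ L → P (proj₂ p) (proj₂ p) ≡ a) →
                (∀ {p q} → p ∈ L → q ∈ L → proj₂ p ≢ proj₂ q → P (proj₂ p) (proj₂ q) ≡ 0ℤ) →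
                L ∙ (λ x → L ∙ P x) ≡ a * ∑ L (λ p → proj₁ p * proj₁ p)
  ∙∙-diagonal {A = A} L P a un on off = trans (∑-cong L (λ {p} p∈L → trans (cong (λ s → proj₁ p * s) (row p p∈L)) (lemma (proj₁ p) a)))
      (∑-*ˡ a L (λ p → proj₁ p * proj₁ p))
    where
    lemma : ∀ c a → c * (c * a) ≡ a * (c * c)
    lemma = solve-∀
    row : ∀ p → p ∈ L → L ∙ P (proj₂ p) ≡ proj₁ p * a
    row p p∈L = go (split-off un p∈L)
      where
      go : (Σ (Combination A) λ M → (∀ f → ∑ L f ≡ f p + ∑ M f) × length L ≡ suc (length M) ×
             (∀ {q} → q ∈ M → q ∈ L × proj₂ p ≢ proj₂ q)) → L ∙ P (proj₂ p) ≡ proj₁ p * a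
      go (M , sum , _ , sep) = trans (sum (λ q → proj₁ q * P (proj₂ p) (proj₂ q)))
        (trans (cong₂ _+_ (cong (λ s → proj₁ p * s) (on p∈L))
          (∑-zero M (λ {q} q∈M → trans (cong (λ s → proj₁ q * s) (off p∈L (proj₁ (sep q∈M)) (proj₂ (sep q∈M)))) (*-zeroʳ (proj₁ q)))))
          (+-identityʳ _))

  δ : Vec Bool n → Vec Bool n → ℤ
  δ S T = if does (Vec.≡-dec Bool._≟_ S T) then 1ℤ else 0ℤ

  δ-≡ : ∀ (S : Vec Bool n) → δ S S ≡ 1ℤ
  δ-≡ S with Vec.≡-dec Bool._≟_ S S
  ... | yes _ = refl
  ... | no ≢ = contradiction refl ≢

  δ-≢ : ∀ {S T : Vec Bool n} → S ≢ T → δ S T ≡ 0ℤ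
  δ-≢ {S = S} {T} S≢T with Vec.≡-dec Bool._≟_ S T
  ... | yes eq = contradiction eq S≢T
  ... | no _   = refl

  split-sum : ∀ (xs : List A) (ys : List B) (N : Combination (A ⊎ B)) → map proj₂ N ≡ map inj₁ xs ++ map inj₂ ys →
              Σ (Combination A) λ L → Σ (Combination B) λ M → map proj₂ L ≡ xs × map proj₂ M ≡ ys ×
                (∀ f → N ∙ f ≡ L ∙ (f ∘ inj₁) + M ∙ (f ∘ inj₂)) × (Nonzero N → Nonzero L ⊎ Nonzero M)
  split-sum [] [] [] refl = [] , [] , refl , refl , (λ f → refl) , λ ()
  split-sum [] (y ∷ ys) ((c , b) ∷ N) eq = go (split-sum [] ys N (∷-injectiveʳ eq)) (∷-injectiveˡ eq)
    where
    open import Data.List.Properties using (∷-injectiveˡ; ∷-injectiveʳ)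
    go : _ → b ≡ inj₂ y → _
    go (L , M , l , m , s , nz) refl = L , (c , y) ∷ M , l , cong (y ∷_) m
      , (λ f → trans (cong (_+_ (c * f (inj₂ y))) (s f)) (lemma (c * f (inj₂ y)) (L ∙ (f ∘ inj₁)) (M ∙ (f ∘ inj₂))))
      , λ { (here c≢0) → inj₂ (here c≢0) ; (there nzN) → [ inj₁ , (λ q → inj₂ (there q)) ]′ (nz nzN) }
      where lemma : ∀ a b c → a + (b + c) ≡ b + (a + c)
            lemma = solve-∀
  split-sum (x ∷ xs) ys ((c , b) ∷ N) eq = go (split-sum xs ys N (∷-injectiveʳ eq)) (∷-injectiveˡ eq)
    where
    open import Data.List.Properties using (∷-injectiveˡ; ∷-injectiveʳ)
    go : _ → b ≡ inj₁ x → _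
    go (L , M , l , m , s , nz) refl = (c , x) ∷ L , M , cong (x ∷_) l , m
      , (λ f → trans (cong (_+_ (c * f (inj₁ x))) (s f)) (sym (+-assoc (c * f (inj₁ x)) (L ∙ (f ∘ inj₁)) (M ∙ (f ∘ inj₂)))))
      , λ { (here c≢0) → inj₁ (here c≢0) ; (there nzN) → [ (λ q → inj₁ (there q)) , inj₂ ]′ (nz nzN) }

  -- All points have weight w, so `D-ζ` has the same factor at each of them. Hence the values of
  -- `L ^ζ` on the (k + 1)-sets determine those on the k-sets when k < w.
  D-^ζ : ∀ (L : Combination (Vec Bool n)) → (∀ {p} → p ∈ L → weight (proj₂ p) ≡ w) →
         ∀ {S} → S ∈ layer n k → D (L ^ζ) S ≡ (+ w - + k) * (L ^ζ) S
  D-^ζ {n} {w} {k} L ws {S} S∈ = trans (D-∙ L (λ x T → ζ T x) S)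
    (trans (∙-cong L (λ {p} p∈L → trans (D-ζ S (proj₂ p))
      (cong₂ (λ a b → (+ a - + b) * ζ S (proj₂ p)) (ws p∈L) (weight-layer n k S∈))))
      (∙-* L (+ w - + k) (ζ S)))

  module _ (u : Vec Bool n → ℤ) (k : ℕ) where
    private
      dot : ℕ → (f g : Vec Bool n → ℤ) → ℤ
      dot j f g = ∑ (layer n j) (λ T → f T * g T)

    -- `DU-UD` under the inner product; all sets concerned have size k + 1, so the commutator acts
    -- as a scalar.
    ∑-DU : ∀ (g : Vec Bool n → ℤ) → dot (suc k) (D (U u)) g ≡ dot k (D u) (D g) + (+ n - + 2 * + suc k) * dot (suc k) u g
    ∑-DU g = begin
      dot (suc k) (D (U u)) g
        ≡⟨ ∑-cong (layer n (suc k)) (λ {T} T∈ → trans (cong (λ s → s * g T)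
             (trans (DU-UD u T) (cong (λ j → U (D u) T + (+ n - + 2 * + j) * u T) (weight-layer n (suc k) T∈))))
             (lemma (U (D u) T) (+ n - + 2 * + suc k) (u T) (g T))) ⟩
      ∑ (layer n (suc k)) (λ T → g T * U (D u) T + (+ n - + 2 * + suc k) * (u T * g T))
        ≡⟨ ∑-+ (layer n (suc k)) _ _ ⟩
      dot (suc k) g (U (D u)) + ∑ (layer n (suc k)) (λ T → (+ n - + 2 * + suc k) * (u T * g T))
        ≡⟨ cong₂ _+_ (trans (U-D-adjoint n k (D u) g) (∑-cong (layer n k) (λ {S} _ → *-comm (D g S) (D u S))))
             (∑-*ˡ (+ n - + 2 * + suc k) (layer n (suc k)) (λ T → u T * g T)) ⟩
      dot k (D u) (D g) + (+ n - + 2 * + suc k) * dot (suc k) u g ∎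
      where
      open ≡-Reasoning
      lemma : ∀ a b c d → (a + b * c) * d ≡ d * a + b * (c * d)
      lemma = solve-∀

    -- ‖U u‖² = ‖D u‖² + (n − 2k) ‖u‖².
    U-injective : ∀ {m} → + n - + 2 * + suc k ≡ + suc m → (∀ {T} → T ∈ layer n (2 ℕ.+ k) → U u T ≡ 0ℤ) →
                  ∀ {S} → S ∈ layer n (suc k) → u S ≡ 0ℤ
    U-injective {m} n>2k Uu≡0 = ∑-squares≤0 (layer n (suc k)) u (positive-cancel {m}
        (∑-nonneg (layer n (suc k)) (λ {T} _ → 0≤i*i (u T)))
        (subst₂ _≤_ (cong (λ s → s * dot (suc k) u u) n>2k) norm
          (≤-trans (≤-reflexive (sym (+-identityˡ _))) (+-monoˡ-≤ ((+ n - + 2 * + suc k) * dot (suc k) u u)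
            (∑-nonneg (layer n k) (λ {S} _ → 0≤i*i (D u S)))))))
      where
      norm : dot k (D u) (D u) + (+ n - + 2 * + suc k) * dot (suc k) u u ≡ 0ℤ
      norm = trans (sym (∑-DU u)) (trans (sym (U-D-adjoint n (suc k) u (U u)))
        (∑-zero (layer n (2 ℕ.+ k)) (λ {T} T∈ → trans (cong (λ s → s * U u T) (Uu≡0 T∈)) (*-zeroˡ (U u T)))))

  -- The left-hand side is the entry computed by coefficients.
  third-coefficient : ∀ a b c d →
    + 3 * (+ 2 * (+ 1 * (0ℤ + (0ℤ - d) * 1ℤ) + (1ℤ - c) * 1ℤ) + (+ 2 - b) * + 2) + (+ 3 - a) * + 6 ≡ + 36 - + 6 * (a + b + c + d)
  third-coefficient = solve-∀

  -- The left-hand side has the sign of the coefficient of the third harmonic in ∏ (dᵢ − τ).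
  NonpositiveCubic : (n w : ℕ) → List ℕ → Set
  NonpositiveCubic n w (d₁ ∷ d₂ ∷ d₃ ∷ d₄ ∷ []) =
    + 4 * ((+ w - + 3) * (+ w - + 3)) + (+ n - + 6) * (+ 6 - ((+ w - + d₁) + (+ w - + d₂) + (+ w - + d₃) + (+ w - + d₄))) ≤ 0ℤ
  NonpositiveCubic n w _ = ⊥

  gap-positive : ∀ ds → All (0 ℕ.<_) ds → ∃ λ a → gap ds 0 ≡ + suc a
  gap-positive []           []        = 0 , refl
  gap-positive (suc d ∷ ds) (_ ∷ pos) with gap-positive ds pos
  ... | a , eq = a ℕ.+ d ℕ.* suc a , cong₂ _*_ (+-identityʳ (+ suc d)) eq

  points-∈ : ∀ {X : List A} {L : Combination A} → map proj₂ L ≡ X → ∀ {p} → p ∈ L → proj₂ p ∈ X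
  points-∈ refl = ∈-map⁺ proj₂

  ∙∙-gap : ∀ {X ds} (L : Combination (Vec Bool n)) → Code n w ds X → map proj₂ L ≡ X →
           L ∙ (λ x → L ∙ λ y → monic (roots w ds) (meet x y)) ≡ gap ds 0 * ∑ L (λ p → proj₁ p * proj₁ p)
  ∙∙-gap {n} {w} {X} {ds} L code points = ∙∙-diagonal L (λ x y → monic (roots w ds) (meet x y)) (gap ds 0)
    (subst Unique (sym points) unique)
    (λ {p} p∈L → monic-roots ds (trans (cong (ℕ._+ meet (proj₂ p) (proj₂ p)) (sym (τ-self (proj₂ p)))) (sum p∈L p∈L)))
    (λ {p} {q} p∈L q∈L ≢ → trans (monic-roots ds (sum p∈L q∈L))
      (gap-∈ (distance (points-∈ points p∈L) (points-∈ points q∈L) ≢)))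
    where
    open Code code
    sum : ∀ {p q} → p ∈ L → q ∈ L → τ (proj₂ p) (proj₂ q) ℕ.+ meet (proj₂ p) (proj₂ q) ≡ w
    sum {p} {q} p∈L q∈L = τ+meet (proj₂ p) (proj₂ q) (weights (points-∈ points p∈L)) (weights (points-∈ points q∈L))

  -- Writing n = 7 + m and w = 5 + b turns n - 6 and w - k for small k into successors by
  -- computation, so their positivity is immediate.
  module _ (m b : ℕ) {d₁ d₂ d₃ d₄ : ℕ} {X : List (Vec Bool (7 ℕ.+ m))}
           (code : Code (7 ℕ.+ m) (5 ℕ.+ b) (d₁ ∷ d₂ ∷ d₃ ∷ d₄ ∷ []) X)
           (positive : All (0 ℕ.<_) (d₁ ∷ d₂ ∷ d₃ ∷ d₄ ∷ []))
           (cubic : NonpositiveCubic (7 ℕ.+ m) (5 ℕ.+ b) (d₁ ∷ d₂ ∷ d₃ ∷ d₄ ∷ [])) where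
    private
      n′ w′ : ℕ
      n′ = 7 ℕ.+ m
      w′ = 5 ℕ.+ b
      ds : List ℕ
      ds = d₁ ∷ d₂ ∷ d₃ ∷ d₄ ∷ []
      open Code code

      -- The two conditions make z a pure third harmonic on the 4-sets: the image of `U` contains
      -- only harmonics of degree at most 3, and vanishing on pairs removes those of degree at most
      -- 2. On such L only the third coefficient of ∏ (d_j - τ) counts.
      module Solution (L : Combination (Vec Bool n′)) (u : Vec Bool n′ → ℤ) (points : map proj₂ L ≡ X)
                      (on-pairs : ∀ {R} → R ∈ layer n′ 2 → (L ^ζ) R ≡ 0ℤ)
                      (on-quadruples : ∀ {T} → T ∈ layer n′ 4 → (L ^ζ) T ≡ U u T) where
        z = L ^ζ

        D-z : ∀ {k S} → S ∈ layer n′ k → D z S ≡ (+ w′ - + k) * z S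
        D-z {k} = D-^ζ {w = w′} {k = k} L (λ p∈L → weights (points-∈ points p∈L))

        ∑-D-z : ∀ k (f : Vec Bool n′ → ℤ) →
                ∑ (layer n′ (suc k)) (λ T → z T * U f T) ≡ (+ w′ - + k) * ∑ (layer n′ k) (λ S → z S * f S)
        ∑-D-z k f = trans (U-D-adjoint n′ k f z) (trans (∑-cong (layer n′ k) (λ {S} S∈ →
          trans (cong (λ s → s * f S) (D-z {k} S∈)) (*-assoc (+ w′ - + k) (z S) (f S))))
          (∑-*ˡ (+ w′ - + k) (layer n′ k) (λ S → z S * f S)))

        -- ⟨z, U z⟩ on the (k + 1)-sets equals (w - k) ‖z‖² on the k-sets, because `D z` is (w - k)
        -- z there.
        descend : ∀ k {a} → + w′ - + k ≡ + suc a → (∀ {T} → T ∈ layer n′ (suc k) → z T ≡ 0ℤ) →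
                  ∀ {S} → S ∈ layer n′ k → z S ≡ 0ℤ
        descend k {a} eq above = ∑-squares≤0 (layer n′ k) z (positive-cancel {a}
          (∑-nonneg (layer n′ k) (λ {S} _ → 0≤i*i (z S)))
          (≤-reflexive (trans (cong (λ s → s * Φ k L) (sym eq)) (trans (sym (∑-D-z k z))
            (∑-zero (layer n′ (suc k)) (λ {T} T∈ → trans (cong (λ s → s * U z T) (above T∈)) (*-zeroˡ (U z T))))))))

        Φ≡0 : ∀ k → (∀ {S} → S ∈ layer n′ k → z S ≡ 0ℤ) → Φ k L ≡ 0ℤ
        Φ≡0 k vanishing = ∑-zero (layer n′ k) (λ {S} S∈ → trans (cong (λ s → s * z S) (vanishing S∈)) (*-zeroˡ (z S)))

        on-points : ∀ {S} → S ∈ layer n′ 1 → z S ≡ 0ℤ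
        on-points = descend 1 refl on-pairs

        uz = ∑ (layer n′ 3) (λ S → z S * u S)

        Φ₄ : Φ 4 L ≡ (+ w′ - + 3) * uz
        Φ₄ = trans (∑-cong (layer n′ 4) (λ {T} T∈ → cong (λ s → z T * s) (on-quadruples T∈))) (∑-D-z 3 u)

        -- ⟨z, U z⟩ on the 4-sets is evaluated twice. Adjunction gives (w - 3) ‖z‖²; replacing z by
        -- U u gives (n - 6) ⟨u, z⟩ through the commutator, since D z is a multiple of z on pairs
        -- and vanishes there. With `Φ₄`, both squares are expressed by the one number `uz`.
        Φ₃ : (+ w′ - + 3) * Φ 3 L ≡ (+ n′ - + 6) * uz
        Φ₃ = begin
          (+ w′ - + 3) * Φ 3 L
            ≡⟨ sym (∑-D-z 3 z) ⟩
          ∑ (layer n′ 4) (λ T → z T * U z T)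
            ≡⟨ ∑-cong (layer n′ 4) (λ {T} T∈ → cong (λ s → s * U z T) (on-quadruples T∈)) ⟩
          ∑ (layer n′ 4) (λ T → U u T * U z T)
            ≡⟨ U-D-adjoint n′ 3 z (U u) ⟩
          ∑ (layer n′ 3) (λ S → D (U u) S * z S)
            ≡⟨ ∑-DU u 2 z ⟩
          ∑ (layer n′ 2) (λ R → D u R * D z R) + (+ n′ - + 6) * ∑ (layer n′ 3) (λ S → u S * z S)
            ≡⟨ cong₂ _+_ (∑-zero (layer n′ 2) (λ {R} R∈ → trans (cong (λ s → D u R * s)
                 (trans (D-z {2} R∈) (trans (cong (λ s → (+ w′ - + 2) * s) (on-pairs R∈)) (*-zeroʳ (+ w′ - + 2))))) (*-zeroʳ (D u R))))
                 (cong (λ s → (+ n′ - + 6) * s) (∑-cong (layer n′ 3) (λ {S} _ → *-comm (u S) (z S)))) ⟩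
          0ℤ + (+ n′ - + 6) * uz
            ≡⟨ +-identityˡ _ ⟩
          (+ n′ - + 6) * uz ∎
          where open ≡-Reasoning

        squares = ∑ L (λ p → proj₁ p * proj₁ p)
        Σm = (+ w′ - + d₁) + (+ w′ - + d₂) + (+ w′ - + d₃) + (+ w′ - + d₄)
        κ  = + 4 * ((+ w′ - + 3) * (+ w′ - + 3)) + (+ n′ - + 6) * (+ 6 - Σm)

        norm : gap ds 0 * squares ≡ (+ 36 - + 6 * Σm) * Φ 3 L + + 24 * Φ 4 L
        norm = begin
          gap ds 0 * squares
            ≡⟨ sym (∙∙-gap L code points) ⟩
          L ∙ (λ x → L ∙ λ y → monic (roots w′ ds) (meet x y))
            ≡⟨ ∙-cong L (λ {p} _ → ∙-cong L (λ {q} _ → sym (newton-coefficients (roots w′ ds) (meet (proj₂ p) (proj₂ q))))) ⟩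
          L ∙ (λ x → L ∙ λ y → newton 0 (coefficients (roots w′ ds)) (meet x y))
            ≡⟨ ∙∙-newton 0 (coefficients (roots w′ ds)) L ⟩
          newton-form 0 (coefficients (roots w′ ds)) L
            ≡⟨ vanish shape (Φ≡0 0 (descend 0 refl on-points)) (Φ≡0 1 on-points) (Φ≡0 2 on-pairs) ⟩
          third * Φ 3 L + + 24 * Φ 4 L
            ≡⟨ cong (λ s → s * Φ 3 L + + 24 * Φ 4 L)
                 (third-coefficient (+ w′ - + d₁) (+ w′ - + d₂) (+ w′ - + d₃) (+ w′ - + d₄)) ⟩
          (+ 36 - + 6 * Σm) * Φ 3 L + + 24 * Φ 4 L ∎
          where
          open ≡-Reasoning
          third = + 3 * (+ 2 * (+ 1 * (0ℤ + (0ℤ - (+ w′ - + d₄)) * 1ℤ) + (1ℤ - (+ w′ - + d₃)) * 1ℤ) + (+ 2 - (+ w′ - + d₂)) * + 2)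
                  + (+ 3 - (+ w′ - + d₁)) * + 6
          low : ∀ c {s} → s ≡ 0ℤ → ∀ t → c * s + t ≡ t
          low c refl t = trans (cong (λ r → r + t) (*-zeroʳ c)) (+-identityˡ t)
          shape : ∃ λ c₀ → ∃ λ c₁ → ∃ λ c₂ → coefficients (roots w′ ds) ≡ c₀ ∷ c₁ ∷ c₂ ∷ third ∷ + 24 ∷ []
          shape = _ , _ , _ , refl
          vanish : ∀ {cs c₃ c₄} → (∃ λ c₀ → ∃ λ c₁ → ∃ λ c₂ → cs ≡ c₀ ∷ c₁ ∷ c₂ ∷ c₃ ∷ c₄ ∷ []) →
                   Φ 0 L ≡ 0ℤ → Φ 1 L ≡ 0ℤ → Φ 2 L ≡ 0ℤ → newton-form 0 cs L ≡ c₃ * Φ 3 L + c₄ * Φ 4 L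
          vanish {c₃ = c₃} {c₄} (c₀ , c₁ , c₂ , refl) e₀ e₁ e₂ = trans (low c₀ e₀ _) (trans (low c₁ e₁ _) (trans (low c₂ e₂ _)
            (cong (_+_ (c₃ * Φ 3 L)) (+-identityʳ (c₄ * Φ 4 L)))))

        -- The factor n - 6 permits the elimination (n - 6) Φ₄ = (w - 3)² Φ₃. What remains is Φ₃
        -- times `κ`, the number that the cubic hypothesis makes nonpositive.
        scaled-norm : (+ n′ - + 6) * (gap ds 0 * squares) ≡ + 6 * (Φ 3 L * κ)
        scaled-norm = begin
          N * (gap ds 0 * squares)
            ≡⟨ cong (λ s → N * s) norm ⟩
          N * ((+ 36 - + 6 * Σm) * Φ 3 L + + 24 * Φ 4 L)
            ≡⟨ cong (λ s → N * ((+ 36 - + 6 * Σm) * Φ 3 L + + 24 * s)) Φ₄ ⟩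
          N * ((+ 36 - + 6 * Σm) * Φ 3 L + + 24 * (W * uz))
            ≡⟨ l₁ N Σm (Φ 3 L) W uz ⟩
          N * (+ 36 - + 6 * Σm) * Φ 3 L + + 24 * (W * (N * uz))
            ≡⟨ cong (λ s → N * (+ 36 - + 6 * Σm) * Φ 3 L + + 24 * (W * s)) (sym Φ₃) ⟩
          N * (+ 36 - + 6 * Σm) * Φ 3 L + + 24 * (W * (W * Φ 3 L))
            ≡⟨ l₂ N Σm (Φ 3 L) W ⟩
          + 6 * (Φ 3 L * κ) ∎
          where
          open ≡-Reasoning
          N = + n′ - + 6
          W = + w′ - + 3
          l₁ : ∀ N s f W u → N * ((+ 36 - + 6 * s) * f + + 24 * (W * u)) ≡ N * (+ 36 - + 6 * s) * f + + 24 * (W * (N * u))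
          l₁ = solve-∀
          l₂ : ∀ N s f W → N * (+ 36 - + 6 * s) * f + + 24 * (W * (W * f)) ≡ + 6 * (f * (+ 4 * (W * W) + N * (+ 6 - s)))
          l₂ = solve-∀

        squares≤0 : squares ≤ 0ℤ
        squares≤0 = go (gap-positive ds positive)
          where
          squares≥0 : 0ℤ ≤ squares
          squares≥0 = ∑-nonneg L (λ {p} _ → 0≤i*i (proj₁ p))
          nonpositive : 0ℤ ≤ Φ 3 L → Φ 3 L * κ ≤ 0ℤ
          nonpositive Φ≥0 = ≤-trans (*-monoˡ-≤-nonNeg (Φ 3 L) {{Data.Integer.nonNegative Φ≥0}} cubic) (≤-reflexive (*-zeroʳ (Φ 3 L)))
          go : (∃ λ a → gap ds 0 ≡ + suc a) → squares ≤ 0ℤ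
          go (a , eq) = positive-cancel {a} squares≥0 (subst (λ g → g * squares ≤ 0ℤ) {gap ds 0} {+ suc a} eq
            (*-cancelˡ-≤-pos (gap ds 0 * squares) 0ℤ (+ suc m)
              (≤-trans (≤-reflexive scaled-norm) (≤-trans (*-monoˡ-≤-nonNeg (+ 6) (nonpositive (∑-nonneg (layer n′ 3) (λ {S} _ → 0≤i*i (z S)))))
                (≤-reflexive (sym (*-zeroʳ (+ suc m))))))))

        coefficients≡0 : ∀ {p} → p ∈ L → proj₁ p ≡ 0ℤ
        coefficients≡0 = ∑-squares≤0 L proj₁ squares≤0

    -- The unknowns are L on X and a function u on the 3-sets; the equations ask for L ^ζ = U u on
    -- the 4-sets and L ^ζ = 0 on the pairs. With fewer equations than unknowns there is a nonzero
    -- solution. `Solution` forces L = 0, then U u = 0, and u = 0 by injectivity of `U`, as n > 6.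
    -- Having u as an unknown divides out the third harmonic without choosing a basis of it.
    rank-bound : length X ℕ.+ n′ C 3 ℕ.≤ n′ C 4 ℕ.+ n′ C 2
    rank-bound = ℕ.≮⇒≥ λ few → refute (kernel-vector (map row₄ (layer n′ 4) ++ map row₂ (layer n′ 2))
        (map inj₁ X ++ map inj₂ (layer n′ 3)) (subst₂ ℕ._<_ (sym equations) (sym unknowns) few))
      where
      Unknown = Vec Bool n′ ⊎ Vec Bool n′
      row₄ row₂ : Vec Bool n′ → Unknown → ℤ
      row₄ T = [ ζ T , (λ S → - 1ℤ * U (δ S) T) ]′
      row₂ R = [ ζ R , (λ _ → 0ℤ) ]′
      equations : length (map row₄ (layer n′ 4) ++ map row₂ (layer n′ 2)) ≡ n′ C 4 ℕ.+ n′ C 2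
      equations = trans (length-++ (map row₄ (layer n′ 4))) (cong₂ ℕ._+_
        (trans (length-map row₄ (layer n′ 4)) (length-layer n′ 4)) (trans (length-map row₂ (layer n′ 2)) (length-layer n′ 2)))
      unknowns : length (map inj₁ X ++ map inj₂ (layer n′ 3)) ≡ length X ℕ.+ n′ C 3
      unknowns = trans (length-++ (map inj₁ X)) (cong₂ ℕ._+_
        (length-map inj₁ X) (trans (length-map inj₂ (layer n′ 3)) (length-layer n′ 3)))
      all-zero : ∀ {A : Set} {K : Combination A} → (∀ {p} → p ∈ K → proj₁ p ≡ 0ℤ) → ¬ Nonzero K
      all-zero zs (here ≢)   = ≢ (zs (here refl))
      all-zero zs (there nz) = all-zero (zs ∘ there) nz

      refute : (Σ (Combination Unknown) λ N → map proj₂ N ≡ map inj₁ X ++ map inj₂ (layer n′ 3) × Nonzero N ×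
                 All (λ r → N ∙ r ≡ 0ℤ) (map row₄ (layer n′ 4) ++ map row₂ (layer n′ 2))) → ⊥
      refute (N , pts , nz , zs) = go (split-sum X (layer n′ 3) N pts)
        where
        zs₄ : All (λ T → N ∙ row₄ T ≡ 0ℤ) (layer n′ 4)
        zs₄ = All.map⁻ (All.++⁻ˡ (map row₄ (layer n′ 4)) zs)
        zs₂ : All (λ R → N ∙ row₂ R ≡ 0ℤ) (layer n′ 2)
        zs₂ = All.map⁻ (All.++⁻ʳ (map row₄ (layer n′ 4)) zs)
        go : (Σ (Combination (Vec Bool n′)) λ L → Σ (Combination (Vec Bool n′)) λ M → map proj₂ L ≡ X × map proj₂ M ≡ layer n′ 3 ×
               (∀ f → N ∙ f ≡ L ∙ (f ∘ inj₁) + M ∙ (f ∘ inj₂)) × (Nonzero N → Nonzero L ⊎ Nonzero M)) → ⊥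
        go (L , M , l , μ , sum , nz′) = [ all-zero L≡0 , all-zero M≡0 ]′ (nz′ nz)
          where
          u : Vec Bool n′ → ℤ
          u T = M ∙ λ S → δ S T
          on-pairs : ∀ {R} → R ∈ layer n′ 2 → (L ^ζ) R ≡ 0ℤ
          on-pairs {R} R∈ = trans (sym (trans (cong (_+_ ((L ^ζ) R)) (∑-zero M (λ {p} _ → *-zeroʳ (proj₁ p)))) (+-identityʳ _)))
            (trans (sym (sum (row₂ R))) (All.lookup zs₂ R∈))
          on-quadruples : ∀ {T} → T ∈ layer n′ 4 → (L ^ζ) T ≡ U u T
          on-quadruples {T} T∈ = trans (lemma ((L ^ζ) T) (U u T))
            (trans (cong (λ s → s + U u T) (trans (cong (_+_ ((L ^ζ) T)) (trans (cong (λ s → - 1ℤ * s) (U-∙ M δ T)) (sym (∙-* M (- 1ℤ) (λ S → U (δ S) T)))))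
              (trans (sym (sum (row₄ T))) (All.lookup zs₄ T∈)))) (+-identityˡ _))
            where lemma : ∀ a b → a ≡ (a + - 1ℤ * b) + b
                  lemma = solve-∀
          open Solution L u l on-pairs on-quadruples
          L≡0 : ∀ {p} → p ∈ L → proj₁ p ≡ 0ℤ
          L≡0 = coefficients≡0
          u≡0 : ∀ {S} → S ∈ layer n′ 3 → u S ≡ 0ℤ
          u≡0 = U-injective u 2 {m} refl (λ {T} T∈ → trans (sym (on-quadruples T∈))
            (∑-zero L (λ {p} p∈L → trans (cong (λ c → c * ζ T (proj₂ p)) (L≡0 p∈L)) (*-zeroˡ (ζ T (proj₂ p))))))
          M≡0 : ∀ {p} → p ∈ M → proj₁ p ≡ 0ℤ
          M≡0 {p} p∈M = pick (split-off (subst Unique (sym μ) (unique-layer n′ 3)) p∈M)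
            where
            pick : (Σ (Combination (Vec Bool n′)) λ K → (∀ f → ∑ M f ≡ f p + ∑ K f) × length M ≡ suc (length K) ×
                     (∀ {q} → q ∈ K → q ∈ M × proj₂ p ≢ proj₂ q)) → proj₁ p ≡ 0ℤ
            pick (K , s , _ , sep) = trans (sym (trans (s (λ q → proj₁ q * δ (proj₂ q) (proj₂ p)))
              (trans (cong₂ _+_ (trans (cong (λ t → proj₁ p * t) (δ-≡ (proj₂ p))) (*-identityʳ (proj₁ p)))
                (∑-zero K (λ {q} q∈K → trans (cong (λ t → proj₁ q * t) (δ-≢ (λ e → proj₂ (sep q∈K) (sym e)))) (*-zeroʳ (proj₁ q)))))
                (+-identityʳ (proj₁ p))))) (u≡0 (points-∈ μ p∈M))

  -- Positive semidefinite kernels.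

  only neither : Vec Bool n → Vec Bool n → ℕ
  only []          []          = 0
  only (true ∷ x)  (true ∷ y)  = only x y
  only (true ∷ x)  (false ∷ y) = suc (only x y)
  only (false ∷ x) (_ ∷ y)     = only x y
  neither []          []          = 0
  neither (true ∷ x)  (_ ∷ y)     = neither x y
  neither (false ∷ x) (true ∷ y)  = neither x y
  neither (false ∷ x) (false ∷ y) = suc (neither x y)

  ∑-Fin : ∀ n (f : Fin (suc n) → ℤ) → ∑ (allFin (suc n)) f ≡ f zero + ∑ (allFin n) (f ∘ suc)
  ∑-Fin n f = cong (_+_ (f zero)) (trans (cong (λ xs → ∑ xs f) (sym (map-tabulate id suc))) (∑-map suc (allFin n) f))

  -- A quantity attached to one position: the bits of x and y there, then the sizes p, q, r, s
  -- counted over the other positions.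
  Counted : Set
  Counted = Bool → Bool → ℕ → ℕ → ℕ → ℕ → ℤ

  -- Positions grouped by their pair of bits. Where a count is zero, the factor zero makes the
  -- truncated `∸ 1` harmless.
  by-type : Counted → ℕ → ℕ → ℕ → ℕ → ℤ
  by-type h p q r s = + p * h true true (p ∸ 1) q r s + + q * h true false p (q ∸ 1) r s
                    + + r * h false true p q (r ∸ 1) s + + s * h false false p q r (s ∸ 1)

  private
    refill : ∀ (f : ℕ → ℤ) k → + k * f (suc (k ∸ 1)) ≡ + k * f k
    refill f zero    = trans (*-zeroˡ (f 1)) (sym (*-zeroˡ (f 0)))
    refill f (suc k) = refl

  at-position : Counted → Vec Bool (suc n) → Vec Bool (suc n) → Fin (suc n) → ℤ
  at-position h x y a = h (lookup x a) (lookup y a)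
    (meet (removeAt x a) (removeAt y a)) (only (removeAt x a) (removeAt y a))
    (only (removeAt y a) (removeAt x a)) (neither (removeAt x a) (removeAt y a))

  -- In the induction, the head of the vectors raises one argument of `h`, and `refill` turns the
  -- resulting `suc (k ∸ 1)` under the factor k back into k.
  ∑-positions : (h : Counted) (x y : Vec Bool (suc n)) →
    ∑ (allFin (suc n)) (at-position h x y) ≡ by-type h (meet x y) (only x y) (only y x) (neither x y)
  ∑-positions {zero} h (true ∷ [])  (true ∷ [])  = lemma (h true true 0 0 0 0) (h true false 1 0 0 0) (h false true 1 0 0 0) (h false false 1 0 0 0)
    where lemma : ∀ a b c d → a + 0ℤ ≡ 1ℤ * a + 0ℤ * b + 0ℤ * c + 0ℤ * d
          lemma = solve-∀
  ∑-positions {zero} h (true ∷ [])  (false ∷ []) = lemma (h true false 0 0 0 0) (h true true 0 1 0 0) (h false true 0 1 0 0) (h false false 0 1 0 0)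
    where lemma : ∀ a b c d → a + 0ℤ ≡ 0ℤ * b + 1ℤ * a + 0ℤ * c + 0ℤ * d
          lemma = solve-∀
  ∑-positions {zero} h (false ∷ []) (true ∷ [])  = lemma (h false true 0 0 0 0) (h true true 0 0 1 0) (h true false 0 0 1 0) (h false false 0 0 1 0)
    where lemma : ∀ a b c d → a + 0ℤ ≡ 0ℤ * b + 0ℤ * c + 1ℤ * a + 0ℤ * d
          lemma = solve-∀
  ∑-positions {zero} h (false ∷ []) (false ∷ []) = lemma (h false false 0 0 0 0) (h true true 0 0 0 1) (h true false 0 0 0 1) (h false true 0 0 0 1)
    where lemma : ∀ a b c d → a + 0ℤ ≡ 0ℤ * b + 0ℤ * c + 0ℤ * d + 1ℤ * a
          lemma = solve-∀
  ∑-positions {suc n} h (true ∷ x@(_ ∷ _)) (true ∷ y@(_ ∷ _)) = trans (∑-Fin (suc n) (at-position h (true ∷ x) (true ∷ y)))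
    (trans (cong (_+_ (h true true p q r s)) (∑-positions (λ α β p′ → h α β (suc p′)) x y))
    (trans (cong (λ t → h true true p q r s + (t + + q * h true false (suc p) (q ∸ 1) r s
              + + r * h false true (suc p) q (r ∸ 1) s + + s * h false false (suc p) q r (s ∸ 1)))
            (refill (λ k → h true true k q r s) p))
      (lemma (h true true p q r s) (+ p) _ _ _)))
    where
    p = meet x y ; q = only x y ; r = only y x ; s = neither x y
    lemma : ∀ a p b c d → a + (p * a + b + c + d) ≡ (1ℤ + p) * a + b + c + d
    lemma = solve-∀
  ∑-positions {suc n} h (true ∷ x@(_ ∷ _)) (false ∷ y@(_ ∷ _)) = trans (∑-Fin (suc n) (at-position h (true ∷ x) (false ∷ y)))
    (trans (cong (_+_ (h true false p q r s)) (∑-positions (λ α β p′ q′ → h α β p′ (suc q′)) x y))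
    (trans (cong (λ t → h true false p q r s + (+ p * h true true (p ∸ 1) (suc q) r s + t
              + + r * h false true p (suc q) (r ∸ 1) s + + s * h false false p (suc q) r (s ∸ 1)))
            (refill (λ k → h true false p k r s) q))
      (lemma (h true false p q r s) (+ q) (+ p * h true true (p ∸ 1) (suc q) r s) _ _)))
    where
    p = meet x y ; q = only x y ; r = only y x ; s = neither x y
    lemma : ∀ a p b c d → a + (b + p * a + c + d) ≡ b + (1ℤ + p) * a + c + d
    lemma = solve-∀
  ∑-positions {suc n} h (false ∷ x@(_ ∷ _)) (true ∷ y@(_ ∷ _)) = trans (∑-Fin (suc n) (at-position h (false ∷ x) (true ∷ y)))
    (trans (cong (_+_ (h false true p q r s)) (∑-positions (λ α β p′ q′ r′ → h α β p′ q′ (suc r′)) x y))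
    (trans (cong (λ t → h false true p q r s + (+ p * h true true (p ∸ 1) q (suc r) s + + q * h true false p (q ∸ 1) (suc r) s
              + t + + s * h false false p q (suc r) (s ∸ 1)))
            (refill (λ k → h false true p q k s) r))
      (lemma (h false true p q r s) (+ r) (+ p * h true true (p ∸ 1) q (suc r) s) (+ q * h true false p (q ∸ 1) (suc r) s) _)))
    where
    p = meet x y ; q = only x y ; r = only y x ; s = neither x y
    lemma : ∀ a p b c d → a + (b + c + p * a + d) ≡ b + c + (1ℤ + p) * a + d
    lemma = solve-∀
  ∑-positions {suc n} h (false ∷ x@(_ ∷ _)) (false ∷ y@(_ ∷ _)) = trans (∑-Fin (suc n) (at-position h (false ∷ x) (false ∷ y)))
    (trans (cong (_+_ (h false false p q r s)) (∑-positions (λ α β p′ q′ r′ s′ → h α β p′ q′ r′ (suc s′)) x y))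
    (trans (cong (λ t → h false false p q r s + (+ p * h true true (p ∸ 1) q r (suc s) + + q * h true false p (q ∸ 1) r (suc s)
              + + r * h false true p q (r ∸ 1) (suc s) + t))
            (refill (λ k → h false false p q r k) s))
      (lemma (h false false p q r s) (+ s) (+ p * h true true (p ∸ 1) q r (suc s)) (+ q * h true false p (q ∸ 1) r (suc s))
        (+ r * h false true p q (r ∸ 1) (suc s)))))
    where
    p = meet x y ; q = only x y ; r = only y x ; s = neither x y
    lemma : ∀ a p b c d → a + (b + c + d + p * a) ≡ b + c + d + (1ℤ + p) * a
    lemma = solve-∀

  bit : Bool → ℤ
  bit true  = 1ℤ
  bit false = 0ℤ

  -- b indexes the positions left after a is removed, so (a, b) runs over the ordered pairs of
  -- distinct positions.
  slope : Vec Bool (2 ℕ.+ n) → Fin (2 ℕ.+ n) → Fin (1 ℕ.+ n) → ℤ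
  slope x a b = bit (lookup x a) - bit (lookup (removeAt x a) b)

  without : Vec Bool (2 ℕ.+ n) → Fin (2 ℕ.+ n) → Fin (1 ℕ.+ n) → Vec Bool n
  without x a b = removeAt (removeAt x a) b

  -- Σ ∏ (x_a − x_b) (y_a − y_b) over all sequences of j disjoint ordered pairs (a, b).
  κ : ℕ → Vec Bool n → Vec Bool n → ℤ
  κ             zero    x y = 1ℤ
  κ {zero}      (suc j) x y = 0ℤ
  κ {suc zero}  (suc j) x y = 0ℤ
  κ {suc (suc n)} (suc j) x y = ∑ (allFin (2 ℕ.+ n)) λ a → ∑ (allFin (1 ℕ.+ n)) λ b →
    (slope x a b * slope y a b) * κ j (without x a b) (without y a b)

  ∙∙-∑ : ∀ (L : Combination A) (xs : List B) (F : B → A → A → ℤ) →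
         L ∙ (λ x → L ∙ λ y → ∑ xs (λ b → F b x y)) ≡ ∑ xs (λ b → L ∙ λ x → L ∙ λ y → F b x y)
  ∙∙-∑ {A = A} {B} L xs F = trans (∙-cong L (λ {p} _ → ∙-∑ (λ b y → F b (proj₂ p) y))) (∙-∑ (λ b x → L ∙ λ y → F b x y))
    where
    ∙-∑ : (G : B → A → ℤ) → L ∙ (λ y → ∑ xs (λ b → G b y)) ≡ ∑ xs (λ b → L ∙ G b)
    ∙-∑ G = trans (∑-cong L (λ {p} _ → sym (∑-*ˡ (proj₁ p) xs (λ b → G b (proj₂ p))))) (∑-swap L xs _)

  reweight : (A → ℤ) → (A → B) → Combination A → Combination B
  reweight s g = map (λ p → proj₁ p * s (proj₂ p) , g (proj₂ p))

  ∙∙-reweight : ∀ (L : Combination A) (s : A → ℤ) (g : A → B) (k : B → B → ℤ) →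
                L ∙ (λ x → L ∙ λ y → (s x * s y) * k (g x) (g y)) ≡ reweight s g L ∙ (λ x → reweight s g L ∙ k x)
  ∙∙-reweight L s g k = sym (trans (∑-map _ L _) (∑-cong L (λ {p} _ → trans (cong (λ t → (proj₁ p * s (proj₂ p)) * t) (∑-map _ L _))
    (trans (*-assoc (proj₁ p) (s (proj₂ p)) _) (cong (λ t → proj₁ p * t)
      (trans (sym (∑-*ˡ (s (proj₂ p)) L _)) (∑-cong L (λ {q} _ → lemma (s (proj₂ p)) (proj₁ q) (s (proj₂ q)) (k (g (proj₂ p)) (g (proj₂ q)))))))))))
    where lemma : ∀ a b c d → a * ((b * c) * d) ≡ b * ((a * c) * d)
          lemma = solve-∀

  -- `κ zero` gives a square. Each pair (a, b) contributes the form of `κ j` at the combination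
  -- whose coefficients are multiplied by x_a - x_b and whose points lose the positions a and b;
  -- these are nonnegative by induction.
  κ-psd : ∀ j (L : Combination (Vec Bool n)) → 0ℤ ≤ L ∙ (λ x → L ∙ κ j x)
  κ-psd zero L = subst (0ℤ ≤_) (sym (∑-*ʳ (L ∙ λ _ → 1ℤ) L proj₁)) (subst (λ s → 0ℤ ≤ s * (L ∙ λ _ → 1ℤ))
    (∑-cong L (λ {p} _ → *-identityʳ (proj₁ p))) (0≤i*i (L ∙ λ _ → 1ℤ)))
  κ-psd {zero} (suc j) L = ≤-reflexive (sym (∑-zero L (λ {p} _ → trans (cong (λ s → proj₁ p * s) (∑-zero L (λ {q} _ → *-zeroʳ (proj₁ q)))) (*-zeroʳ (proj₁ p)))))
  κ-psd {suc zero} (suc j) L = ≤-reflexive (sym (∑-zero L (λ {p} _ → trans (cong (λ s → proj₁ p * s) (∑-zero L (λ {q} _ → *-zeroʳ (proj₁ q)))) (*-zeroʳ (proj₁ p)))))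
  κ-psd {suc (suc n)} (suc j) L = subst (0ℤ ≤_) (sym expand)
    (∑-nonneg (allFin (2 ℕ.+ n)) λ {a} _ → ∑-nonneg (allFin (1 ℕ.+ n)) λ {b} _ →
      κ-psd j (reweight (λ x → slope x a b) (λ x → without x a b) L))
    where
    expand : L ∙ (λ x → L ∙ κ (suc j) x) ≡ ∑ (allFin (2 ℕ.+ n)) λ a → ∑ (allFin (1 ℕ.+ n)) λ b →
      let L′ = reweight (λ x → slope x a b) (λ x → without x a b) L in L′ ∙ (λ x → L′ ∙ κ j x)
    expand = trans (∙∙-∑ L (allFin (2 ℕ.+ n)) _) (∑-cong (allFin (2 ℕ.+ n)) λ {a} _ →
      trans (∙∙-∑ L (allFin (1 ℕ.+ n)) _) (∑-cong (allFin (1 ℕ.+ n)) λ {b} _ →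
        ∙∙-reweight L (λ x → slope x a b) (λ x → without x a b) (κ j)))

  -- The Hahn polynomials, unnormalised, in terms of the sizes p, q, r, s of x ∩ y, x ∖ y, y ∖ x and the rest.
  hahn : ℕ → ℕ → ℕ → ℕ → ℕ → ℤ
  hahn zero    p q r s = 1ℤ
  hahn (suc j) p q r s = (+ p * + s) * hahn j (p ∸ 1) q r (s ∸ 1) - (+ q * + r) * hahn j p (q ∸ 1) (r ∸ 1) s

  2^ : ℕ → ℤ
  2^ zero    = 1ℤ
  2^ (suc j) = + 2 * 2^ j

  -- The product (x_a - x_b)(y_a - y_b) is 1 if one of a, b lies in both sets and the other in
  -- neither, -1 if one lies only in x and the other only in y, and 0 otherwise. This produces p s
  -- and q r, each in two orders, whence a factor 2 per pair.
  κ-hahn : ∀ j (x y : Vec Bool n) → κ j x y ≡ 2^ j * hahn j (meet x y) (only x y) (only y x) (neither x y)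
  κ-hahn zero x y = refl
  κ-hahn {zero} (suc j) [] [] = sym (lemma (2^ j) (hahn j 0 0 0 0) (hahn j 0 0 0 0))
    where lemma : ∀ a b c → (+ 2 * a) * ((0ℤ * 0ℤ) * b - (0ℤ * 0ℤ) * c) ≡ 0ℤ
          lemma = solve-∀
  κ-hahn {suc zero} (suc j) (true ∷ []) (true ∷ []) = sym (lemma (2^ j) (hahn j 0 0 0 0) (hahn j 1 0 0 0))
    where lemma : ∀ a b c → (+ 2 * a) * ((1ℤ * 0ℤ) * b - (0ℤ * 0ℤ) * c) ≡ 0ℤ
          lemma = solve-∀
  κ-hahn {suc zero} (suc j) (true ∷ []) (false ∷ []) = sym (lemma (2^ j) (hahn j 0 1 0 0) (hahn j 0 0 0 0))
    where lemma : ∀ a b c → (+ 2 * a) * ((0ℤ * 0ℤ) * b - (1ℤ * 0ℤ) * c) ≡ 0ℤ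
          lemma = solve-∀
  κ-hahn {suc zero} (suc j) (false ∷ []) (true ∷ []) = sym (lemma (2^ j) (hahn j 0 0 1 0) (hahn j 0 0 0 0))
    where lemma : ∀ a b c → (+ 2 * a) * ((0ℤ * 0ℤ) * b - (0ℤ * 1ℤ) * c) ≡ 0ℤ
          lemma = solve-∀
  κ-hahn {suc zero} (suc j) (false ∷ []) (false ∷ []) = sym (lemma (2^ j) (hahn j 0 0 0 0) (hahn j 0 0 0 1))
    where lemma : ∀ a b c → (+ 2 * a) * ((0ℤ * 1ℤ) * b - (0ℤ * 0ℤ) * c) ≡ 0ℤ
          lemma = solve-∀
  κ-hahn {suc (suc n)} (suc j) x y = begin
    κ (suc j) x y
      ≡⟨ ∑-cong (allFin (2 ℕ.+ n)) (λ {a} _ → trans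
           (∑-cong (allFin (1 ℕ.+ n)) (λ {b} _ → cong (λ t → (slope x a b * slope y a b) * t) (κ-hahn j (without x a b) (without y a b))))
           (∑-positions (inner (lookup x a) (lookup y a)) (removeAt x a) (removeAt y a))) ⟩
    ∑ (allFin (2 ℕ.+ n)) (at-position (λ α β → by-type (inner α β)) x y)
      ≡⟨ ∑-positions (λ α β → by-type (inner α β)) x y ⟩
    by-type (λ α β → by-type (inner α β)) p q r s
      ≡⟨ lemma (2^ j) (+ p) (+ q) (+ r) (+ s) (+ (p ∸ 1)) (+ (q ∸ 1)) (+ (r ∸ 1)) (+ (s ∸ 1)) (H (p ∸ 1) q r (s ∸ 1)) (H p (q ∸ 1) (r ∸ 1) s)
           (H (p ∸ 1 ∸ 1) q r s) (H (p ∸ 1) (q ∸ 1) r s) (H (p ∸ 1) q (r ∸ 1) s)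
           (H p (q ∸ 1 ∸ 1) r s) (H p (q ∸ 1) r (s ∸ 1)) (H p q (r ∸ 1 ∸ 1) s) (H p q (r ∸ 1) (s ∸ 1)) (H p q r (s ∸ 1 ∸ 1)) ⟩
    2^ (suc j) * hahn (suc j) p q r s ∎
    where
    open ≡-Reasoning
    p = meet x y
    q = only x y
    r = only y x
    s = neither x y
    H = hahn j
    inner : Bool → Bool → Counted
    inner α β γ δ′ p q r s = ((bit α - bit γ) * (bit β - bit δ′)) * (2^ j * hahn j p q r s)
    lemma : ∀ t p q r s p′ q′ r′ s′ u v a₁ a₂ a₃ a₄ a₅ a₆ a₇ a₈ →
      p * (p′ * (((1ℤ - 1ℤ) * (1ℤ - 1ℤ)) * (t * a₁)) + q * (((1ℤ - 1ℤ) * (1ℤ - 0ℤ)) * (t * a₂))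
         + r * (((1ℤ - 0ℤ) * (1ℤ - 1ℤ)) * (t * a₃)) + s * (((1ℤ - 0ℤ) * (1ℤ - 0ℤ)) * (t * u)))
      + q * (p * (((1ℤ - 1ℤ) * (0ℤ - 1ℤ)) * (t * a₂)) + q′ * (((1ℤ - 1ℤ) * (0ℤ - 0ℤ)) * (t * a₄))
         + r * (((1ℤ - 0ℤ) * (0ℤ - 1ℤ)) * (t * v)) + s * (((1ℤ - 0ℤ) * (0ℤ - 0ℤ)) * (t * a₅)))
      + r * (p * (((0ℤ - 1ℤ) * (1ℤ - 1ℤ)) * (t * a₃)) + q * (((0ℤ - 1ℤ) * (1ℤ - 0ℤ)) * (t * v))
         + r′ * (((0ℤ - 0ℤ) * (1ℤ - 1ℤ)) * (t * a₆)) + s * (((0ℤ - 0ℤ) * (1ℤ - 0ℤ)) * (t * a₇)))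
      + s * (p * (((0ℤ - 1ℤ) * (0ℤ - 1ℤ)) * (t * u)) + q * (((0ℤ - 1ℤ) * (0ℤ - 0ℤ)) * (t * a₅))
         + r * (((0ℤ - 0ℤ) * (0ℤ - 1ℤ)) * (t * a₇)) + s′ * (((0ℤ - 0ℤ) * (0ℤ - 0ℤ)) * (t * a₈)))
      ≡ (+ 2 * t) * ((p * s) * u - (q * r) * v)
    lemma = solve-∀

  -- The linear programming bound.

  only+meet : ∀ (x y : Vec Bool n) → only x y ℕ.+ meet x y ≡ weight x
  only+meet []          []          = refl
  only+meet (true ∷ x)  (true ∷ y)  = trans (ℕ.+-suc (only x y) (meet x y)) (cong suc (only+meet x y))
  only+meet (true ∷ x)  (false ∷ y) = cong suc (only+meet x y)
  only+meet (false ∷ x) (_ ∷ y)     = only+meet x y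

  meet-comm : ∀ (x y : Vec Bool n) → meet x y ≡ meet y x
  meet-comm []          []          = refl
  meet-comm (true ∷ x)  (true ∷ y)  = cong suc (meet-comm x y)
  meet-comm (true ∷ x)  (false ∷ y) = meet-comm x y
  meet-comm (false ∷ x) (true ∷ y)  = meet-comm x y
  meet-comm (false ∷ x) (false ∷ y) = meet-comm x y

  neither+ : ∀ (x y : Vec Bool n) → weight x ℕ.+ (only y x ℕ.+ neither x y) ≡ n
  neither+ []          []          = refl
  neither+ (true ∷ x)  (true ∷ y)  = cong suc (neither+ x y)
  neither+ (true ∷ x)  (false ∷ y) = cong suc (neither+ x y)
  neither+ (false ∷ x) (true ∷ y)  = trans (ℕ.+-suc (weight x) _) (cong suc (neither+ x y))
  neither+ (false ∷ x) (false ∷ y) = trans (cong (weight x ℕ.+_) (ℕ.+-suc (only y x) _)) (trans (ℕ.+-suc (weight x) _) (cong suc (neither+ x y)))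

  only≡τ : ∀ (x y : Vec Bool n) → weight x ≡ w → weight y ≡ w → only x y ≡ τ x y
  only≡τ x y wx wy = ℕ.+-cancelʳ-≡ (meet x y) (only x y) (τ x y) (trans (only+meet x y) (trans wx (sym (τ+meet x y wx wy))))

  only≡τ′ : ∀ (x y : Vec Bool n) → weight x ≡ w → weight y ≡ w → only y x ≡ τ x y
  only≡τ′ x y wx wy = ℕ.+-cancelʳ-≡ (meet x y) (only y x) (τ x y)
    (trans (cong (only y x ℕ.+_) (meet-comm x y)) (trans (only+meet y x) (trans wy (sym (τ+meet x y wx wy)))))

  -- The value of the j-th Hahn polynomial at distance d in F₂^{n,w}.
  Q : (n w j d : ℕ) → ℤ
  Q n w j d = hahn j (w ∸ d) d d (n ∸ w ∸ d)

  κ-Q : ∀ j (x y : Vec Bool n) → weight x ≡ w → weight y ≡ w → κ j x y ≡ 2^ j * Q n w j (τ x y)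
  κ-Q {n} {w} j x y wx wy = trans (κ-hahn j x y) (cong (λ t → 2^ j * t) (trans
    (cong₂ (λ p s → hahn j p (only x y) (only y x) s) p-eq s-eq) (cong₂ (λ q r → hahn j (w ∸ τ x y) q r (n ∸ w ∸ τ x y)) (only≡τ x y wx wy) (only≡τ′ x y wx wy))))
    where
    p-eq : meet x y ≡ w ∸ τ x y
    p-eq = trans (sym (ℕ.m+n∸m≡n (τ x y) (meet x y))) (cong (_∸ τ x y) (τ+meet x y wx wy))
    s-eq : neither x y ≡ n ∸ w ∸ τ x y
    s-eq = begin
      neither x y ≡⟨ sym (ℕ.m+n∸m≡n (τ x y) _) ⟩
      τ x y ℕ.+ neither x y ∸ τ x y ≡⟨ cong (_∸ τ x y) (sym (ℕ.m+n∸m≡n w _)) ⟩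
      w ℕ.+ (τ x y ℕ.+ neither x y) ∸ w ∸ τ x y ≡⟨ cong (λ t → t ∸ w ∸ τ x y)
        (trans (cong₂ (λ a b → a ℕ.+ (b ℕ.+ neither x y)) (sym wx) (sym (only≡τ′ x y wx wy))) (neither+ x y)) ⟩
      n ∸ w ∸ τ x y ∎
      where open ≡-Reasoning

  2^-positive : ∀ j → ∃ λ a → 2^ j ≡ + suc a
  2^-positive zero = 0 , refl
  2^-positive (suc j) with 2^-positive j
  ... | a , eq = a ℕ.+ suc (a ℕ.+ 0) , cong (λ t → + 2 * t) eq

  units : ∀ {A : Set} → List A → Combination A
  units = map (1ℤ ,_)

  units-∙ : ∀ {A : Set} (X : List A) f → units X ∙ f ≡ ∑ X f
  units-∙ X f = trans (∑-map _ X _) (∑-cong X (λ {x} _ → *-identityˡ (f x)))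

  -- Delsarte's inequality: `κ-psd` at the characteristic vector of X, divided by the positive
  -- factor 2^j.
  Q-psd : ∀ j {X : List (Vec Bool n)} → (∀ {x} → x ∈ X → weight x ≡ w) → 0ℤ ≤ ∑ X (λ x → ∑ X λ y → Q n w j (τ x y))
  Q-psd {n} {w} j {X} weights = go (2^-positive j)
    where
    S = ∑ X (λ x → ∑ X λ y → Q n w j (τ x y))
    form : units X ∙ (λ x → units X ∙ κ j x) ≡ 2^ j * S
    form = trans (units-∙ X _) (trans (∑-cong X λ {x} x∈ → trans (units-∙ X (κ j x))
      (trans (∑-cong X λ {y} y∈ → κ-Q j x y (weights x∈) (weights y∈)) (∑-*ˡ (2^ j) X (λ y → Q n w j (τ x y)))))
      (∑-*ˡ (2^ j) X (λ x → ∑ X λ y → Q n w j (τ x y))))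
    go : (∃ λ a → 2^ j ≡ + suc a) → 0ℤ ≤ S
    go (a , eq) = *-cancelˡ-≤-pos 0ℤ S (+ suc a) (≤-trans (≤-reflexive (*-zeroʳ (+ suc a)))
      (≤-trans (κ-psd j (units X)) (≤-reflexive (trans form (cong (λ t → t * S) eq)))))

  -- Let G be the combination of the `Q` with the multipliers in L. Summed over all ordered pairs, 0
  -- ≤ |X| (G 0 - (|X| - 1)(A + 1)). So (|X| - 1)(A + 1) ≤ G 0 < (A + 1) t, and |X| - 1 < t is the
  -- bound.
  lp-bound : ∀ {ds} {X : List (Vec Bool n)} (L : Combination ℕ) A t → Code n w ds X →
             All (λ p → 0ℤ ≤ proj₁ p) L → All (λ d → L ∙ (λ j → Q n w j d) ≤ - (+ suc A)) ds →
             1ℤ + L ∙ (λ j → Q n w j 0) ≤ + suc A * + t → length X ℕ.≤ t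
  lp-bound {n} {w} {ds} {[]} L A t code pos off on = ℕ.z≤n
  lp-bound {n} {w} {ds} {X@(x₀ ∷ X′)} L A t code pos off on = finish
    where
    open Code code
    G : ℕ → ℤ
    G d = L ∙ λ j → Q n w j d
    N = length X′

    total : 0ℤ ≤ ∑ X (λ x → ∑ X λ y → G (τ x y))
    total = ≤-trans (∑-nonneg L λ {p} p∈ → ≤-trans (≤-reflexive (sym (*-zeroʳ (proj₁ p))))
        (*-monoˡ-≤-nonNeg (proj₁ p) {{Data.Integer.nonNegative (All.lookup pos p∈)}} (Q-psd (proj₂ p) weights)))
      (≤-reflexive (trans (∑-cong L λ {p} _ → trans (sym (∑-*ˡ (proj₁ p) X _))
          (∑-cong X λ {x} _ → sym (∑-*ˡ (proj₁ p) X (λ y → Q n w (proj₂ p) (τ x y)))))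
        (trans (∑-swap L X _) (∑-cong X λ {x} _ → ∑-swap L X _))))

    row : ∀ {x} → x ∈ X → ∑ X (λ y → G (τ x y)) ≤ G 0 + + N * - (+ suc A)
    row {x} x∈ = go (split-off {L = units X} (subst Unique (sym (unit-points X)) unique) (∈-map⁺ (1ℤ ,_) x∈))
      where
      number : length (units X) ≡ suc N
      number = cong suc (length-map {B = ℤ × Vec Bool n} (1ℤ ,_) X′)
      unit-points : ∀ (Y : List (Vec Bool n)) → map proj₂ (units Y) ≡ Y
      unit-points []      = refl
      unit-points (y ∷ Y) = cong (y ∷_) (unit-points Y)
      go : (Σ (Combination (Vec Bool n)) λ M → (∀ f → ∑ (units X) f ≡ f (1ℤ , x) + ∑ M f) × length (units X) ≡ suc (length M) ×
             (∀ {q} → q ∈ M → q ∈ units X × x ≢ proj₂ q)) → ∑ X (λ y → G (τ x y)) ≤ G 0 + + N * - (+ suc A)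
      go (M , sum , len , sep) = ≤-trans (≤-reflexive (trans (sym (∑-map (1ℤ ,_) X (λ q → G (τ x (proj₂ q)))))
          (trans (sum (λ q → G (τ x (proj₂ q)))) (cong (λ t → G t + ∑ M (λ q → G (τ x (proj₂ q)))) (τ-self x)))))
        (+-monoʳ-≤ (G 0) (≤-trans (∑-mono-≤ M {g = λ _ → - (+ suc A)} λ {q} q∈ →
            All.lookup off (distance x∈ (subst (proj₂ q ∈_) (unit-points X) (∈-map⁺ proj₂ (proj₁ (sep q∈)))) (proj₂ (sep q∈))))
          (≤-reflexive (trans (∑-const M (- (+ suc A))) (cong (λ k → + k * - (+ suc A))
            (ℕ.suc-injective (trans (sym len) number)))))))

    average : 0ℤ ≤ G 0 + + N * - (+ suc A)
    average = *-cancelˡ-≤-pos 0ℤ (G 0 + + N * - (+ suc A)) (+ suc N) (≤-trans (≤-reflexive (*-zeroʳ (+ suc N)))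
      (≤-trans total (≤-trans (∑-mono-≤ X row) (≤-reflexive (∑-const X (G 0 + + N * - (+ suc A)))))))

    finish : suc N ℕ.≤ t
    finish = drop‿+<+ (*-cancelˡ-<-nonNeg (+ suc A) (≤-<-trans
        (≤-trans (≤-reflexive (sym (+-identityˡ _))) (≤-trans (+-monoˡ-≤ (+ suc A * + N) average) (≤-reflexive (lemma (G 0) (+ N) (+ suc A)))))
        (suc[i]≤j⇒i<j on)))
      where lemma : ∀ g n a → (g + n * - a) + a * n ≡ g
            lemma = solve-∀

  -- Certificates.

  antidiagonal : ℕ → (ℕ → ℕ → ℤ) → List ℤ
  antidiagonal zero    f = f 0 0 ∷ []
  antidiagonal (suc j) f = f 0 (suc j) ∷ antidiagonal j (f ∘ suc)

  differences : List ℤ → List ℤ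
  differences (a ∷ b ∷ cs) = (b - a) ∷ differences (b ∷ cs)
  differences _            = []

  collapse : ℕ → List ℤ → ℤ
  collapse zero    (a ∷ _) = a
  collapse zero    []      = 0ℤ
  collapse (suc j) as      = collapse j (differences as)

  -- The operator (E_x - E_y)^j at (0, 0), where E shifts one variable. It reads f on the
  -- antidiagonal x + y = j only, so `collapse` computes it by a triangle of differences.
  mixed : ℕ → (ℕ → ℕ → ℤ) → ℤ
  mixed zero    f = f 0 0
  mixed (suc j) f = mixed j (λ x y → f (suc x) y - f x (suc y))

  differences-antidiagonal : ∀ j f → differences (antidiagonal (suc j) f) ≡ antidiagonal j (λ x y → f (suc x) y - f x (suc y))
  differences-antidiagonal zero    f = refl
  differences-antidiagonal (suc j) f = cong (_∷_ (f 1 (suc j) - f 0 (2 ℕ.+ j))) (differences-antidiagonal j (f ∘ suc))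

  collapse-antidiagonal : ∀ j f → collapse j (antidiagonal j f) ≡ mixed j f
  collapse-antidiagonal zero    f = refl
  collapse-antidiagonal (suc j) f = trans (cong (collapse j) (differences-antidiagonal j f)) (collapse-antidiagonal j _)

  mixed-cong : ∀ j {f g} → (∀ x y → f x y ≡ g x y) → mixed j f ≡ mixed j g
  mixed-cong zero    eq = eq 0 0
  mixed-cong (suc j) eq = mixed-cong j (λ x y → cong₂ _-_ (eq (suc x) y) (eq x (suc y)))

  mixed-combination : ∀ j a b f g → mixed j (λ x y → a * f x y - b * g x y) ≡ a * mixed j f - b * mixed j g
  mixed-combination zero    a b f g = refl
  mixed-combination (suc j) a b f g = trans (mixed-cong j (λ x y → lemma a b (f (suc x) y) (g (suc x) y) (f x (suc y)) (g x (suc y))))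
    (mixed-combination j a b (λ x y → f (suc x) y - f x (suc y)) (λ x y → g (suc x) y - g x (suc y)))
    where lemma : ∀ a b p q r s → (a * p - b * q) - (a * r - b * s) ≡ a * (p - r) - b * (q - s)
          lemma = solve-∀

  falling : ℕ → ℕ → ℕ → ℤ
  falling p s zero    = 1ℤ
  falling p s (suc i) = (+ p * + s) * falling (p ∸ 1) (s ∸ 1) i

  -- The recursion of `hahn` branches at every step, lowering either p and s or q and r. In a
  -- product of falling factorials each lowering is a shift of x or of y, so the whole tree becomes
  -- one iterated difference, with quadratically many subtractions.
  mixed-falling : ∀ j p q r s → mixed j (λ x y → falling p s x * falling q r y) ≡ hahn j p q r s
  mixed-falling zero    p q r s = refl
  mixed-falling (suc j) p q r s = trans
    (mixed-cong j (λ x y → lemma (+ p * + s) (falling (p ∸ 1) (s ∸ 1) x) (falling q r y) (falling p s x) (+ q * + r) (falling (q ∸ 1) (r ∸ 1) y)))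
    (trans (mixed-combination j (+ p * + s) (+ q * + r)
        (λ x y → falling (p ∸ 1) (s ∸ 1) x * falling q r y) (λ x y → falling p s x * falling (q ∸ 1) (r ∸ 1) y))
      (cong₂ (λ u v → (+ p * + s) * u - (+ q * + r) * v) (mixed-falling j (p ∸ 1) q r (s ∸ 1)) (mixed-falling j p (q ∸ 1) (r ∸ 1) s)))
    where lemma : ∀ a f g h b k → (a * f) * g - h * (b * k) ≡ a * (f * g) - b * (h * k)
          lemma = solve-∀

  -- The default is returned outside the list, so that memoised look-ups are correct everywhere.
  at : A → List A → ℕ → A
  at d []       i       = d
  at d (x ∷ xs) zero    = x
  at d (x ∷ xs) (suc i) = at d xs i

  at-applyUpTo : ∀ (P : A → Set) (f : ℕ → A) k i {d} → P d → P (f i) → P (at d (applyUpTo f k) i)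
  at-applyUpTo P f zero    i       Pd Pf = Pd
  at-applyUpTo P f (suc k) zero    Pd Pf = Pf
  at-applyUpTo P f (suc k) (suc i) Pd Pf = at-applyUpTo P (f ∘ suc) k i Pd Pf

  fallings : ℕ → ℤ → ℕ → ℕ → List ℤ
  fallings zero    acc p s = []
  fallings (suc k) acc p s = acc ∷ fallings k (acc * (+ p * + s)) (p ∸ 1) (s ∸ 1)

  at-fallings : ∀ k acc p s i {d} → d ≡ acc * falling p s i → at d (fallings k acc p s) i ≡ acc * falling p s i
  at-fallings zero    acc p s i       eq = eq
  at-fallings (suc k) acc p s zero    eq = sym (*-identityʳ acc)
  at-fallings (suc k) acc p s (suc i) eq = trans (at-fallings k (acc * (+ p * + s)) (p ∸ 1) (s ∸ 1) i
    (trans eq (sym (*-assoc acc (+ p * + s) _)))) (*-assoc acc (+ p * + s) _)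

  memo-hahn : (p s d : ℕ) → List ℤ → List ℤ → ℕ → ℤ
  memo-hahn p s d as bs j = collapse j (antidiagonal j λ x y → at (falling p s x) as x * at (falling d d y) bs y)

  hahn-row : (k p s d : ℕ) → List ℤ → List ℤ → List ℤ
  hahn-row k p s d as bs = applyUpTo (memo-hahn p s d as bs) k

  distance-row : (k n w d : ℕ) → List ℤ
  distance-row k n w d = hahn-row k (w ∸ d) (n ∸ w ∸ d) d (fallings k 1ℤ (w ∸ d) (n ∸ w ∸ d)) (fallings k 1ℤ d d)

  hahn-table : (k n w : ℕ) → List (List ℤ)
  hahn-table k n w = applyUpTo (distance-row k n w) (suc w)

  entry : (n w d : ℕ) → List ℤ → ℕ → ℤ
  entry n w d row j = at (Q n w j d) row j

  row-at : List (List ℤ) → ℕ → List ℤ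
  row-at = at []

  -- Holds for every table size k: a degree or distance outside the table falls back on the
  -- definition of `Q`.
  entry-correct : ∀ k n w d j → entry n w d (row-at (hahn-table k n w) d) j ≡ Q n w j d
  entry-correct k n w d j = at-applyUpTo (λ row → at (Q n w j d) row j ≡ Q n w j d) (distance-row k n w) (suc w) d refl
    (at-applyUpTo (_≡ Q n w j d) (memo-hahn p s d (fallings k 1ℤ p s) (fallings k 1ℤ d d)) k j refl (trans (collapse-antidiagonal j _)
      (trans (mixed-cong j (λ x y → cong₂ _*_
        (trans (at-fallings k 1ℤ p s x (sym (*-identityˡ _))) (*-identityˡ _))
        (trans (at-fallings k 1ℤ d d y (sym (*-identityˡ _))) (*-identityˡ _))))
        (mixed-falling j p d d s))))
    where
    p = w ∸ d
    s = n ∸ w ∸ d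

  -- Finding and testing multipliers

  data Quadruple : Set where
    ⟨_,_,_,_⟩ : (a b c d : ℕ) → Quadruple

  data Values : Set where
    ⟪_,_,_,_⟫ : (a b c d : ℤ) → Values

  values : (ℕ → ℤ) → Quadruple → Values
  values q ⟨ j₁ , j₂ , j₃ , j₄ ⟩ = ⟪ q j₁ , q j₂ , q j₃ , q j₄ ⟫

  positive-part negative-part : ℤ → ℕ
  positive-part (+ n)    = n
  positive-part -[1+ n ] = 0
  negative-part (+ n)    = 0
  negative-part -[1+ n ] = suc n

  combine : (ℤ → ℕ) → (l₁ l₂ l₃ l₄ : ℕ) → Values → ℕ
  combine part l₁ l₂ l₃ l₄ ⟪ a , b , c , d ⟫ =
    l₁ ℕ.* part a ℕ.+ (l₂ ℕ.* part b ℕ.+ (l₃ ℕ.* part c ℕ.+ l₄ ℕ.* part d))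

  -- The hypotheses of `lp-bound` for the multipliers l₁, ..., l₄, with negative parts moved to the
  -- other side so that only natural numbers are compared.
  valid : (t l₁ l₂ l₃ l₄ A : ℕ) → Values → List Values → Bool
  valid t l₁ l₂ l₃ l₄ A v₀ vs = (0 ℕ.<ᵇ A) ∧
    ((combine positive-part l₁ l₂ l₃ l₄ v₀ ℕ.<ᵇ A ℕ.* t ℕ.+ combine negative-part l₁ l₂ l₃ l₄ v₀) ∧
    all (λ v → A ℕ.+ combine positive-part l₁ l₂ l₃ l₄ v ℕ.≤ᵇ combine negative-part l₁ l₂ l₃ l₄ v) vs)

  -- The multipliers, up to a common factor, that make the combination equal at all four distances are
  -- 3 × 3 minors. They are found in arithmetic modulo suc M for speed, and nothing has to be proved about
  -- them: M only has to be large enough for residues to determine the integers that occur.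
  module Search (M t : ℕ) where
    residue : ℤ → ℕ
    residue (+ n)    = n
    residue -[1+ n ] = M ∸ n

    negate : ℕ → ℕ
    negate a = (suc M ∸ a) ℕ.% suc M

    _⊖_ : ℕ → ℕ → ℕ
    a ⊖ b = a ℕ.+ (suc M ∸ b)

    _⊝_ : ℤ → ℤ → ℕ
    a ⊝ b = residue a ⊖ residue b

    det₃ : (a₁ a₂ a₃ b₁ b₂ b₃ c₁ c₂ c₃ : ℕ) → ℕ
    det₃ a₁ a₂ a₃ b₁ b₂ b₃ c₁ c₂ c₃ =
      ((a₁ ℕ.* (b₂ ℕ.* c₃) ℕ.+ a₂ ℕ.* (b₃ ℕ.* c₁) ℕ.+ a₃ ℕ.* (b₁ ℕ.* c₂))
        ⊖ ((a₁ ℕ.* (b₃ ℕ.* c₂) ℕ.+ a₂ ℕ.* (b₁ ℕ.* c₃) ℕ.+ a₃ ℕ.* (b₂ ℕ.* c₁)) ℕ.% suc M)) ℕ.% suc M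

    -- s is the common value at the distances modulo `suc M`, read as positive below half the
    -- modulus. The bound asks for a negative value -A, so a positive one is turned around by
    -- negating all multipliers.
    oriented : Values → List Values → (l₁ l₂ l₃ l₄ s : ℕ) → Bool
    oriented v₀ vs l₁ l₂ l₃ l₄ s =
      if 2 ℕ.* s ℕ.<ᵇ M then valid t (negate l₁) (negate l₂) (negate l₃) (negate l₄) s v₀ vs
                        else valid t l₁ l₂ l₃ l₄ (suc M ∸ s) v₀ vs

    multipliers : Values → Values → List Values → (l₁ l₂ l₃ l₄ : ℕ) → Bool
    multipliers v₀ v₁ vs l₁ l₂ l₃ l₄ = oriented v₀ (v₁ ∷ vs) l₁ l₂ l₃ l₄ (combine residue l₁ l₂ l₃ l₄ v₁ ℕ.% suc M)

    -- Cramer's rule for three homogeneous equations in four unknowns; the alternating signs appear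
    -- as exchanged columns.
    minors : Values → Values → List Values → (a₁ a₂ a₃ a₄ b₁ b₂ b₃ b₄ c₁ c₂ c₃ c₄ : ℕ) → Bool
    minors v₀ v₁ vs a₁ a₂ a₃ a₄ b₁ b₂ b₃ b₄ c₁ c₂ c₃ c₄ = multipliers v₀ v₁ vs
      (det₃ a₂ a₃ a₄ b₂ b₃ b₄ c₂ c₃ c₄) (det₃ a₁ a₄ a₃ b₁ b₄ b₃ c₁ c₄ c₃)
      (det₃ a₁ a₂ a₄ b₁ b₂ b₄ c₁ c₂ c₄) (det₃ a₁ a₃ a₂ b₁ b₃ b₂ c₁ c₃ c₂)

    search : (v₀ v₁ v₂ v₃ v₄ : Values) → Bool
    search v₀ v₁@(⟪ p₁ , p₂ , p₃ , p₄ ⟫) v₂@(⟪ q₁ , q₂ , q₃ , q₄ ⟫) v₃@(⟪ r₁ , r₂ , r₃ , r₄ ⟫) v₄@(⟪ s₁ , s₂ , s₃ , s₄ ⟫) =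
      minors v₀ v₁ (v₂ ∷ v₃ ∷ v₄ ∷ []) (p₁ ⊝ q₁) (p₂ ⊝ q₂) (p₃ ⊝ q₃) (p₄ ⊝ q₄)
        (q₁ ⊝ r₁) (q₂ ⊝ r₂) (q₃ ⊝ r₃) (q₄ ⊝ r₄) (r₁ ⊝ s₁) (r₂ ⊝ s₂) (r₃ ⊝ s₃) (r₄ ⊝ s₄)

  lp-certified : (M t n w d₁ d₂ d₃ d₄ : ℕ) → (row₀ row₁ row₂ row₃ row₄ : List ℤ) → List Quadruple → Bool
  lp-certified M t n w d₁ d₂ d₃ d₄ row₀ row₁ row₂ row₃ row₄ = any λ js → Search.search M t
    (values (entry n w 0 row₀) js) (values (entry n w d₁ row₁) js) (values (entry n w d₂ row₂) js)
    (values (entry n w d₃ row₃) js) (values (entry n w d₄ row₄) js)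

  -- `NonpositiveCubic` in truncated arithmetic. For the distances 1, 2, 3, 4 it amounts to (w - 3)²
  -- ≤ (n - 6)(w - 4), which holds whenever w ≥ 5 and n ≥ 2w.
  cubic-test : (n w d₁ d₂ d₃ d₄ : ℕ) → Bool
  cubic-test n w d₁ d₂ d₃ d₄ =
    4 ℕ.* ((w ∸ 3) ℕ.* (w ∸ 3)) ℕ.≤ᵇ (n ∸ 6) ℕ.* (((w ∸ d₁) ℕ.+ (w ∸ d₂) ℕ.+ (w ∸ d₃) ℕ.+ (w ∸ d₄)) ∸ 6)

  infix 3 _∶_
  data Case : Set where
    _∶_ : Quadruple → List Quadruple → Case

  lp-case : (M t n w : ℕ) → List (List ℤ) → Case → Bool
  lp-case M t n w rows (⟨ d₁ , d₂ , d₃ , d₄ ⟩ ∶ supports) =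
    lp-certified M t n w d₁ d₂ d₃ d₄ (row-at rows 0) (row-at rows d₁) (row-at rows d₂) (row-at rows d₃) (row-at rows d₄) supports

  cubic-case : (n w : ℕ) → Case → Bool
  cubic-case n w (⟨ d₁ , d₂ , d₃ , d₄ ⟩ ∶ _) = cubic-test n w d₁ d₂ d₃ d₄

  relevant : ℕ → Case → Bool
  relevant w (⟨ _ , _ , _ , d₄ ⟩ ∶ _) = d₄ ℕ.≤ᵇ w

  below : ℕ → (ℕ → Bool) → Bool
  below zero    p = true
  below (suc n) p = p n ∧ below n p

  below-sound : ∀ n p → T (below n p) → ∀ {i} → i ℕ.< n → T (p i)
  below-sound (suc n) p ok {i} (ℕ.s≤s i≤n) with ℕ.m≤n⇒m<n∨m≡n i≤n
  ... | inj₁ i<n  = below-sound n p (proj₂ (Equivalence.to T-∧ ok)) i<n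
  ... | inj₂ refl = proj₁ (Equivalence.to T-∧ ok)

open Forms
open import Data.Nat using (_+_; _*_; _∸_; _^_; _%_; _/_; _⊔_; _≤_; _<_; _≤ᵇ_; _<ᵇ_; _≡ᵇ_; _≤′_; ≤′-refl; ≤′-step; z≤n; s≤s)
open import Data.Nat.Properties
open import Data.List.Sort ≤-decTotalOrder using (sort; sort-↭; sort-↗)

-- The finite verification.

-- The quadruples of distances below 30 passing the integrality test, each with the supports (found by an exhaustive
-- search) of the linear programming certificates that are needed.
star-case : Case
star-case = ⟨ 1 , 2 , 3 , 4 ⟩ ∶ ⟨ 2 , 3 , 4 , 5 ⟩ ∷ ⟨ 3 , 4 , 5 , 6 ⟩ ∷ ⟨ 4 , 5 , 6 , 7 ⟩ ∷ ⟨ 5 , 6 , 7 , 8 ⟩ ∷ ⟨ 6 , 7 , 8 , 9 ⟩ ∷ ⟨ 7 , 8 , 9 , 10 ⟩ ∷ ⟨ 8 , 9 , 10 , 11 ⟩ ∷ []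

other-cases : List Case
other-cases =
  (⟨ 1 , 4 , 5 , 6 ⟩ ∶ ⟨ 1 , 2 , 3 , 6 ⟩ ∷ ⟨ 3 , 4 , 9 , 10 ⟩ ∷ ⟨ 2 , 3 , 4 , 7 ⟩ ∷ ⟨ 3 , 4 , 5 , 8 ⟩ ∷ ⟨ 5 , 6 , 8 , 11 ⟩ ∷ ⟨ 3 , 4 , 8 , 9 ⟩ ∷ ⟨ 4 , 5 , 7 , 10 ⟩ ∷ ⟨ 1 , 2 , 6 , 7 ⟩ ∷ ⟨ 3 , 4 , 6 , 9 ⟩ ∷ ⟨ 4 , 5 , 6 , 9 ⟩ ∷ ⟨ 1 , 2 , 5 , 6 ⟩ ∷ ⟨ 2 , 3 , 7 , 8 ⟩ ∷ ⟨ 5 , 6 , 7 , 10 ⟩ ∷ ⟨ 4 , 7 , 9 , 10 ⟩ ∷ []) ∷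
  (⟨ 2 , 3 , 4 , 5 ⟩ ∶ ⟨ 1 , 2 , 3 , 4 ⟩ ∷ ⟨ 2 , 3 , 4 , 5 ⟩ ∷ ⟨ 5 , 6 , 8 , 9 ⟩ ∷ ⟨ 3 , 4 , 5 , 6 ⟩ ∷ ⟨ 5 , 6 , 7 , 8 ⟩ ∷ ⟨ 4 , 5 , 6 , 7 ⟩ ∷ ⟨ 6 , 7 , 8 , 9 ⟩ ∷ ⟨ 7 , 8 , 9 , 10 ⟩ ∷ ⟨ 3 , 5 , 7 , 8 ⟩ ∷ ⟨ 2 , 4 , 6 , 7 ⟩ ∷ []) ∷
  (⟨ 2 , 3 , 4 , 6 ⟩ ∶ ⟨ 4 , 6 , 7 , 8 ⟩ ∷ ⟨ 1 , 5 , 7 , 9 ⟩ ∷ ⟨ 3 , 5 , 6 , 7 ⟩ ∷ ⟨ 2 , 3 , 4 , 5 ⟩ ∷ ⟨ 4 , 7 , 8 , 9 ⟩ ∷ ⟨ 4 , 8 , 9 , 10 ⟩ ∷ ⟨ 1 , 3 , 4 , 5 ⟩ ∷ ⟨ 2 , 4 , 5 , 6 ⟩ ∷ ⟨ 3 , 4 , 5 , 6 ⟩ ∷ ⟨ 4 , 5 , 6 , 7 ⟩ ∷ []) ∷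
  (⟨ 2 , 4 , 5 , 6 ⟩ ∶ ⟨ 1 , 2 , 3 , 5 ⟩ ∷ ⟨ 2 , 3 , 4 , 6 ⟩ ∷ ⟨ 3 , 5 , 7 , 8 ⟩ ∷ ⟨ 4 , 5 , 7 , 9 ⟩ ∷ ⟨ 4 , 7 , 8 , 9 ⟩ ∷ ⟨ 5 , 6 , 8 , 10 ⟩ ∷ ⟨ 1 , 2 , 4 , 5 ⟩ ∷ ⟨ 1 , 2 , 5 , 6 ⟩ ∷ ⟨ 3 , 4 , 5 , 7 ⟩ ∷ ⟨ 4 , 5 , 6 , 8 ⟩ ∷ ⟨ 1 , 2 , 6 , 7 ⟩ ∷ ⟨ 2 , 3 , 4 , 7 ⟩ ∷ ⟨ 2 , 3 , 6 , 7 ⟩ ∷ ⟨ 3 , 4 , 5 , 8 ⟩ ∷ ⟨ 5 , 6 , 7 , 9 ⟩ ∷ []) ∷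
  (⟨ 2 , 4 , 6 , 8 ⟩ ∶ ⟨ 2 , 4 , 6 , 8 ⟩ ∷ ⟨ 5 , 7 , 8 , 9 ⟩ ∷ ⟨ 2 , 3 , 5 , 7 ⟩ ∷ ⟨ 5 , 6 , 8 , 10 ⟩ ∷ ⟨ 2 , 4 , 7 , 9 ⟩ ∷ ⟨ 1 , 3 , 5 , 7 ⟩ ∷ ⟨ 1 , 2 , 5 , 6 ⟩ ∷ ⟨ 2 , 5 , 7 , 9 ⟩ ∷ []) ∷
  (⟨ 2 , 8 , 10 , 12 ⟩ ∶ ⟨ 1 , 2 , 3 , 10 ⟩ ∷ ⟨ 1 , 2 , 4 , 10 ⟩ ∷ ⟨ 1 , 2 , 3 , 11 ⟩ ∷ ⟨ 1 , 2 , 3 , 12 ⟩ ∷ []) ∷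
  (⟨ 3 , 4 , 5 , 6 ⟩ ∶ ⟨ 1 , 2 , 3 , 4 ⟩ ∷ ⟨ 4 , 6 , 7 , 8 ⟩ ∷ ⟨ 2 , 3 , 4 , 5 ⟩ ∷ ⟨ 3 , 4 , 5 , 6 ⟩ ∷ ⟨ 6 , 7 , 8 , 9 ⟩ ∷ ⟨ 4 , 5 , 6 , 7 ⟩ ∷ ⟨ 5 , 6 , 7 , 8 ⟩ ∷ ⟨ 2 , 4 , 6 , 7 ⟩ ∷ ⟨ 1 , 3 , 5 , 6 ⟩ ∷ ⟨ 1 , 5 , 7 , 8 ⟩ ∷ []) ∷
  (⟨ 3 , 4 , 5 , 8 ⟩ ∶ ⟨ 4 , 5 , 6 , 7 ⟩ ∷ ⟨ 5 , 6 , 7 , 8 ⟩ ∷ ⟨ 3 , 4 , 5 , 6 ⟩ ∷ ⟨ 2 , 5 , 7 , 8 ⟩ ∷ ⟨ 6 , 7 , 8 , 9 ⟩ ∷ ⟨ 1 , 2 , 3 , 5 ⟩ ∷ ⟨ 1 , 6 , 8 , 9 ⟩ ∷ []) ∷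
  (⟨ 3 , 4 , 6 , 7 ⟩ ∶ ⟨ 3 , 6 , 7 , 8 ⟩ ∷ ⟨ 2 , 4 , 5 , 6 ⟩ ∷ ⟨ 1 , 2 , 3 , 4 ⟩ ∷ ⟨ 1 , 3 , 4 , 5 ⟩ ∷ ⟨ 3 , 5 , 6 , 7 ⟩ ∷ ⟨ 1 , 2 , 4 , 5 ⟩ ∷ ⟨ 4 , 7 , 8 , 9 ⟩ ∷ []) ∷
  (⟨ 3 , 5 , 6 , 8 ⟩ ∶ ⟨ 3 , 5 , 7 , 8 ⟩ ∷ ⟨ 2 , 4 , 6 , 7 ⟩ ∷ ⟨ 1 , 2 , 5 , 6 ⟩ ∷ ⟨ 2 , 6 , 8 , 9 ⟩ ∷ ⟨ 3 , 4 , 5 , 6 ⟩ ∷ ⟨ 3 , 4 , 6 , 7 ⟩ ∷ ⟨ 2 , 3 , 4 , 5 ⟩ ∷ ⟨ 1 , 3 , 4 , 6 ⟩ ∷ ⟨ 2 , 3 , 5 , 6 ⟩ ∷ []) ∷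
  (⟨ 3 , 5 , 7 , 8 ⟩ ∶ ⟨ 2 , 5 , 7 , 8 ⟩ ∷ ⟨ 4 , 5 , 6 , 7 ⟩ ∷ ⟨ 3 , 4 , 5 , 6 ⟩ ∷ ⟨ 2 , 5 , 6 , 8 ⟩ ∷ ⟨ 3 , 4 , 6 , 9 ⟩ ∷ ⟨ 1 , 2 , 4 , 6 ⟩ ∷ ⟨ 1 , 4 , 5 , 7 ⟩ ∷ ⟨ 1 , 2 , 3 , 6 ⟩ ∷ ⟨ 1 , 2 , 5 , 7 ⟩ ∷ ⟨ 5 , 6 , 8 , 9 ⟩ ∷ []) ∷
  (⟨ 3 , 5 , 8 , 9 ⟩ ∶ ⟨ 1 , 4 , 7 , 8 ⟩ ∷ ⟨ 1 , 2 , 5 , 8 ⟩ ∷ ⟨ 1 , 2 , 6 , 9 ⟩ ∷ ⟨ 1 , 4 , 6 , 7 ⟩ ∷ ⟨ 1 , 2 , 6 , 10 ⟩ ∷ ⟨ 1 , 2 , 4 , 8 ⟩ ∷ []) ∷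
  (⟨ 3 , 6 , 9 , 12 ⟩ ∶ ⟨ 1 , 2 , 7 , 8 ⟩ ∷ ⟨ 1 , 3 , 4 , 8 ⟩ ∷ []) ∷
  (⟨ 3 , 7 , 8 , 10 ⟩ ∶ ⟨ 2 , 3 , 7 , 8 ⟩ ∷ ⟨ 1 , 5 , 6 , 8 ⟩ ∷ ⟨ 2 , 3 , 4 , 9 ⟩ ∷ ⟨ 1 , 2 , 6 , 7 ⟩ ∷ []) ∷
  (⟨ 3 , 12 , 15 , 18 ⟩ ∶ ⟨ 1 , 2 , 3 , 14 ⟩ ∷ ⟨ 1 , 2 , 10 , 11 ⟩ ∷ []) ∷
  (⟨ 3 , 13 , 15 , 16 ⟩ ∶ ⟨ 1 , 2 , 3 , 13 ⟩ ∷ ⟨ 1 , 2 , 11 , 12 ⟩ ∷ []) ∷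
  (⟨ 4 , 5 , 6 , 7 ⟩ ∶ ⟨ 1 , 2 , 3 , 4 ⟩ ∷ ⟨ 2 , 3 , 4 , 5 ⟩ ∷ ⟨ 3 , 4 , 5 , 6 ⟩ ∷ ⟨ 2 , 5 , 7 , 8 ⟩ ∷ ⟨ 1 , 4 , 6 , 7 ⟩ ∷ ⟨ 4 , 5 , 6 , 7 ⟩ ∷ ⟨ 5 , 6 , 7 , 8 ⟩ ∷ []) ∷
  (⟨ 4 , 5 , 6 , 8 ⟩ ∶ ⟨ 3 , 5 , 6 , 7 ⟩ ∷ ⟨ 3 , 4 , 6 , 8 ⟩ ∷ ⟨ 2 , 3 , 4 , 5 ⟩ ∷ ⟨ 1 , 4 , 5 , 7 ⟩ ∷ ⟨ 1 , 2 , 3 , 4 ⟩ ∷ ⟨ 1 , 3 , 4 , 5 ⟩ ∷ ⟨ 1 , 4 , 5 , 6 ⟩ ∷ ⟨ 2 , 3 , 4 , 6 ⟩ ∷ ⟨ 1 , 3 , 6 , 8 ⟩ ∷ []) ∷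
  (⟨ 4 , 5 , 6 , 9 ⟩ ∶ ⟨ 3 , 4 , 5 , 6 ⟩ ∷ ⟨ 4 , 5 , 6 , 7 ⟩ ∷ ⟨ 5 , 6 , 7 , 8 ⟩ ∷ ⟨ 2 , 3 , 4 , 5 ⟩ ∷ []) ∷
  (⟨ 4 , 5 , 6 , 10 ⟩ ∶ ⟨ 3 , 4 , 5 , 6 ⟩ ∷ ⟨ 1 , 4 , 6 , 8 ⟩ ∷ ⟨ 3 , 5 , 6 , 7 ⟩ ∷ ⟨ 1 , 4 , 5 , 7 ⟩ ∷ ⟨ 2 , 3 , 4 , 5 ⟩ ∷ []) ∷
  (⟨ 4 , 5 , 8 , 9 ⟩ ∶ ⟨ 1 , 3 , 4 , 5 ⟩ ∷ ⟨ 1 , 4 , 5 , 6 ⟩ ∷ ⟨ 3 , 5 , 6 , 7 ⟩ ∷ ⟨ 1 , 2 , 3 , 4 ⟩ ∷ ⟨ 1 , 2 , 5 , 6 ⟩ ∷ []) ∷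
  (⟨ 4 , 5 , 9 , 10 ⟩ ∶ ⟨ 1 , 4 , 5 , 6 ⟩ ∷ ⟨ 2 , 6 , 7 , 8 ⟩ ∷ ⟨ 1 , 3 , 4 , 5 ⟩ ∷ ⟨ 1 , 2 , 4 , 6 ⟩ ∷ []) ∷
  (⟨ 4 , 6 , 7 , 8 ⟩ ∶ ⟨ 3 , 5 , 6 , 7 ⟩ ∷ ⟨ 2 , 4 , 5 , 6 ⟩ ∷ ⟨ 1 , 2 , 4 , 5 ⟩ ∷ ⟨ 1 , 3 , 4 , 5 ⟩ ∷ ⟨ 3 , 4 , 7 , 8 ⟩ ∷ ⟨ 1 , 2 , 3 , 5 ⟩ ∷ ⟨ 2 , 5 , 6 , 7 ⟩ ∷ ⟨ 1 , 2 , 3 , 6 ⟩ ∷ ⟨ 2 , 3 , 6 , 11 ⟩ ∷ []) ∷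
  (⟨ 4 , 6 , 8 , 10 ⟩ ∶ ⟨ 1 , 2 , 7 , 9 ⟩ ∷ ⟨ 1 , 4 , 6 , 8 ⟩ ∷ ⟨ 1 , 2 , 4 , 5 ⟩ ∷ ⟨ 1 , 2 , 3 , 7 ⟩ ∷ ⟨ 2 , 6 , 8 , 10 ⟩ ∷ ⟨ 1 , 2 , 3 , 4 ⟩ ∷ []) ∷
  (⟨ 4 , 6 , 8 , 12 ⟩ ∶ ⟨ 1 , 3 , 4 , 5 ⟩ ∷ ⟨ 4 , 5 , 6 , 8 ⟩ ∷ []) ∷
  (⟨ 4 , 6 , 9 , 10 ⟩ ∶ ⟨ 3 , 4 , 6 , 7 ⟩ ∷ ⟨ 1 , 5 , 7 , 8 ⟩ ∷ ⟨ 2 , 3 , 6 , 9 ⟩ ∷ ⟨ 1 , 2 , 4 , 7 ⟩ ∷ ⟨ 2 , 3 , 4 , 6 ⟩ ∷ []) ∷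
  (⟨ 4 , 7 , 9 , 10 ⟩ ∶ ⟨ 1 , 2 , 5 , 6 ⟩ ∷ ⟨ 1 , 2 , 3 , 6 ⟩ ∷ ⟨ 2 , 4 , 6 , 7 ⟩ ∷ ⟨ 6 , 7 , 8 , 9 ⟩ ∷ ⟨ 1 , 2 , 5 , 7 ⟩ ∷ []) ∷
  (⟨ 4 , 8 , 9 , 10 ⟩ ∶ ⟨ 1 , 4 , 5 , 6 ⟩ ∷ ⟨ 1 , 2 , 6 , 7 ⟩ ∷ ⟨ 1 , 3 , 4 , 5 ⟩ ∷ ⟨ 1 , 2 , 3 , 7 ⟩ ∷ ⟨ 1 , 2 , 7 , 8 ⟩ ∷ []) ∷
  (⟨ 4 , 8 , 10 , 12 ⟩ ∶ ⟨ 1 , 2 , 5 , 6 ⟩ ∷ ⟨ 1 , 2 , 3 , 8 ⟩ ∷ ⟨ 1 , 2 , 6 , 7 ⟩ ∷ []) ∷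
  (⟨ 4 , 8 , 12 , 16 ⟩ ∶ ⟨ 2 , 4 , 7 , 8 ⟩ ∷ ⟨ 1 , 5 , 9 , 10 ⟩ ∷ ⟨ 1 , 4 , 8 , 9 ⟩ ∷ ⟨ 1 , 9 , 10 , 11 ⟩ ∷ []) ∷
  (⟨ 4 , 11 , 14 , 15 ⟩ ∶ ⟨ 1 , 2 , 9 , 10 ⟩ ∷ ⟨ 1 , 2 , 3 , 10 ⟩ ∷ ⟨ 1 , 6 , 7 , 8 ⟩ ∷ []) ∷
  (⟨ 4 , 16 , 20 , 24 ⟩ ∶ ⟨ 1 , 2 , 14 , 15 ⟩ ∷ ⟨ 1 , 2 , 5 , 14 ⟩ ∷ []) ∷
  (⟨ 5 , 6 , 7 , 8 ⟩ ∶ ⟨ 1 , 2 , 3 , 4 ⟩ ∷ ⟨ 2 , 3 , 4 , 5 ⟩ ∷ ⟨ 3 , 4 , 5 , 6 ⟩ ∷ ⟨ 1 , 4 , 6 , 7 ⟩ ∷ ⟨ 4 , 5 , 6 , 7 ⟩ ∷ []) ∷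
  (⟨ 5 , 6 , 7 , 12 ⟩ ∶ ⟨ 3 , 4 , 5 , 6 ⟩ ∷ []) ∷ (⟨ 5 , 6 , 8 , 9 ⟩ ∶ ⟨ 1 , 2 , 3 , 4 ⟩ ∷ ⟨ 2 , 3 , 4 , 5 ⟩ ∷ ⟨ 2 , 4 , 5 , 6 ⟩ ∷ []) ∷
  (⟨ 5 , 6 , 8 , 10 ⟩ ∶ ⟨ 1 , 2 , 3 , 4 ⟩ ∷ ⟨ 3 , 4 , 5 , 6 ⟩ ∷ ⟨ 2 , 3 , 4 , 5 ⟩ ∷ ⟨ 1 , 2 , 4 , 5 ⟩ ∷ []) ∷
  (⟨ 5 , 7 , 8 , 9 ⟩ ∶ ⟨ 2 , 4 , 5 , 6 ⟩ ∷ ⟨ 1 , 2 , 3 , 4 ⟩ ∷ ⟨ 1 , 2 , 4 , 5 ⟩ ∷ ⟨ 2 , 3 , 6 , 7 ⟩ ∷ ⟨ 1 , 3 , 4 , 5 ⟩ ∷ []) ∷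
  (⟨ 5 , 7 , 8 , 12 ⟩ ∶ ⟨ 3 , 4 , 5 , 6 ⟩ ∷ ⟨ 3 , 4 , 6 , 7 ⟩ ∷ ⟨ 2 , 4 , 5 , 7 ⟩ ∷ []) ∷ (⟨ 5 , 7 , 10 , 12 ⟩ ∶ ⟨ 3 , 4 , 5 , 6 ⟩ ∷ []) ∷
  (⟨ 5 , 8 , 9 , 10 ⟩ ∶ ⟨ 1 , 2 , 5 , 8 ⟩ ∷ ⟨ 2 , 4 , 5 , 6 ⟩ ∷ ⟨ 1 , 3 , 4 , 5 ⟩ ∷ ⟨ 2 , 5 , 6 , 7 ⟩ ∷ ⟨ 2 , 4 , 5 , 7 ⟩ ∷ []) ∷
  (⟨ 5 , 8 , 9 , 11 ⟩ ∶ ⟨ 1 , 2 , 5 , 6 ⟩ ∷ ⟨ 2 , 4 , 5 , 7 ⟩ ∷ ⟨ 1 , 2 , 4 , 6 ⟩ ∷ ⟨ 1 , 3 , 4 , 5 ⟩ ∷ ⟨ 2 , 3 , 6 , 7 ⟩ ∷ []) ∷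
  (⟨ 5 , 9 , 12 , 14 ⟩ ∶ ⟨ 1 , 3 , 6 , 7 ⟩ ∷ ⟨ 1 , 4 , 5 , 8 ⟩ ∷ ⟨ 1 , 2 , 5 , 6 ⟩ ∷ ⟨ 1 , 2 , 3 , 8 ⟩ ∷ ⟨ 1 , 2 , 4 , 6 ⟩ ∷ []) ∷
  (⟨ 5 , 10 , 15 , 20 ⟩ ∶ ⟨ 1 , 4 , 9 , 10 ⟩ ∷ ⟨ 1 , 3 , 8 , 9 ⟩ ∷ ⟨ 1 , 4 , 5 , 10 ⟩ ∷ ⟨ 1 , 3 , 9 , 10 ⟩ ∷ []) ∷
  (⟨ 5 , 11 , 15 , 16 ⟩ ∶ ⟨ 2 , 3 , 8 , 9 ⟩ ∷ ⟨ 1 , 2 , 3 , 10 ⟩ ∷ ⟨ 1 , 5 , 6 , 7 ⟩ ∷ ⟨ 2 , 3 , 8 , 10 ⟩ ∷ []) ∷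
  (⟨ 5 , 12 , 14 , 15 ⟩ ∶ ⟨ 1 , 2 , 8 , 9 ⟩ ∷ ⟨ 1 , 3 , 6 , 7 ⟩ ∷ ⟨ 1 , 2 , 7 , 8 ⟩ ∷ ⟨ 1 , 2 , 3 , 9 ⟩ ∷ ⟨ 3 , 4 , 5 , 6 ⟩ ∷ []) ∷
  (⟨ 6 , 7 , 8 , 9 ⟩ ∶ ⟨ 1 , 2 , 3 , 4 ⟩ ∷ ⟨ 2 , 3 , 4 , 5 ⟩ ∷ ⟨ 3 , 4 , 5 , 6 ⟩ ∷ []) ∷
  (⟨ 6 , 7 , 8 , 10 ⟩ ∶ ⟨ 2 , 3 , 4 , 5 ⟩ ∷ ⟨ 1 , 2 , 3 , 4 ⟩ ∷ ⟨ 1 , 3 , 4 , 8 ⟩ ∷ ⟨ 2 , 3 , 5 , 6 ⟩ ∷ []) ∷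
  (⟨ 6 , 7 , 8 , 14 ⟩ ∶ ⟨ 3 , 4 , 5 , 6 ⟩ ∷ ⟨ 2 , 3 , 4 , 6 ⟩ ∷ []) ∷ (⟨ 6 , 7 , 10 , 12 ⟩ ∶ ⟨ 1 , 4 , 5 , 8 ⟩ ∷ ⟨ 1 , 2 , 3 , 4 ⟩ ∷ []) ∷
  (⟨ 6 , 8 , 9 , 10 ⟩ ∶ ⟨ 1 , 2 , 3 , 4 ⟩ ∷ ⟨ 2 , 4 , 5 , 6 ⟩ ∷ ⟨ 1 , 2 , 4 , 5 ⟩ ∷ ⟨ 1 , 3 , 5 , 6 ⟩ ∷ []) ∷
  (⟨ 6 , 8 , 9 , 12 ⟩ ∶ ⟨ 2 , 3 , 4 , 5 ⟩ ∷ ⟨ 3 , 4 , 5 , 6 ⟩ ∷ ⟨ 2 , 3 , 4 , 6 ⟩ ∷ ⟨ 1 , 3 , 5 , 6 ⟩ ∷ []) ∷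
  (⟨ 6 , 8 , 10 , 11 ⟩ ∶ ⟨ 2 , 3 , 4 , 5 ⟩ ∷ ⟨ 1 , 2 , 3 , 4 ⟩ ∷ ⟨ 1 , 2 , 5 , 6 ⟩ ∷ []) ∷
  (⟨ 6 , 8 , 10 , 12 ⟩ ∶ ⟨ 1 , 2 , 3 , 4 ⟩ ∷ ⟨ 2 , 3 , 4 , 5 ⟩ ∷ ⟨ 1 , 2 , 4 , 5 ⟩ ∷ []) ∷
  (⟨ 6 , 8 , 10 , 16 ⟩ ∶ ⟨ 3 , 4 , 5 , 6 ⟩ ∷ ⟨ 2 , 3 , 4 , 5 ⟩ ∷ ⟨ 3 , 4 , 6 , 7 ⟩ ∷ []) ∷
  (⟨ 6 , 8 , 12 , 14 ⟩ ∶ ⟨ 1 , 3 , 4 , 5 ⟩ ∷ ⟨ 1 , 4 , 5 , 6 ⟩ ∷ ⟨ 2 , 3 , 5 , 6 ⟩ ∷ ⟨ 2 , 3 , 4 , 5 ⟩ ∷ ⟨ 1 , 2 , 5 , 7 ⟩ ∷ []) ∷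
  (⟨ 6 , 9 , 10 , 12 ⟩ ∶ ⟨ 2 , 5 , 7 , 8 ⟩ ∷ ⟨ 1 , 3 , 5 , 6 ⟩ ∷ ⟨ 2 , 4 , 5 , 7 ⟩ ∷ ⟨ 1 , 2 , 3 , 4 ⟩ ∷ ⟨ 1 , 2 , 3 , 5 ⟩ ∷ []) ∷
  (⟨ 6 , 9 , 12 , 15 ⟩ ∶ ⟨ 5 , 6 , 7 , 8 ⟩ ∷ ⟨ 4 , 5 , 7 , 8 ⟩ ∷ ⟨ 1 , 2 , 8 , 9 ⟩ ∷ ⟨ 1 , 2 , 4 , 7 ⟩ ∷ ⟨ 1 , 2 , 3 , 9 ⟩ ∷ []) ∷
  (⟨ 6 , 9 , 12 , 18 ⟩ ∶ ⟨ 2 , 5 , 8 , 9 ⟩ ∷ ⟨ 1 , 2 , 6 , 7 ⟩ ∷ []) ∷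
  (⟨ 6 , 10 , 11 , 12 ⟩ ∶ ⟨ 1 , 4 , 5 , 6 ⟩ ∷ ⟨ 1 , 2 , 5 , 6 ⟩ ∷ ⟨ 2 , 3 , 4 , 7 ⟩ ∷ ⟨ 1 , 2 , 6 , 7 ⟩ ∷ []) ∷
  (⟨ 6 , 10 , 12 , 16 ⟩ ∶ ⟨ 1 , 2 , 6 , 7 ⟩ ∷ ⟨ 2 , 3 , 6 , 8 ⟩ ∷ ⟨ 1 , 2 , 4 , 5 ⟩ ∷ []) ∷
  (⟨ 6 , 10 , 14 , 16 ⟩ ∶ ⟨ 2 , 3 , 6 , 7 ⟩ ∷ ⟨ 1 , 3 , 4 , 8 ⟩ ∷ ⟨ 1 , 2 , 5 , 6 ⟩ ∷ ⟨ 1 , 3 , 7 , 8 ⟩ ∷ []) ∷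
  (⟨ 6 , 10 , 16 , 18 ⟩ ∶ ⟨ 2 , 3 , 8 , 9 ⟩ ∷ ⟨ 3 , 4 , 7 , 9 ⟩ ∷ ⟨ 2 , 4 , 5 , 6 ⟩ ∷ ⟨ 2 , 3 , 6 , 7 ⟩ ∷ []) ∷
  (⟨ 6 , 12 , 15 , 18 ⟩ ∶ ⟨ 1 , 2 , 7 , 8 ⟩ ∷ ⟨ 3 , 7 , 8 , 10 ⟩ ∷ ⟨ 5 , 6 , 7 , 8 ⟩ ∷ ⟨ 1 , 2 , 9 , 10 ⟩ ∷ []) ∷
  (⟨ 6 , 12 , 18 , 24 ⟩ ∶ ⟨ 2 , 3 , 10 , 11 ⟩ ∷ ⟨ 3 , 10 , 11 , 12 ⟩ ∷ ⟨ 2 , 3 , 8 , 9 ⟩ ∷ []) ∷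
  (⟨ 6 , 14 , 16 , 20 ⟩ ∶ ⟨ 1 , 5 , 8 , 9 ⟩ ∷ ⟨ 1 , 2 , 3 , 10 ⟩ ∷ ⟨ 1 , 2 , 9 , 10 ⟩ ∷ ⟨ 1 , 4 , 6 , 7 ⟩ ∷ []) ∷
  (⟨ 6 , 15 , 16 , 18 ⟩ ∶ ⟨ 1 , 4 , 8 , 9 ⟩ ∷ ⟨ 1 , 2 , 9 , 10 ⟩ ∷ ⟨ 3 , 6 , 7 , 8 ⟩ ∷ []) ∷
  (⟨ 6 , 18 , 20 , 21 ⟩ ∶ ⟨ 1 , 8 , 9 , 10 ⟩ ∷ []) ∷ (⟨ 7 , 8 , 9 , 10 ⟩ ∶ ⟨ 1 , 2 , 3 , 4 ⟩ ∷ ⟨ 2 , 3 , 4 , 5 ⟩ ∷ []) ∷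
  (⟨ 7 , 8 , 9 , 11 ⟩ ∶ ⟨ 1 , 2 , 3 , 4 ⟩ ∷ ⟨ 2 , 3 , 4 , 5 ⟩ ∷ ⟨ 1 , 2 , 4 , 5 ⟩ ∷ []) ∷
  (⟨ 7 , 8 , 9 , 16 ⟩ ∶ ⟨ 3 , 4 , 5 , 6 ⟩ ∷ ⟨ 3 , 4 , 5 , 7 ⟩ ∷ []) ∷ (⟨ 7 , 8 , 10 , 12 ⟩ ∶ ⟨ 1 , 2 , 3 , 4 ⟩ ∷ ⟨ 1 , 2 , 4 , 5 ⟩ ∷ []) ∷
  (⟨ 7 , 8 , 10 , 15 ⟩ ∶ ⟨ 2 , 3 , 4 , 5 ⟩ ∷ ⟨ 2 , 3 , 4 , 6 ⟩ ∷ ⟨ 4 , 5 , 6 , 7 ⟩ ∷ []) ∷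
  (⟨ 7 , 8 , 12 , 15 ⟩ ∶ ⟨ 1 , 3 , 4 , 5 ⟩ ∷ ⟨ 1 , 4 , 5 , 6 ⟩ ∷ ⟨ 1 , 2 , 3 , 4 ⟩ ∷ []) ∷
  (⟨ 7 , 8 , 14 , 15 ⟩ ∶ ⟨ 4 , 5 , 6 , 8 ⟩ ∷ ⟨ 4 , 5 , 7 , 8 ⟩ ∷ ⟨ 1 , 5 , 6 , 10 ⟩ ∷ ⟨ 1 , 2 , 3 , 4 ⟩ ∷ []) ∷
  (⟨ 7 , 9 , 10 , 12 ⟩ ∶ ⟨ 1 , 2 , 3 , 4 ⟩ ∷ ⟨ 2 , 3 , 4 , 5 ⟩ ∷ ⟨ 3 , 4 , 5 , 6 ⟩ ∷ []) ∷
  (⟨ 7 , 9 , 15 , 16 ⟩ ∶ ⟨ 4 , 6 , 7 , 8 ⟩ ∷ ⟨ 3 , 4 , 5 , 6 ⟩ ∷ ⟨ 2 , 3 , 4 , 5 ⟩ ∷ []) ∷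
  (⟨ 7 , 10 , 11 , 12 ⟩ ∶ ⟨ 2 , 4 , 5 , 6 ⟩ ∷ ⟨ 1 , 6 , 7 , 8 ⟩ ∷ ⟨ 1 , 3 , 4 , 5 ⟩ ∷ ⟨ 2 , 4 , 5 , 7 ⟩ ∷ ⟨ 1 , 5 , 6 , 7 ⟩ ∷ []) ∷
  (⟨ 7 , 10 , 12 , 14 ⟩ ∶ ⟨ 1 , 2 , 5 , 6 ⟩ ∷ ⟨ 1 , 2 , 4 , 5 ⟩ ∷ ⟨ 1 , 2 , 5 , 7 ⟩ ∷ ⟨ 1 , 3 , 4 , 5 ⟩ ∷ []) ∷
  (⟨ 7 , 10 , 12 , 15 ⟩ ∶ ⟨ 4 , 5 , 6 , 7 ⟩ ∷ ⟨ 5 , 6 , 7 , 8 ⟩ ∷ ⟨ 1 , 2 , 6 , 7 ⟩ ∷ ⟨ 1 , 2 , 4 , 6 ⟩ ∷ ⟨ 2 , 4 , 5 , 6 ⟩ ∷ []) ∷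
  (⟨ 7 , 12 , 14 , 15 ⟩ ∶ ⟨ 1 , 4 , 5 , 6 ⟩ ∷ ⟨ 4 , 5 , 6 , 7 ⟩ ∷ ⟨ 1 , 2 , 3 , 4 ⟩ ∷ []) ∷
  (⟨ 7 , 12 , 15 , 16 ⟩ ∶ ⟨ 1 , 4 , 5 , 6 ⟩ ∷ ⟨ 4 , 5 , 6 , 7 ⟩ ∷ ⟨ 1 , 2 , 5 , 7 ⟩ ∷ []) ∷
  (⟨ 7 , 14 , 21 , 28 ⟩ ∶ ⟨ 2 , 3 , 8 , 9 ⟩ ∷ []) ∷
  (⟨ 7 , 15 , 16 , 21 ⟩ ∶ ⟨ 1 , 2 , 7 , 8 ⟩ ∷ ⟨ 1 , 2 , 3 , 9 ⟩ ∷ ⟨ 1 , 6 , 7 , 8 ⟩ ∷ ⟨ 1 , 3 , 7 , 9 ⟩ ∷ []) ∷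
  (⟨ 8 , 9 , 10 , 11 ⟩ ∶ ⟨ 1 , 2 , 3 , 4 ⟩ ∷ ⟨ 2 , 3 , 4 , 5 ⟩ ∷ []) ∷ (⟨ 8 , 9 , 10 , 12 ⟩ ∶ ⟨ 1 , 2 , 3 , 4 ⟩ ∷ ⟨ 2 , 3 , 4 , 5 ⟩ ∷ []) ∷
  (⟨ 8 , 9 , 10 , 13 ⟩ ∶ ⟨ 1 , 2 , 3 , 4 ⟩ ∷ ⟨ 2 , 4 , 6 , 9 ⟩ ∷ ⟨ 2 , 3 , 4 , 5 ⟩ ∷ ⟨ 1 , 2 , 4 , 6 ⟩ ∷ []) ∷
  (⟨ 8 , 9 , 10 , 14 ⟩ ∶ ⟨ 2 , 3 , 4 , 5 ⟩ ∷ ⟨ 2 , 3 , 4 , 6 ⟩ ∷ ⟨ 1 , 3 , 5 , 10 ⟩ ∷ []) ∷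
  (⟨ 8 , 9 , 10 , 18 ⟩ ∶ ⟨ 3 , 4 , 5 , 6 ⟩ ∷ []) ∷ (⟨ 8 , 9 , 11 , 12 ⟩ ∶ ⟨ 1 , 2 , 3 , 4 ⟩ ∷ ⟨ 2 , 3 , 4 , 5 ⟩ ∷ ⟨ 1 , 2 , 4 , 6 ⟩ ∷ []) ∷
  (⟨ 8 , 9 , 14 , 15 ⟩ ∶ ⟨ 4 , 6 , 7 , 8 ⟩ ∷ ⟨ 1 , 3 , 4 , 5 ⟩ ∷ ⟨ 1 , 2 , 3 , 4 ⟩ ∷ ⟨ 2 , 3 , 4 , 5 ⟩ ∷ []) ∷
  (⟨ 8 , 10 , 11 , 12 ⟩ ∶ ⟨ 1 , 2 , 3 , 4 ⟩ ∷ ⟨ 2 , 4 , 5 , 6 ⟩ ∷ []) ∷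
  (⟨ 8 , 10 , 12 , 13 ⟩ ∶ ⟨ 1 , 2 , 3 , 4 ⟩ ∷ ⟨ 2 , 3 , 4 , 5 ⟩ ∷ []) ∷
  (⟨ 8 , 10 , 12 , 14 ⟩ ∶ ⟨ 1 , 2 , 3 , 4 ⟩ ∷ ⟨ 2 , 3 , 4 , 5 ⟩ ∷ ⟨ 1 , 2 , 4 , 5 ⟩ ∷ []) ∷
  (⟨ 8 , 10 , 12 , 16 ⟩ ∶ ⟨ 2 , 3 , 4 , 5 ⟩ ∷ []) ∷
  (⟨ 8 , 10 , 12 , 18 ⟩ ∶ ⟨ 3 , 4 , 5 , 6 ⟩ ∷ ⟨ 1 , 3 , 5 , 6 ⟩ ∷ ⟨ 2 , 3 , 4 , 5 ⟩ ∷ ⟨ 1 , 3 , 4 , 6 ⟩ ∷ []) ∷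
  (⟨ 8 , 10 , 12 , 20 ⟩ ∶ ⟨ 3 , 4 , 6 , 7 ⟩ ∷ ⟨ 1 , 3 , 5 , 6 ⟩ ∷ []) ∷
  (⟨ 8 , 10 , 14 , 15 ⟩ ∶ ⟨ 2 , 3 , 4 , 5 ⟩ ∷ ⟨ 1 , 2 , 3 , 4 ⟩ ∷ ⟨ 3 , 4 , 5 , 6 ⟩ ∷ []) ∷
  (⟨ 8 , 10 , 16 , 18 ⟩ ∶ ⟨ 3 , 4 , 5 , 6 ⟩ ∷ ⟨ 1 , 5 , 6 , 7 ⟩ ∷ ⟨ 2 , 3 , 4 , 5 ⟩ ∷ ⟨ 1 , 2 , 3 , 4 ⟩ ∷ []) ∷
  (⟨ 8 , 10 , 18 , 20 ⟩ ∶ ⟨ 3 , 4 , 5 , 6 ⟩ ∷ ⟨ 4 , 5 , 6 , 7 ⟩ ∷ ⟨ 1 , 5 , 6 , 7 ⟩ ∷ ⟨ 1 , 6 , 7 , 8 ⟩ ∷ []) ∷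
  (⟨ 8 , 12 , 14 , 15 ⟩ ∶ ⟨ 2 , 4 , 5 , 6 ⟩ ∷ ⟨ 1 , 3 , 4 , 5 ⟩ ∷ ⟨ 1 , 2 , 3 , 4 ⟩ ∷ ⟨ 1 , 2 , 5 , 7 ⟩ ∷ []) ∷
  (⟨ 8 , 12 , 14 , 16 ⟩ ∶ ⟨ 1 , 2 , 5 , 6 ⟩ ∷ ⟨ 1 , 2 , 4 , 5 ⟩ ∷ ⟨ 1 , 3 , 4 , 5 ⟩ ∷ ⟨ 1 , 2 , 3 , 6 ⟩ ∷ ⟨ 2 , 3 , 4 , 5 ⟩ ∷ []) ∷
  (⟨ 8 , 12 , 16 , 20 ⟩ ∶ ⟨ 2 , 4 , 6 , 7 ⟩ ∷ ⟨ 2 , 4 , 6 , 8 ⟩ ∷ ⟨ 1 , 2 , 5 , 6 ⟩ ∷ ⟨ 1 , 2 , 3 , 7 ⟩ ∷ []) ∷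
  (⟨ 8 , 12 , 16 , 24 ⟩ ∶ ⟨ 3 , 5 , 7 , 8 ⟩ ∷ []) ∷
  (⟨ 8 , 12 , 18 , 20 ⟩ ∶ ⟨ 2 , 3 , 6 , 7 ⟩ ∷ ⟨ 2 , 3 , 7 , 8 ⟩ ∷ ⟨ 2 , 4 , 5 , 6 ⟩ ∷ []) ∷
  (⟨ 8 , 13 , 14 , 15 ⟩ ∶ ⟨ 1 , 4 , 5 , 6 ⟩ ∷ ⟨ 2 , 3 , 4 , 7 ⟩ ∷ ⟨ 1 , 2 , 5 , 6 ⟩ ∷ ⟨ 1 , 3 , 4 , 5 ⟩ ∷ ⟨ 1 , 2 , 4 , 6 ⟩ ∷ []) ∷
  (⟨ 8 , 13 , 20 , 21 ⟩ ∶ ⟨ 2 , 5 , 6 , 7 ⟩ ∷ ⟨ 1 , 2 , 6 , 8 ⟩ ∷ []) ∷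
  (⟨ 8 , 14 , 15 , 16 ⟩ ∶ ⟨ 1 , 5 , 6 , 7 ⟩ ∷ ⟨ 3 , 4 , 7 , 8 ⟩ ∷ ⟨ 1 , 3 , 4 , 5 ⟩ ∷ []) ∷
  (⟨ 8 , 14 , 15 , 18 ⟩ ∶ ⟨ 1 , 4 , 5 , 6 ⟩ ∷ ⟨ 2 , 6 , 8 , 9 ⟩ ∷ ⟨ 2 , 3 , 4 , 5 ⟩ ∷ []) ∷
  (⟨ 8 , 14 , 18 , 20 ⟩ ∶ ⟨ 2 , 5 , 6 , 7 ⟩ ∷ ⟨ 1 , 4 , 5 , 6 ⟩ ∷ ⟨ 2 , 3 , 7 , 8 ⟩ ∷ ⟨ 1 , 2 , 5 , 6 ⟩ ∷ []) ∷
  (⟨ 8 , 16 , 18 , 20 ⟩ ∶ ⟨ 1 , 2 , 7 , 8 ⟩ ∷ ⟨ 1 , 5 , 6 , 7 ⟩ ∷ ⟨ 1 , 2 , 6 , 7 ⟩ ∷ []) ∷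
  (⟨ 8 , 16 , 20 , 24 ⟩ ∶ ⟨ 1 , 2 , 7 , 8 ⟩ ∷ ⟨ 1 , 5 , 6 , 7 ⟩ ∷ []) ∷
  (⟨ 9 , 10 , 11 , 12 ⟩ ∶ ⟨ 1 , 2 , 3 , 4 ⟩ ∷ ⟨ 2 , 3 , 4 , 5 ⟩ ∷ []) ∷ (⟨ 9 , 10 , 11 , 20 ⟩ ∶ ⟨ 3 , 4 , 5 , 6 ⟩ ∷ []) ∷
  (⟨ 9 , 10 , 12 , 13 ⟩ ∶ ⟨ 1 , 2 , 3 , 4 ⟩ ∷ ⟨ 2 , 3 , 4 , 5 ⟩ ∷ []) ∷
  (⟨ 9 , 10 , 12 , 14 ⟩ ∶ ⟨ 1 , 2 , 3 , 4 ⟩ ∷ ⟨ 1 , 2 , 4 , 9 ⟩ ∷ []) ∷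
  (⟨ 9 , 10 , 12 , 15 ⟩ ∶ ⟨ 1 , 2 , 3 , 4 ⟩ ∷ ⟨ 1 , 2 , 3 , 5 ⟩ ∷ ⟨ 2 , 3 , 4 , 5 ⟩ ∷ []) ∷
  (⟨ 9 , 10 , 14 , 16 ⟩ ∶ ⟨ 1 , 2 , 3 , 4 ⟩ ∷ ⟨ 1 , 3 , 4 , 5 ⟩ ∷ ⟨ 1 , 2 , 3 , 5 ⟩ ∷ []) ∷
  (⟨ 9 , 12 , 14 , 15 ⟩ ∶ ⟨ 1 , 3 , 4 , 5 ⟩ ∷ ⟨ 1 , 5 , 6 , 7 ⟩ ∷ ⟨ 1 , 4 , 5 , 6 ⟩ ∷ ⟨ 1 , 2 , 3 , 4 ⟩ ∷ []) ∷
  (⟨ 9 , 12 , 15 , 18 ⟩ ∶ ⟨ 3 , 4 , 5 , 6 ⟩ ∷ ⟨ 5 , 6 , 7 , 8 ⟩ ∷ ⟨ 4 , 5 , 6 , 7 ⟩ ∷ []) ∷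
  (⟨ 9 , 12 , 15 , 24 ⟩ ∶ ⟨ 3 , 5 , 7 , 8 ⟩ ∷ ⟨ 1 , 4 , 6 , 7 ⟩ ∷ []) ∷
  (⟨ 9 , 12 , 18 , 21 ⟩ ∶ ⟨ 6 , 7 , 8 , 9 ⟩ ∷ ⟨ 4 , 5 , 6 , 7 ⟩ ∷ ⟨ 1 , 5 , 6 , 7 ⟩ ∷ ⟨ 1 , 4 , 7 , 8 ⟩ ∷ []) ∷
  (⟨ 9 , 14 , 15 , 16 ⟩ ∶ ⟨ 1 , 4 , 5 , 6 ⟩ ∷ ⟨ 2 , 3 , 4 , 7 ⟩ ∷ ⟨ 1 , 3 , 4 , 5 ⟩ ∷ []) ∷
  (⟨ 9 , 15 , 16 , 21 ⟩ ∶ ⟨ 1 , 5 , 6 , 7 ⟩ ∷ ⟨ 1 , 3 , 4 , 5 ⟩ ∷ []) ∷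
  (⟨ 9 , 15 , 18 , 24 ⟩ ∶ ⟨ 1 , 5 , 6 , 7 ⟩ ∷ ⟨ 1 , 4 , 5 , 6 ⟩ ∷ []) ∷ (⟨ 9 , 15 , 21 , 24 ⟩ ∶ ⟨ 1 , 5 , 6 , 7 ⟩ ∷ []) ∷
  (⟨ 9 , 15 , 24 , 27 ⟩ ∶ ⟨ 1 , 5 , 6 , 7 ⟩ ∷ []) ∷ (⟨ 10 , 11 , 12 , 13 ⟩ ∶ ⟨ 1 , 2 , 3 , 4 ⟩ ∷ ⟨ 2 , 3 , 4 , 5 ⟩ ∷ []) ∷
  (⟨ 10 , 11 , 12 , 14 ⟩ ∶ ⟨ 1 , 2 , 3 , 4 ⟩ ∷ ⟨ 2 , 3 , 4 , 5 ⟩ ∷ ⟨ 1 , 2 , 4 , 5 ⟩ ∷ []) ∷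
  (⟨ 10 , 11 , 12 , 15 ⟩ ∶ ⟨ 1 , 2 , 3 , 4 ⟩ ∷ ⟨ 1 , 2 , 4 , 5 ⟩ ∷ ⟨ 2 , 3 , 4 , 5 ⟩ ∷ []) ∷
  (⟨ 10 , 11 , 12 , 16 ⟩ ∶ ⟨ 1 , 2 , 3 , 4 ⟩ ∷ ⟨ 2 , 3 , 4 , 6 ⟩ ∷ ⟨ 2 , 3 , 4 , 5 ⟩ ∷ []) ∷
  (⟨ 10 , 11 , 12 , 22 ⟩ ∶ ⟨ 3 , 4 , 5 , 6 ⟩ ∷ ⟨ 2 , 3 , 4 , 5 ⟩ ∷ []) ∷
  (⟨ 10 , 11 , 15 , 16 ⟩ ∶ ⟨ 1 , 2 , 3 , 4 ⟩ ∷ ⟨ 1 , 2 , 4 , 5 ⟩ ∷ []) ∷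
  (⟨ 10 , 12 , 13 , 14 ⟩ ∶ ⟨ 1 , 2 , 3 , 4 ⟩ ∷ ⟨ 2 , 3 , 4 , 5 ⟩ ∷ []) ∷
  (⟨ 10 , 12 , 13 , 15 ⟩ ∶ ⟨ 1 , 2 , 3 , 4 ⟩ ∷ ⟨ 2 , 3 , 4 , 5 ⟩ ∷ []) ∷
  (⟨ 10 , 12 , 14 , 15 ⟩ ∶ ⟨ 1 , 2 , 3 , 4 ⟩ ∷ ⟨ 2 , 3 , 4 , 5 ⟩ ∷ []) ∷
  (⟨ 10 , 12 , 14 , 16 ⟩ ∶ ⟨ 1 , 2 , 3 , 4 ⟩ ∷ ⟨ 2 , 3 , 4 , 5 ⟩ ∷ []) ∷
  (⟨ 10 , 12 , 14 , 17 ⟩ ∶ ⟨ 1 , 2 , 3 , 4 ⟩ ∷ ⟨ 3 , 5 , 6 , 7 ⟩ ∷ ⟨ 1 , 3 , 4 , 5 ⟩ ∷ []) ∷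
  (⟨ 10 , 12 , 14 , 24 ⟩ ∶ ⟨ 2 , 4 , 6 , 7 ⟩ ∷ ⟨ 1 , 3 , 5 , 6 ⟩ ∷ []) ∷
  (⟨ 10 , 12 , 15 , 16 ⟩ ∶ ⟨ 1 , 2 , 3 , 4 ⟩ ∷ ⟨ 2 , 3 , 4 , 5 ⟩ ∷ []) ∷
  (⟨ 10 , 12 , 16 , 18 ⟩ ∶ ⟨ 1 , 2 , 3 , 4 ⟩ ∷ ⟨ 1 , 3 , 4 , 5 ⟩ ∷ []) ∷
  (⟨ 10 , 12 , 16 , 20 ⟩ ∶ ⟨ 1 , 2 , 3 , 4 ⟩ ∷ ⟨ 1 , 3 , 4 , 5 ⟩ ∷ []) ∷
  (⟨ 10 , 13 , 16 , 18 ⟩ ∶ ⟨ 1 , 2 , 3 , 4 ⟩ ∷ ⟨ 3 , 4 , 5 , 7 ⟩ ∷ ⟨ 2 , 3 , 4 , 5 ⟩ ∷ ⟨ 1 , 2 , 5 , 7 ⟩ ∷ []) ∷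
  (⟨ 10 , 14 , 15 , 16 ⟩ ∶ ⟨ 1 , 3 , 4 , 5 ⟩ ∷ ⟨ 2 , 5 , 6 , 7 ⟩ ∷ ⟨ 1 , 2 , 3 , 4 ⟩ ∷ ⟨ 1 , 4 , 5 , 6 ⟩ ∷ []) ∷
  (⟨ 10 , 14 , 15 , 20 ⟩ ∶ ⟨ 1 , 4 , 5 , 6 ⟩ ∷ ⟨ 2 , 4 , 6 , 9 ⟩ ∷ ⟨ 6 , 7 , 8 , 9 ⟩ ∷ []) ∷
  (⟨ 10 , 14 , 16 , 18 ⟩ ∶ ⟨ 1 , 3 , 4 , 5 ⟩ ∷ ⟨ 1 , 2 , 5 , 6 ⟩ ∷ ⟨ 1 , 2 , 3 , 5 ⟩ ∷ ⟨ 1 , 2 , 3 , 4 ⟩ ∷ []) ∷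
  (⟨ 10 , 14 , 16 , 24 ⟩ ∶ ⟨ 1 , 3 , 5 , 6 ⟩ ∷ ⟨ 1 , 4 , 5 , 6 ⟩ ∷ []) ∷
  (⟨ 10 , 14 , 20 , 24 ⟩ ∶ ⟨ 2 , 5 , 6 , 9 ⟩ ∷ ⟨ 2 , 4 , 5 , 8 ⟩ ∷ []) ∷
  (⟨ 10 , 15 , 16 , 18 ⟩ ∶ ⟨ 1 , 3 , 4 , 5 ⟩ ∷ ⟨ 2 , 3 , 4 , 5 ⟩ ∷ ⟨ 2 , 4 , 5 , 6 ⟩ ∷ []) ∷
  (⟨ 10 , 15 , 16 , 20 ⟩ ∶ ⟨ 1 , 4 , 5 , 9 ⟩ ∷ ⟨ 3 , 4 , 7 , 8 ⟩ ∷ ⟨ 1 , 2 , 4 , 6 ⟩ ∷ []) ∷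
  (⟨ 10 , 15 , 20 , 25 ⟩ ∶ ⟨ 1 , 4 , 5 , 6 ⟩ ∷ []) ∷ (⟨ 10 , 16 , 18 , 20 ⟩ ∶ ⟨ 1 , 4 , 5 , 6 ⟩ ∷ ⟨ 2 , 3 , 4 , 7 ⟩ ∷ []) ∷
  (⟨ 10 , 16 , 18 , 22 ⟩ ∶ ⟨ 1 , 3 , 4 , 5 ⟩ ∷ ⟨ 2 , 3 , 4 , 5 ⟩ ∷ []) ∷ (⟨ 10 , 18 , 24 , 28 ⟩ ∶ ⟨ 1 , 4 , 5 , 6 ⟩ ∷ []) ∷
  (⟨ 10 , 20 , 21 , 22 ⟩ ∶ ⟨ 3 , 4 , 5 , 6 ⟩ ∷ []) ∷ (⟨ 10 , 21 , 22 , 24 ⟩ ∶ ⟨ 4 , 5 , 6 , 7 ⟩ ∷ []) ∷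
  (⟨ 11 , 12 , 13 , 14 ⟩ ∶ ⟨ 1 , 2 , 3 , 4 ⟩ ∷ ⟨ 2 , 3 , 4 , 5 ⟩ ∷ []) ∷
  (⟨ 11 , 12 , 13 , 24 ⟩ ∶ ⟨ 2 , 3 , 5 , 10 ⟩ ∷ ⟨ 3 , 4 , 5 , 6 ⟩ ∷ []) ∷
  (⟨ 11 , 12 , 14 , 15 ⟩ ∶ ⟨ 1 , 2 , 3 , 4 ⟩ ∷ ⟨ 2 , 3 , 4 , 5 ⟩ ∷ []) ∷
  (⟨ 11 , 12 , 14 , 18 ⟩ ∶ ⟨ 1 , 2 , 3 , 4 ⟩ ∷ ⟨ 2 , 3 , 4 , 9 ⟩ ∷ ⟨ 1 , 2 , 3 , 5 ⟩ ∷ []) ∷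
  (⟨ 11 , 12 , 15 , 16 ⟩ ∶ ⟨ 1 , 2 , 3 , 4 ⟩ ∷ ⟨ 2 , 3 , 4 , 5 ⟩ ∷ []) ∷
  (⟨ 11 , 13 , 15 , 16 ⟩ ∶ ⟨ 1 , 2 , 3 , 4 ⟩ ∷ ⟨ 2 , 3 , 4 , 5 ⟩ ∷ []) ∷
  (⟨ 11 , 14 , 15 , 16 ⟩ ∶ ⟨ 1 , 2 , 3 , 4 ⟩ ∷ ⟨ 2 , 3 , 4 , 5 ⟩ ∷ []) ∷
  (⟨ 11 , 15 , 16 , 17 ⟩ ∶ ⟨ 1 , 2 , 3 , 4 ⟩ ∷ ⟨ 1 , 4 , 5 , 6 ⟩ ∷ ⟨ 1 , 3 , 4 , 5 ⟩ ∷ []) ∷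
  (⟨ 11 , 18 , 20 , 21 ⟩ ∶ ⟨ 3 , 4 , 7 , 8 ⟩ ∷ ⟨ 1 , 3 , 4 , 5 ⟩ ∷ []) ∷
  (⟨ 12 , 13 , 14 , 15 ⟩ ∶ ⟨ 1 , 2 , 3 , 4 ⟩ ∷ ⟨ 2 , 3 , 4 , 5 ⟩ ∷ []) ∷
  (⟨ 12 , 13 , 14 , 16 ⟩ ∶ ⟨ 1 , 2 , 3 , 4 ⟩ ∷ ⟨ 1 , 2 , 4 , 13 ⟩ ∷ []) ∷ (⟨ 12 , 13 , 14 , 26 ⟩ ∶ ⟨ 2 , 3 , 4 , 5 ⟩ ∷ []) ∷
  (⟨ 12 , 13 , 15 , 16 ⟩ ∶ ⟨ 1 , 2 , 3 , 4 ⟩ ∷ ⟨ 2 , 3 , 4 , 5 ⟩ ∷ []) ∷ (⟨ 12 , 13 , 15 , 18 ⟩ ∶ ⟨ 1 , 2 , 3 , 4 ⟩ ∷ []) ∷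
  (⟨ 12 , 14 , 15 , 16 ⟩ ∶ ⟨ 1 , 2 , 3 , 4 ⟩ ∷ ⟨ 2 , 3 , 4 , 5 ⟩ ∷ []) ∷ (⟨ 12 , 14 , 15 , 17 ⟩ ∶ ⟨ 1 , 2 , 3 , 4 ⟩ ∷ []) ∷
  (⟨ 12 , 14 , 15 , 18 ⟩ ∶ ⟨ 1 , 2 , 3 , 4 ⟩ ∷ []) ∷ (⟨ 12 , 14 , 15 , 19 ⟩ ∶ ⟨ 1 , 2 , 3 , 4 ⟩ ∷ []) ∷
  (⟨ 12 , 14 , 16 , 18 ⟩ ∶ ⟨ 1 , 2 , 3 , 4 ⟩ ∷ []) ∷ (⟨ 12 , 14 , 16 , 20 ⟩ ∶ ⟨ 1 , 2 , 3 , 4 ⟩ ∷ []) ∷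
  (⟨ 12 , 14 , 16 , 28 ⟩ ∶ ⟨ 2 , 3 , 4 , 5 ⟩ ∷ []) ∷ (⟨ 12 , 14 , 18 , 21 ⟩ ∶ ⟨ 1 , 2 , 3 , 4 ⟩ ∷ []) ∷
  (⟨ 12 , 14 , 20 , 24 ⟩ ∶ ⟨ 1 , 2 , 3 , 4 ⟩ ∷ ⟨ 2 , 3 , 4 , 5 ⟩ ∷ []) ∷ (⟨ 12 , 15 , 16 , 17 ⟩ ∶ ⟨ 1 , 2 , 3 , 4 ⟩ ∷ []) ∷
  (⟨ 12 , 15 , 16 , 18 ⟩ ∶ ⟨ 1 , 2 , 3 , 4 ⟩ ∷ []) ∷ (⟨ 12 , 15 , 16 , 20 ⟩ ∶ ⟨ 1 , 2 , 3 , 4 ⟩ ∷ []) ∷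
  (⟨ 12 , 15 , 17 , 18 ⟩ ∶ ⟨ 1 , 2 , 3 , 4 ⟩ ∷ []) ∷ (⟨ 12 , 15 , 18 , 21 ⟩ ∶ ⟨ 1 , 2 , 3 , 4 ⟩ ∷ []) ∷
  (⟨ 12 , 15 , 18 , 24 ⟩ ∶ ⟨ 1 , 2 , 3 , 4 ⟩ ∷ []) ∷ (⟨ 12 , 15 , 18 , 27 ⟩ ∶ ⟨ 1 , 2 , 3 , 4 ⟩ ∷ []) ∷
  (⟨ 12 , 15 , 24 , 27 ⟩ ∶ ⟨ 2 , 4 , 7 , 8 ⟩ ∷ []) ∷ (⟨ 12 , 16 , 17 , 20 ⟩ ∶ ⟨ 1 , 2 , 3 , 4 ⟩ ∷ ⟨ 1 , 3 , 4 , 5 ⟩ ∷ []) ∷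
  (⟨ 12 , 16 , 18 , 20 ⟩ ∶ ⟨ 1 , 2 , 3 , 4 ⟩ ∷ ⟨ 1 , 3 , 4 , 5 ⟩ ∷ []) ∷
  (⟨ 12 , 16 , 18 , 24 ⟩ ∶ ⟨ 1 , 3 , 8 , 9 ⟩ ∷ ⟨ 1 , 2 , 3 , 4 ⟩ ∷ []) ∷
  (⟨ 12 , 16 , 20 , 22 ⟩ ∶ ⟨ 1 , 2 , 7 , 8 ⟩ ∷ ⟨ 1 , 3 , 4 , 5 ⟩ ∷ []) ∷
  (⟨ 12 , 16 , 20 , 24 ⟩ ∶ ⟨ 1 , 3 , 4 , 5 ⟩ ∷ ⟨ 1 , 2 , 3 , 4 ⟩ ∷ []) ∷ (⟨ 12 , 16 , 24 , 28 ⟩ ∶ ⟨ 1 , 3 , 4 , 5 ⟩ ∷ []) ∷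
  (⟨ 12 , 18 , 19 , 21 ⟩ ∶ ⟨ 2 , 3 , 4 , 7 ⟩ ∷ []) ∷ (⟨ 12 , 18 , 20 , 24 ⟩ ∶ ⟨ 2 , 3 , 4 , 7 ⟩ ∷ []) ∷
  (⟨ 12 , 18 , 21 , 24 ⟩ ∶ ⟨ 2 , 3 , 4 , 11 ⟩ ∷ ⟨ 1 , 3 , 4 , 5 ⟩ ∷ []) ∷ (⟨ 12 , 20 , 22 , 24 ⟩ ∶ ⟨ 2 , 3 , 4 , 5 ⟩ ∷ []) ∷
  (⟨ 13 , 14 , 15 , 16 ⟩ ∶ ⟨ 1 , 2 , 3 , 4 ⟩ ∷ []) ∷ (⟨ 13 , 14 , 15 , 20 ⟩ ∶ ⟨ 1 , 2 , 3 , 4 ⟩ ∷ []) ∷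
  (⟨ 13 , 14 , 15 , 28 ⟩ ∶ ⟨ 2 , 3 , 4 , 5 ⟩ ∷ []) ∷ (⟨ 13 , 14 , 18 , 20 ⟩ ∶ ⟨ 1 , 2 , 3 , 4 ⟩ ∷ []) ∷
  (⟨ 13 , 14 , 20 , 21 ⟩ ∶ ⟨ 1 , 2 , 3 , 4 ⟩ ∷ []) ∷ (⟨ 13 , 15 , 16 , 17 ⟩ ∶ ⟨ 1 , 2 , 3 , 4 ⟩ ∷ []) ∷
  (⟨ 13 , 15 , 16 , 18 ⟩ ∶ ⟨ 1 , 2 , 3 , 4 ⟩ ∷ []) ∷ (⟨ 13 , 15 , 16 , 21 ⟩ ∶ ⟨ 1 , 2 , 3 , 4 ⟩ ∷ []) ∷
  (⟨ 13 , 16 , 20 , 21 ⟩ ∶ ⟨ 1 , 2 , 3 , 4 ⟩ ∷ []) ∷ (⟨ 13 , 18 , 20 , 21 ⟩ ∶ ⟨ 1 , 2 , 3 , 4 ⟩ ∷ []) ∷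
  (⟨ 13 , 18 , 25 , 28 ⟩ ∶ ⟨ 2 , 3 , 4 , 5 ⟩ ∷ []) ∷ (⟨ 13 , 20 , 21 , 26 ⟩ ∶ ⟨ 2 , 3 , 4 , 5 ⟩ ∷ []) ∷
  (⟨ 13 , 21 , 22 , 24 ⟩ ∶ ⟨ 2 , 3 , 4 , 5 ⟩ ∷ []) ∷ (⟨ 14 , 15 , 16 , 17 ⟩ ∶ ⟨ 1 , 2 , 3 , 4 ⟩ ∷ []) ∷
  (⟨ 14 , 15 , 16 , 18 ⟩ ∶ ⟨ 1 , 2 , 3 , 4 ⟩ ∷ []) ∷ (⟨ 14 , 15 , 16 , 19 ⟩ ∶ ⟨ 1 , 2 , 3 , 4 ⟩ ∷ []) ∷
  (⟨ 14 , 15 , 16 , 20 ⟩ ∶ ⟨ 1 , 2 , 3 , 4 ⟩ ∷ []) ∷ (⟨ 14 , 15 , 16 , 21 ⟩ ∶ ⟨ 1 , 2 , 3 , 4 ⟩ ∷ []) ∷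
  (⟨ 14 , 15 , 16 , 22 ⟩ ∶ ⟨ 1 , 2 , 3 , 4 ⟩ ∷ []) ∷ (⟨ 14 , 15 , 18 , 20 ⟩ ∶ ⟨ 1 , 2 , 3 , 4 ⟩ ∷ []) ∷
  (⟨ 14 , 15 , 18 , 24 ⟩ ∶ ⟨ 1 , 2 , 3 , 4 ⟩ ∷ []) ∷ (⟨ 14 , 15 , 19 , 20 ⟩ ∶ ⟨ 1 , 2 , 3 , 4 ⟩ ∷ []) ∷
  (⟨ 14 , 15 , 20 , 21 ⟩ ∶ ⟨ 1 , 2 , 3 , 4 ⟩ ∷ []) ∷ (⟨ 14 , 16 , 17 , 18 ⟩ ∶ ⟨ 1 , 2 , 3 , 4 ⟩ ∷ []) ∷
  (⟨ 14 , 16 , 18 , 20 ⟩ ∶ ⟨ 1 , 2 , 3 , 4 ⟩ ∷ []) ∷ (⟨ 14 , 16 , 18 , 22 ⟩ ∶ ⟨ 1 , 2 , 3 , 4 ⟩ ∷ []) ∷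
  (⟨ 14 , 16 , 20 , 21 ⟩ ∶ ⟨ 1 , 2 , 3 , 4 ⟩ ∷ []) ∷ (⟨ 14 , 16 , 20 , 24 ⟩ ∶ ⟨ 1 , 2 , 3 , 4 ⟩ ∷ []) ∷
  (⟨ 14 , 17 , 18 , 20 ⟩ ∶ ⟨ 1 , 2 , 3 , 4 ⟩ ∷ []) ∷ (⟨ 14 , 18 , 19 , 20 ⟩ ∶ ⟨ 1 , 2 , 3 , 4 ⟩ ∷ []) ∷
  (⟨ 14 , 18 , 20 , 21 ⟩ ∶ ⟨ 1 , 2 , 3 , 4 ⟩ ∷ []) ∷ (⟨ 14 , 18 , 20 , 24 ⟩ ∶ ⟨ 1 , 2 , 3 , 4 ⟩ ∷ []) ∷
  (⟨ 14 , 19 , 20 , 21 ⟩ ∶ ⟨ 1 , 2 , 3 , 4 ⟩ ∷ []) ∷ (⟨ 14 , 20 , 21 , 24 ⟩ ∶ ⟨ 1 , 2 , 3 , 4 ⟩ ∷ []) ∷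
  (⟨ 14 , 20 , 22 , 24 ⟩ ∶ ⟨ 1 , 2 , 3 , 4 ⟩ ∷ []) ∷ (⟨ 14 , 20 , 24 , 28 ⟩ ∶ ⟨ 1 , 2 , 3 , 4 ⟩ ∷ []) ∷
  (⟨ 14 , 20 , 26 , 27 ⟩ ∶ ⟨ 1 , 2 , 3 , 4 ⟩ ∷ []) ∷ (⟨ 14 , 22 , 24 , 25 ⟩ ∶ ⟨ 1 , 2 , 3 , 4 ⟩ ∷ []) ∷
  (⟨ 14 , 26 , 27 , 28 ⟩ ∶ ⟨ 1 , 2 , 3 , 4 ⟩ ∷ []) ∷ (⟨ 15 , 16 , 17 , 18 ⟩ ∶ ⟨ 1 , 2 , 3 , 4 ⟩ ∷ []) ∷
  (⟨ 15 , 16 , 17 , 19 ⟩ ∶ ⟨ 1 , 2 , 3 , 4 ⟩ ∷ []) ∷ (⟨ 15 , 16 , 17 , 20 ⟩ ∶ ⟨ 1 , 2 , 3 , 4 ⟩ ∷ []) ∷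
  (⟨ 15 , 16 , 17 , 21 ⟩ ∶ ⟨ 1 , 2 , 3 , 4 ⟩ ∷ []) ∷ (⟨ 15 , 16 , 18 , 19 ⟩ ∶ ⟨ 1 , 2 , 3 , 4 ⟩ ∷ []) ∷
  (⟨ 15 , 16 , 18 , 20 ⟩ ∶ ⟨ 1 , 2 , 3 , 4 ⟩ ∷ []) ∷ (⟨ 15 , 16 , 18 , 21 ⟩ ∶ ⟨ 1 , 2 , 3 , 4 ⟩ ∷ []) ∷
  (⟨ 15 , 16 , 18 , 24 ⟩ ∶ ⟨ 1 , 2 , 3 , 4 ⟩ ∷ []) ∷ (⟨ 15 , 16 , 19 , 20 ⟩ ∶ ⟨ 1 , 2 , 3 , 4 ⟩ ∷ []) ∷
  (⟨ 15 , 16 , 19 , 21 ⟩ ∶ ⟨ 1 , 2 , 3 , 4 ⟩ ∷ []) ∷ (⟨ 15 , 16 , 20 , 21 ⟩ ∶ ⟨ 1 , 2 , 3 , 4 ⟩ ∷ []) ∷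
  (⟨ 15 , 16 , 21 , 22 ⟩ ∶ ⟨ 1 , 2 , 3 , 4 ⟩ ∷ []) ∷ (⟨ 15 , 16 , 21 , 23 ⟩ ∶ ⟨ 1 , 2 , 3 , 4 ⟩ ∷ []) ∷
  (⟨ 15 , 16 , 21 , 25 ⟩ ∶ ⟨ 1 , 2 , 3 , 4 ⟩ ∷ []) ∷ (⟨ 15 , 17 , 18 , 20 ⟩ ∶ ⟨ 1 , 2 , 3 , 4 ⟩ ∷ []) ∷
  (⟨ 15 , 18 , 19 , 20 ⟩ ∶ ⟨ 1 , 2 , 3 , 4 ⟩ ∷ []) ∷ (⟨ 15 , 18 , 19 , 24 ⟩ ∶ ⟨ 1 , 2 , 3 , 4 ⟩ ∷ []) ∷
  (⟨ 15 , 18 , 20 , 21 ⟩ ∶ ⟨ 1 , 2 , 3 , 4 ⟩ ∷ []) ∷ (⟨ 15 , 18 , 20 , 23 ⟩ ∶ ⟨ 1 , 2 , 3 , 4 ⟩ ∷ []) ∷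
  (⟨ 15 , 18 , 20 , 24 ⟩ ∶ ⟨ 1 , 2 , 3 , 4 ⟩ ∷ []) ∷ (⟨ 15 , 18 , 21 , 24 ⟩ ∶ ⟨ 1 , 2 , 3 , 4 ⟩ ∷ []) ∷
  (⟨ 15 , 18 , 23 , 24 ⟩ ∶ ⟨ 1 , 2 , 3 , 4 ⟩ ∷ []) ∷ (⟨ 15 , 18 , 24 , 27 ⟩ ∶ ⟨ 1 , 2 , 3 , 4 ⟩ ∷ []) ∷
  (⟨ 15 , 20 , 21 , 22 ⟩ ∶ ⟨ 1 , 2 , 3 , 4 ⟩ ∷ []) ∷ (⟨ 15 , 21 , 24 , 27 ⟩ ∶ ⟨ 1 , 2 , 3 , 4 ⟩ ∷ []) ∷
  (⟨ 15 , 22 , 26 , 28 ⟩ ∶ ⟨ 1 , 2 , 3 , 4 ⟩ ∷ []) ∷ (⟨ 15 , 24 , 25 , 27 ⟩ ∶ ⟨ 1 , 2 , 3 , 4 ⟩ ∷ []) ∷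
  (⟨ 16 , 17 , 18 , 19 ⟩ ∶ ⟨ 1 , 2 , 3 , 4 ⟩ ∷ []) ∷ (⟨ 16 , 17 , 18 , 20 ⟩ ∶ ⟨ 1 , 2 , 3 , 4 ⟩ ∷ []) ∷
  (⟨ 16 , 17 , 20 , 21 ⟩ ∶ ⟨ 1 , 2 , 3 , 4 ⟩ ∷ []) ∷ (⟨ 16 , 18 , 19 , 20 ⟩ ∶ ⟨ 1 , 2 , 3 , 4 ⟩ ∷ []) ∷
  (⟨ 16 , 18 , 19 , 22 ⟩ ∶ ⟨ 1 , 2 , 3 , 4 ⟩ ∷ []) ∷ (⟨ 16 , 18 , 20 , 21 ⟩ ∶ ⟨ 1 , 2 , 3 , 4 ⟩ ∷ []) ∷
  (⟨ 16 , 18 , 20 , 22 ⟩ ∶ ⟨ 1 , 2 , 3 , 4 ⟩ ∷ []) ∷ (⟨ 16 , 18 , 20 , 24 ⟩ ∶ ⟨ 1 , 2 , 3 , 4 ⟩ ∷ []) ∷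
  (⟨ 16 , 18 , 20 , 26 ⟩ ∶ ⟨ 1 , 2 , 3 , 4 ⟩ ∷ []) ∷ (⟨ 16 , 18 , 20 , 28 ⟩ ∶ ⟨ 1 , 2 , 3 , 4 ⟩ ∷ []) ∷
  (⟨ 16 , 18 , 21 , 25 ⟩ ∶ ⟨ 1 , 2 , 3 , 4 ⟩ ∷ []) ∷ (⟨ 16 , 18 , 22 , 24 ⟩ ∶ ⟨ 1 , 2 , 3 , 4 ⟩ ∷ []) ∷
  (⟨ 16 , 19 , 20 , 21 ⟩ ∶ ⟨ 1 , 2 , 3 , 4 ⟩ ∷ []) ∷ (⟨ 16 , 19 , 20 , 24 ⟩ ∶ ⟨ 1 , 2 , 3 , 4 ⟩ ∷ []) ∷
  (⟨ 16 , 20 , 21 , 22 ⟩ ∶ ⟨ 1 , 2 , 3 , 4 ⟩ ∷ []) ∷ (⟨ 16 , 20 , 21 , 23 ⟩ ∶ ⟨ 1 , 2 , 3 , 4 ⟩ ∷ []) ∷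
  (⟨ 16 , 20 , 21 , 24 ⟩ ∶ ⟨ 1 , 2 , 3 , 4 ⟩ ∷ []) ∷ (⟨ 16 , 20 , 21 , 28 ⟩ ∶ ⟨ 1 , 2 , 3 , 4 ⟩ ∷ []) ∷
  (⟨ 16 , 20 , 22 , 24 ⟩ ∶ ⟨ 1 , 2 , 3 , 4 ⟩ ∷ []) ∷ (⟨ 16 , 20 , 24 , 26 ⟩ ∶ ⟨ 1 , 2 , 3 , 4 ⟩ ∷ []) ∷
  (⟨ 16 , 20 , 24 , 28 ⟩ ∶ ⟨ 1 , 2 , 3 , 4 ⟩ ∷ []) ∷ (⟨ 16 , 21 , 24 , 25 ⟩ ∶ ⟨ 1 , 2 , 3 , 4 ⟩ ∷ []) ∷
  (⟨ 16 , 22 , 25 , 27 ⟩ ∶ ⟨ 1 , 2 , 3 , 4 ⟩ ∷ []) ∷ (⟨ 17 , 18 , 19 , 20 ⟩ ∶ ⟨ 1 , 2 , 3 , 4 ⟩ ∷ []) ∷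
  (⟨ 17 , 18 , 20 , 21 ⟩ ∶ ⟨ 1 , 2 , 3 , 4 ⟩ ∷ []) ∷ (⟨ 17 , 18 , 20 , 22 ⟩ ∶ ⟨ 1 , 2 , 3 , 4 ⟩ ∷ []) ∷
  (⟨ 17 , 18 , 20 , 23 ⟩ ∶ ⟨ 1 , 2 , 3 , 4 ⟩ ∷ []) ∷ (⟨ 17 , 18 , 21 , 24 ⟩ ∶ ⟨ 1 , 2 , 3 , 4 ⟩ ∷ []) ∷
  (⟨ 17 , 20 , 21 , 22 ⟩ ∶ ⟨ 1 , 2 , 3 , 4 ⟩ ∷ []) ∷ (⟨ 17 , 20 , 21 , 24 ⟩ ∶ ⟨ 1 , 2 , 3 , 4 ⟩ ∷ []) ∷
  (⟨ 17 , 21 , 23 , 24 ⟩ ∶ ⟨ 1 , 2 , 3 , 4 ⟩ ∷ []) ∷ (⟨ 18 , 19 , 20 , 21 ⟩ ∶ ⟨ 1 , 2 , 3 , 4 ⟩ ∷ []) ∷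
  (⟨ 18 , 19 , 20 , 22 ⟩ ∶ ⟨ 1 , 2 , 3 , 4 ⟩ ∷ []) ∷ (⟨ 18 , 19 , 20 , 23 ⟩ ∶ ⟨ 1 , 2 , 3 , 4 ⟩ ∷ []) ∷
  (⟨ 18 , 19 , 20 , 24 ⟩ ∶ ⟨ 1 , 2 , 3 , 4 ⟩ ∷ []) ∷ (⟨ 18 , 20 , 21 , 22 ⟩ ∶ ⟨ 1 , 2 , 3 , 4 ⟩ ∷ []) ∷
  (⟨ 18 , 20 , 21 , 23 ⟩ ∶ ⟨ 1 , 2 , 3 , 4 ⟩ ∷ []) ∷ (⟨ 18 , 20 , 21 , 24 ⟩ ∶ ⟨ 1 , 2 , 3 , 4 ⟩ ∷ []) ∷
  (⟨ 18 , 20 , 21 , 25 ⟩ ∶ ⟨ 1 , 2 , 3 , 4 ⟩ ∷ []) ∷ (⟨ 18 , 20 , 21 , 27 ⟩ ∶ ⟨ 1 , 2 , 3 , 4 ⟩ ∷ []) ∷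
  (⟨ 18 , 20 , 22 , 23 ⟩ ∶ ⟨ 1 , 2 , 3 , 4 ⟩ ∷ []) ∷ (⟨ 18 , 20 , 22 , 24 ⟩ ∶ ⟨ 1 , 2 , 3 , 4 ⟩ ∷ []) ∷
  (⟨ 18 , 20 , 23 , 24 ⟩ ∶ ⟨ 1 , 2 , 3 , 4 ⟩ ∷ []) ∷ (⟨ 18 , 20 , 24 , 26 ⟩ ∶ ⟨ 1 , 2 , 3 , 4 ⟩ ∷ []) ∷
  (⟨ 18 , 20 , 24 , 28 ⟩ ∶ ⟨ 1 , 2 , 3 , 4 ⟩ ∷ []) ∷ (⟨ 18 , 21 , 22 , 24 ⟩ ∶ ⟨ 1 , 2 , 3 , 4 ⟩ ∷ []) ∷
  (⟨ 18 , 21 , 24 , 25 ⟩ ∶ ⟨ 1 , 2 , 3 , 4 ⟩ ∷ []) ∷ (⟨ 18 , 21 , 24 , 27 ⟩ ∶ ⟨ 1 , 2 , 3 , 4 ⟩ ∷ []) ∷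
  (⟨ 18 , 21 , 25 , 28 ⟩ ∶ ⟨ 1 , 2 , 3 , 4 ⟩ ∷ []) ∷ (⟨ 18 , 22 , 25 , 28 ⟩ ∶ ⟨ 1 , 2 , 3 , 4 ⟩ ∷ []) ∷
  (⟨ 18 , 23 , 25 , 28 ⟩ ∶ ⟨ 1 , 2 , 3 , 4 ⟩ ∷ []) ∷ (⟨ 18 , 24 , 25 , 28 ⟩ ∶ ⟨ 1 , 2 , 3 , 4 ⟩ ∷ []) ∷
  (⟨ 18 , 24 , 26 , 27 ⟩ ∶ ⟨ 1 , 2 , 3 , 4 ⟩ ∷ []) ∷ (⟨ 18 , 25 , 27 , 28 ⟩ ∶ ⟨ 1 , 2 , 3 , 4 ⟩ ∷ []) ∷
  (⟨ 19 , 20 , 21 , 22 ⟩ ∶ ⟨ 1 , 2 , 3 , 4 ⟩ ∷ []) ∷ (⟨ 19 , 20 , 21 , 24 ⟩ ∶ ⟨ 1 , 2 , 3 , 4 ⟩ ∷ []) ∷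
  (⟨ 19 , 20 , 21 , 26 ⟩ ∶ ⟨ 1 , 2 , 3 , 4 ⟩ ∷ []) ∷ (⟨ 19 , 20 , 22 , 24 ⟩ ∶ ⟨ 1 , 2 , 3 , 4 ⟩ ∷ []) ∷
  (⟨ 19 , 20 , 23 , 24 ⟩ ∶ ⟨ 1 , 2 , 3 , 4 ⟩ ∷ []) ∷ (⟨ 19 , 20 , 24 , 25 ⟩ ∶ ⟨ 1 , 2 , 3 , 4 ⟩ ∷ []) ∷
  (⟨ 19 , 21 , 24 , 25 ⟩ ∶ ⟨ 1 , 2 , 3 , 4 ⟩ ∷ []) ∷ (⟨ 19 , 23 , 24 , 25 ⟩ ∶ ⟨ 1 , 2 , 3 , 4 ⟩ ∷ []) ∷
  (⟨ 19 , 24 , 25 , 29 ⟩ ∶ ⟨ 1 , 2 , 3 , 4 ⟩ ∷ []) ∷ (⟨ 19 , 26 , 27 , 28 ⟩ ∶ ⟨ 1 , 2 , 3 , 4 ⟩ ∷ []) ∷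
  (⟨ 20 , 21 , 22 , 23 ⟩ ∶ ⟨ 1 , 2 , 3 , 4 ⟩ ∷ []) ∷ (⟨ 20 , 21 , 22 , 24 ⟩ ∶ ⟨ 1 , 2 , 3 , 4 ⟩ ∷ []) ∷
  (⟨ 20 , 21 , 22 , 25 ⟩ ∶ ⟨ 1 , 2 , 3 , 4 ⟩ ∷ []) ∷ (⟨ 20 , 21 , 22 , 26 ⟩ ∶ ⟨ 1 , 2 , 3 , 4 ⟩ ∷ []) ∷
  (⟨ 20 , 21 , 22 , 27 ⟩ ∶ ⟨ 1 , 2 , 3 , 4 ⟩ ∷ []) ∷ (⟨ 20 , 21 , 23 , 24 ⟩ ∶ ⟨ 1 , 2 , 3 , 4 ⟩ ∷ []) ∷
  (⟨ 20 , 21 , 24 , 25 ⟩ ∶ ⟨ 1 , 2 , 3 , 4 ⟩ ∷ []) ∷ (⟨ 20 , 21 , 24 , 26 ⟩ ∶ ⟨ 1 , 2 , 3 , 4 ⟩ ∷ []) ∷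
  (⟨ 20 , 21 , 24 , 27 ⟩ ∶ ⟨ 1 , 2 , 3 , 4 ⟩ ∷ []) ∷ (⟨ 20 , 21 , 24 , 28 ⟩ ∶ ⟨ 1 , 2 , 3 , 4 ⟩ ∷ []) ∷
  (⟨ 20 , 21 , 24 , 29 ⟩ ∶ ⟨ 1 , 2 , 3 , 4 ⟩ ∷ []) ∷ (⟨ 20 , 21 , 25 , 26 ⟩ ∶ ⟨ 1 , 2 , 3 , 4 ⟩ ∷ []) ∷
  (⟨ 20 , 21 , 26 , 27 ⟩ ∶ ⟨ 1 , 2 , 3 , 4 ⟩ ∷ []) ∷ (⟨ 20 , 22 , 23 , 24 ⟩ ∶ ⟨ 1 , 2 , 3 , 4 ⟩ ∷ []) ∷
  (⟨ 20 , 22 , 24 , 25 ⟩ ∶ ⟨ 1 , 2 , 3 , 4 ⟩ ∷ []) ∷ (⟨ 20 , 22 , 24 , 26 ⟩ ∶ ⟨ 1 , 2 , 3 , 4 ⟩ ∷ []) ∷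
  (⟨ 20 , 22 , 24 , 28 ⟩ ∶ ⟨ 1 , 2 , 3 , 4 ⟩ ∷ []) ∷ (⟨ 20 , 23 , 24 , 25 ⟩ ∶ ⟨ 1 , 2 , 3 , 4 ⟩ ∷ []) ∷
  (⟨ 20 , 23 , 24 , 28 ⟩ ∶ ⟨ 1 , 2 , 3 , 4 ⟩ ∷ []) ∷ (⟨ 20 , 24 , 25 , 26 ⟩ ∶ ⟨ 1 , 2 , 3 , 4 ⟩ ∷ []) ∷
  (⟨ 20 , 24 , 25 , 28 ⟩ ∶ ⟨ 1 , 2 , 3 , 4 ⟩ ∷ []) ∷ (⟨ 20 , 24 , 26 , 28 ⟩ ∶ ⟨ 1 , 2 , 3 , 4 ⟩ ∷ []) ∷
  (⟨ 20 , 24 , 27 , 28 ⟩ ∶ ⟨ 1 , 2 , 3 , 4 ⟩ ∷ []) ∷ (⟨ 21 , 22 , 23 , 24 ⟩ ∶ ⟨ 1 , 2 , 3 , 4 ⟩ ∷ []) ∷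
  (⟨ 21 , 22 , 24 , 25 ⟩ ∶ ⟨ 1 , 2 , 3 , 4 ⟩ ∷ []) ∷ (⟨ 21 , 22 , 24 , 28 ⟩ ∶ ⟨ 1 , 2 , 3 , 4 ⟩ ∷ []) ∷
  (⟨ 21 , 22 , 28 , 29 ⟩ ∶ ⟨ 1 , 2 , 3 , 4 ⟩ ∷ []) ∷ (⟨ 21 , 23 , 24 , 25 ⟩ ∶ ⟨ 1 , 2 , 3 , 4 ⟩ ∷ []) ∷
  (⟨ 21 , 23 , 24 , 27 ⟩ ∶ ⟨ 1 , 2 , 3 , 4 ⟩ ∷ []) ∷ (⟨ 21 , 24 , 25 , 26 ⟩ ∶ ⟨ 1 , 2 , 3 , 4 ⟩ ∷ []) ∷
  (⟨ 21 , 24 , 25 , 27 ⟩ ∶ ⟨ 1 , 2 , 3 , 4 ⟩ ∷ []) ∷ (⟨ 21 , 24 , 25 , 28 ⟩ ∶ ⟨ 1 , 2 , 3 , 4 ⟩ ∷ []) ∷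
  (⟨ 21 , 24 , 27 , 28 ⟩ ∶ ⟨ 1 , 2 , 3 , 4 ⟩ ∷ []) ∷ (⟨ 21 , 25 , 26 , 28 ⟩ ∶ ⟨ 1 , 2 , 3 , 4 ⟩ ∷ []) ∷
  (⟨ 22 , 23 , 24 , 25 ⟩ ∶ ⟨ 1 , 2 , 3 , 4 ⟩ ∷ []) ∷ (⟨ 22 , 23 , 24 , 26 ⟩ ∶ ⟨ 1 , 2 , 3 , 4 ⟩ ∷ []) ∷
  (⟨ 22 , 24 , 25 , 26 ⟩ ∶ ⟨ 1 , 2 , 3 , 4 ⟩ ∷ []) ∷ (⟨ 22 , 24 , 25 , 27 ⟩ ∶ ⟨ 1 , 2 , 3 , 4 ⟩ ∷ []) ∷
  (⟨ 22 , 24 , 26 , 28 ⟩ ∶ ⟨ 1 , 2 , 3 , 4 ⟩ ∷ []) ∷ (⟨ 22 , 25 , 27 , 28 ⟩ ∶ ⟨ 1 , 2 , 3 , 4 ⟩ ∷ []) ∷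
  (⟨ 23 , 24 , 25 , 26 ⟩ ∶ ⟨ 1 , 2 , 3 , 4 ⟩ ∷ []) ∷ (⟨ 23 , 24 , 25 , 27 ⟩ ∶ ⟨ 1 , 2 , 3 , 4 ⟩ ∷ []) ∷
  (⟨ 23 , 24 , 25 , 28 ⟩ ∶ ⟨ 1 , 2 , 3 , 4 ⟩ ∷ []) ∷ (⟨ 23 , 24 , 25 , 29 ⟩ ∶ ⟨ 1 , 2 , 3 , 4 ⟩ ∷ []) ∷
  (⟨ 23 , 24 , 26 , 27 ⟩ ∶ ⟨ 1 , 2 , 3 , 4 ⟩ ∷ []) ∷ (⟨ 24 , 25 , 26 , 27 ⟩ ∶ ⟨ 1 , 2 , 3 , 4 ⟩ ∷ []) ∷
  (⟨ 24 , 25 , 26 , 28 ⟩ ∶ ⟨ 1 , 2 , 3 , 4 ⟩ ∷ []) ∷ (⟨ 24 , 25 , 26 , 29 ⟩ ∶ ⟨ 1 , 2 , 3 , 4 ⟩ ∷ []) ∷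
  (⟨ 24 , 25 , 27 , 28 ⟩ ∶ ⟨ 1 , 2 , 3 , 4 ⟩ ∷ []) ∷ (⟨ 24 , 25 , 27 , 29 ⟩ ∶ ⟨ 1 , 2 , 3 , 4 ⟩ ∷ []) ∷
  (⟨ 24 , 25 , 28 , 29 ⟩ ∶ ⟨ 1 , 2 , 3 , 4 ⟩ ∷ []) ∷ (⟨ 24 , 26 , 27 , 28 ⟩ ∶ ⟨ 1 , 2 , 3 , 4 ⟩ ∷ []) ∷
  (⟨ 25 , 26 , 27 , 28 ⟩ ∶ ⟨ 1 , 2 , 3 , 4 ⟩ ∷ []) ∷ (⟨ 26 , 27 , 28 , 29 ⟩ ∶ ⟨ 1 , 2 , 3 , 4 ⟩ ∷ []) ∷ []

table : List Case
table = star-case ∷ other-cases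

-- Bounds, ranges of lengths and the tests to be evaluated

T₁ : ℕ → ℕ
T₁ n = n C 4 + n C 2 ∸ n C 3

T₂ : ℕ → ℕ → ℕ
T₂ n w = (n ∸ w + 4) C 4

modulus : ℕ
modulus = 10 ^ 160

data Range : Set where
  _⋯_ : (n₀ n₁ : ℕ) → Range

-- A linear programming bound computed at n₁ has to fit under `T₁` at the shortest length served, n₀
-- or 2w; this limits how long a range can be.
blocks₁ : List Range
blocks₁ = (14 ⋯ 16) ∷ (17 ⋯ 22) ∷ (23 ⋯ 30) ∷ (31 ⋯ 39) ∷ (40 ⋯ 47) ∷ (48 ⋯ 51) ∷ (52 ⋯ 55) ∷ (56 ⋯ 58) ∷ []

-- All lengths from m to n₁ are treated at once: the cubic test is hardest to pass at m, and for the linear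
-- programming bound a code is padded with zeros to length n₁.
case₁ : (M t m n₁ w : ℕ) → List (List ℤ) → Case → Bool
case₁ M t m n₁ w rows c = if relevant w c then cubic-case m w c ∨ lp-case M t n₁ w rows c else true

cases₁ : (M m n₁ w : ℕ) → List Case → Bool
-- Sixteen degrees are tabulated because the supports in `table` use degrees up to 15.
cases₁ M m n₁ w = all (case₁ M (T₁ m) m n₁ w (hahn-table 16 n₁ w))

block₁ : ℕ → List Case → Range → ℕ → Bool
block₁ M cs (n₀ ⋯ n₁) w = if (5 ≤ᵇ w) ∧ (2 * w ≤ᵇ n₁) then cases₁ M (n₀ ⊔ 2 * w) n₁ w cs else true

weights₁ : ℕ → ℕ → List Case → Range → Bool
weights₁ M k cs b = below k (block₁ M cs b)

checked₁ : ℕ → ℕ → List Case → List Range → Bool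
checked₁ M k cs = all (weights₁ M k cs)

separation : ℕ → ℕ → ℕ
separation a e = (a ∸ e) + (e ∸ a)

divides-test : ℕ → ℕ → Bool
divides-test zero    a = a ≡ᵇ 0
divides-test (suc b) a = a % suc b ≡ᵇ 0

integral-test : (e a b c : ℕ) → Bool
integral-test e a b c = divides-test (separation a e * (separation b e * separation c e)) (a * (b * c))

same : (d₁ d₂ d₃ d₄ : ℕ) → Case → Bool
same d₁ d₂ d₃ d₄ (⟨ a , b , c , d ⟩ ∶ _) = (d₁ ≡ᵇ a) ∧ ((d₂ ≡ᵇ b) ∧ ((d₃ ≡ᵇ c) ∧ (d₄ ≡ᵇ d)))

-- The largest distance is chosen first, so that each `below` bounds the next distance strictly. The
-- four tests put each distance in turn into the role of e.
complete : ℕ → List Case → Bool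
complete k cs = below k λ d₄ → below d₄ λ d₃ → below d₃ λ d₂ → below d₂ λ d₁ →
  if (0 <ᵇ d₁) ∧ (integral-test d₁ d₂ d₃ d₄ ∧ (integral-test d₂ d₁ d₃ d₄ ∧ (integral-test d₃ d₁ d₂ d₄ ∧ integral-test d₄ d₁ d₂ d₃)))
  then any (same d₁ d₂ d₃ d₄) cs else true


-- w ∋ n₀ ⋯ n₁ stands for the weight w and the lengths from n₀ to n₁.
data Block : Set where
  _∋_⋯_ : (w n₀ n₁ : ℕ) → Block

blocks₂ : List Block
blocks₂ =
  (5 ∋ 15 ⋯ 16) ∷ (5 ∋ 17 ⋯ 23) ∷ (5 ∋ 24 ⋯ 33) ∷ (5 ∋ 34 ⋯ 48) ∷ (5 ∋ 49 ⋯ 70) ∷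
  (6 ∋ 17 ⋯ 19) ∷ (6 ∋ 20 ⋯ 26) ∷ (6 ∋ 27 ⋯ 36) ∷ (6 ∋ 37 ⋯ 50) ∷ (6 ∋ 51 ⋯ 70) ∷
  (7 ∋ 20 ⋯ 23) ∷ (7 ∋ 24 ⋯ 30) ∷ (7 ∋ 31 ⋯ 39) ∷ (7 ∋ 40 ⋯ 52) ∷ (7 ∋ 53 ⋯ 70) ∷
  (8 ∋ 25 ⋯ 28) ∷ (8 ∋ 29 ⋯ 33) ∷ (8 ∋ 34 ⋯ 42) ∷ (8 ∋ 43 ⋯ 54) ∷ (8 ∋ 55 ⋯ 70) ∷
  (9 ∋ 30 ⋯ 32) ∷ (9 ∋ 33 ⋯ 35) ∷ (9 ∋ 36 ⋯ 37) ∷ (9 ∋ 38 ⋯ 39) ∷ (9 ∋ 40 ⋯ 45) ∷ (9 ∋ 46 ⋯ 56) ∷ (9 ∋ 57 ⋯ 70) ∷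
  (10 ∋ 35 ⋯ 35) ∷ (10 ∋ 36 ⋯ 36) ∷ (10 ∋ 37 ⋯ 37) ∷ (10 ∋ 38 ⋯ 38) ∷ (10 ∋ 39 ⋯ 39) ∷ (10 ∋ 40 ⋯ 40) ∷ (10 ∋ 48 ⋯ 48) ∷ (10 ∋ 49 ⋯ 51) ∷ (10 ∋ 52 ⋯ 58) ∷ (10 ∋ 59 ⋯ 70) ∷
  (11 ∋ 60 ⋯ 60) ∷ (11 ∋ 61 ⋯ 61) ∷ (11 ∋ 62 ⋯ 64) ∷ (11 ∋ 65 ⋯ 70) ∷ []

case₂ : (M t n w : ℕ) → List (List ℤ) → Case → Bool
case₂ M t n w rows c = if relevant w c then lp-case M t n w rows c else true

block₂ : ℕ → List Case → Block → Bool
block₂ M cs (w ∋ n₀ ⋯ n₁) = all (case₂ M (T₂ n₀ w) n₁ w (hahn-table 16 n₁ w)) cs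

checked₂ : ℕ → List Case → List Block → Bool
checked₂ M cs = all (block₂ M cs)

in-range : ℕ → ℕ → ℕ → Bool
in-range n a b = (a ≤ᵇ n) ∧ (n ≤ᵇ b)

covers : ℕ → ℕ → Block → Bool
covers n w (v ∋ n₀ ⋯ n₁) = (w ≡ᵇ v) ∧ (in-range n n₀ n₁ ∧ (T₂ n₀ w ≤ᵇ T₂ n w))

-- The number of equations in `integrality`: a code with more points than this has the divisibility
-- properties.
low-dimensions : ℕ → ℕ
low-dimensions n = n C 0 + (n C 1 + (n C 2 + n C 3))

-- Here the weight is only an upper bound for the weights considered.
regions₂ : List Block
regions₂ = (5 ∋ 15 ⋯ 16) ∷ (6 ∋ 17 ⋯ 19) ∷ (7 ∋ 20 ⋯ 24) ∷ (8 ∋ 25 ⋯ 29) ∷ (9 ∋ 30 ⋯ 34) ∷ (9 ∋ 41 ⋯ 47) ∷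
  (10 ∋ 35 ⋯ 40) ∷ (10 ∋ 48 ⋯ 59) ∷ (11 ∋ 60 ⋯ 70) ∷ []

-- The distances 1, 2, 3, 4 attain the bound, so their certificate has to be exact and is taken at
-- the length n itself, without padding. The supports in `star-case` are the degrees w - 3 to w for
-- 5 ≤ w ≤ 11.
star₂ : ℕ → Case → List Block → ℕ → ℕ → Bool
star₂ M c bs n w = (low-dimensions n ≤ᵇ T₂ n w) ∧
  (any (covers n w) bs ∧ lp-case M (T₂ n w) n w (hahn-table 16 n w) c)

weight₂ : ℕ → Case → List Block → ℕ → ℕ → Bool
weight₂ M c bs n w = if 5 ≤ᵇ w then star₂ M c bs n w else true

length₂ : ℕ → Case → List Block → (v n₀ n : ℕ) → Bool
length₂ M c bs v n₀ n = if n₀ ≤ᵇ n then below (suc v) (weight₂ M c bs n) else true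

region₂ : ℕ → Case → List Block → Block → Bool
region₂ M c bs (v ∋ n₀ ⋯ n₁) = below (suc n₁) (length₂ M c bs v n₀)

checked-star : ℕ → Case → List Block → List Block → Bool
checked-star M c bs = all (region₂ M c bs)

-- The comparison of `T₁` at the shortest length with `T₁` at n is evaluated, in place of a proof
-- that `T₁` grows.
covers₁ : ℕ → ℕ → Range → Bool
covers₁ n w (n₀ ⋯ n₁) = in-range n n₀ n₁ ∧ (T₁ (n₀ ⊔ 2 * w) ≤ᵇ T₁ n)

covered-pair₁ : List Range → ℕ → ℕ → Bool
covered-pair₁ bs n w = if (14 ≤ᵇ n) ∧ (2 * w ≤ᵇ n) then (low-dimensions n ≤ᵇ T₁ n) ∧ any (covers₁ n w) bs else true

covered₁ : ℕ → ℕ → List Range → Bool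
covered₁ k l bs = below k λ n → below l (covered-pair₁ bs n)

-- Outcomes of the evaluations

complete-ok : complete 30 table ≡ true
complete-ok = refl

checked₁-ok : checked₁ modulus 30 table blocks₁ ≡ true
checked₁-ok = refl

covered₁-ok : covered₁ 59 30 blocks₁ ≡ true
covered₁-ok = refl

checked₂-ok : checked₂ modulus other-cases blocks₂ ≡ true
checked₂-ok = refl

checked-star-ok : checked-star modulus star-case blocks₂ regions₂ ≡ true
checked-star-ok = refl

-- Soundness of the verification.

≡true⇒T : ∀ {b} → b ≡ true → T b
≡true⇒T refl = tt

∧-T : ∀ {a b} → T (a ∧ b) → T a × T b
∧-T = Equivalence.to T-∧

if-T : ∀ {a b} → T (if a then b else true) → T a → T b
if-T {true} ok _ = ok

any-T : ∀ {A : Set} (p : A → Bool) xs → T (any p xs) → ∃ λ x → x ∈ xs × T (p x)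
any-T p xs ok = find (Any.any⁻ p xs ok)

all-T : ∀ {A : Set} (p : A → Bool) xs → T (all p xs) → ∀ {x} → x ∈ xs → T (p x)
all-T p xs ok = All.lookup (All.all⁺ p xs ok)

module _ (M t : ℕ) where
  open Search M t

  -- Forgets how the multipliers were obtained: soundness rests only on their passing `valid`.
  Found : Values → List Values → Set
  Found v₀ vs = ∃ λ l₁ → ∃ λ l₂ → ∃ λ l₃ → ∃ λ l₄ → ∃ λ A → T (valid t l₁ l₂ l₃ l₄ A v₀ vs)

  oriented-sound : ∀ v₀ vs l₁ l₂ l₃ l₄ s → T (oriented v₀ vs l₁ l₂ l₃ l₄ s) → Found v₀ vs
  oriented-sound v₀ vs l₁ l₂ l₃ l₄ s ok with 2 * s <ᵇ M
  ... | true  = negate l₁ , negate l₂ , negate l₃ , negate l₄ , s , ok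
  ... | false = l₁ , l₂ , l₃ , l₄ , suc M ∸ s , ok

  multipliers-sound : ∀ v₀ v₁ vs l₁ l₂ l₃ l₄ → T (multipliers v₀ v₁ vs l₁ l₂ l₃ l₄) → Found v₀ (v₁ ∷ vs)
  multipliers-sound v₀ v₁ vs l₁ l₂ l₃ l₄ = oriented-sound v₀ (v₁ ∷ vs) l₁ l₂ l₃ l₄ (combine residue l₁ l₂ l₃ l₄ v₁ % suc M)

  minors-sound : ∀ v₀ v₁ vs a₁ a₂ a₃ a₄ b₁ b₂ b₃ b₄ c₁ c₂ c₃ c₄ →
                 T (minors v₀ v₁ vs a₁ a₂ a₃ a₄ b₁ b₂ b₃ b₄ c₁ c₂ c₃ c₄) → Found v₀ (v₁ ∷ vs)
  minors-sound v₀ v₁ vs a₁ a₂ a₃ a₄ b₁ b₂ b₃ b₄ c₁ c₂ c₃ c₄ = multipliers-sound v₀ v₁ vs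
    (det₃ a₂ a₃ a₄ b₂ b₃ b₄ c₂ c₃ c₄) (det₃ a₁ a₄ a₃ b₁ b₄ b₃ c₁ c₄ c₃)
    (det₃ a₁ a₂ a₄ b₁ b₂ b₄ c₁ c₂ c₄) (det₃ a₁ a₃ a₂ b₁ b₃ b₂ c₁ c₃ c₂)

  search-sound : ∀ v₀ v₁ v₂ v₃ v₄ → T (search v₀ v₁ v₂ v₃ v₄) → Found v₀ (v₁ ∷ v₂ ∷ v₃ ∷ v₄ ∷ [])
  search-sound v₀ v₁@(⟪ p₁ , p₂ , p₃ , p₄ ⟫) v₂@(⟪ q₁ , q₂ , q₃ , q₄ ⟫) v₃@(⟪ r₁ , r₂ , r₃ , r₄ ⟫) v₄@(⟪ s₁ , s₂ , s₃ , s₄ ⟫) =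
    minors-sound v₀ v₁ (v₂ ∷ v₃ ∷ v₄ ∷ []) (p₁ ⊝ q₁) (p₂ ⊝ q₂) (p₃ ⊝ q₃) (p₄ ⊝ q₄)
      (q₁ ⊝ r₁) (q₂ ⊝ r₂) (q₃ ⊝ r₃) (q₄ ⊝ r₄) (r₁ ⊝ s₁) (r₂ ⊝ s₂) (r₃ ⊝ s₃) (r₄ ⊝ s₄)

parts : ∀ z → + positive-part z ℤ.- + negative-part z ≡ z
parts (+ n)    = ℤ.+-identityʳ (+ n)
parts -[1+ n ] = refl

combination : (l₁ l₂ l₃ l₄ : ℕ) → Quadruple → Combination ℕ
combination l₁ l₂ l₃ l₄ ⟨ j₁ , j₂ , j₃ , j₄ ⟩ = (+ l₁ , j₁) ∷ (+ l₂ , j₂) ∷ (+ l₃ , j₃) ∷ (+ l₄ , j₄) ∷ []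

combination-∙ : ∀ l₁ l₂ l₃ l₄ js q → combination l₁ l₂ l₃ l₄ js ∙ q ≡
  + combine positive-part l₁ l₂ l₃ l₄ (values q js) ℤ.- + combine negative-part l₁ l₂ l₃ l₄ (values q js)
combination-∙ l₁ l₂ l₃ l₄ ⟨ j₁ , j₂ , j₃ , j₄ ⟩ q = go (q j₁) (q j₂) (q j₃) (q j₄)
  where
  spread : ∀ l z → + l ℤ.* z ≡ + (l * positive-part z) ℤ.- + (l * negative-part z)
  spread l z = trans (cong (+ l ℤ.*_) (sym (parts z))) (trans (lemma (+ l) (+ positive-part z) (+ negative-part z))
    (cong₂ ℤ._-_ (sym (ℤ.pos-* l (positive-part z))) (sym (ℤ.pos-* l (negative-part z)))))
    where lemma : ∀ a b c → a ℤ.* (b ℤ.- c) ≡ a ℤ.* b ℤ.- a ℤ.* c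
          lemma = solve-∀
  go : ∀ a b c d → + l₁ ℤ.* a ℤ.+ (+ l₂ ℤ.* b ℤ.+ (+ l₃ ℤ.* c ℤ.+ (+ l₄ ℤ.* d ℤ.+ 0ℤ))) ≡
    + combine positive-part l₁ l₂ l₃ l₄ ⟪ a , b , c , d ⟫ ℤ.- + combine negative-part l₁ l₂ l₃ l₄ ⟪ a , b , c , d ⟫
  go a b c d = trans (cong₂ ℤ._+_ (spread l₁ a) (cong₂ ℤ._+_ (spread l₂ b) (cong₂ ℤ._+_ (spread l₃ c) (cong (ℤ._+ 0ℤ) (spread l₄ d)))))
    (lemma (+ (l₁ * positive-part a)) (+ (l₁ * negative-part a)) (+ (l₂ * positive-part b)) (+ (l₂ * negative-part b))
           (+ (l₃ * positive-part c)) (+ (l₃ * negative-part c)) (+ (l₄ * positive-part d)) (+ (l₄ * negative-part d)))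
    where
    lemma : ∀ p q r s t u v w → (p ℤ.- q) ℤ.+ ((r ℤ.- s) ℤ.+ ((t ℤ.- u) ℤ.+ ((v ℤ.- w) ℤ.+ 0ℤ))) ≡
      (p ℤ.+ (r ℤ.+ (t ℤ.+ v))) ℤ.- (q ℤ.+ (s ℤ.+ (u ℤ.+ w)))
    lemma = solve-∀

≤-difference : ∀ {a p q} → a + p ≤ q → + p ℤ.- + q ℤ.≤ ℤ.- + a
≤-difference {a} {p} {q} le = subst (ℤ._≤ ℤ.- + a) (lemma (+ a) (+ p) (+ q))
  (subst (+ (a + p) ℤ.- + q ℤ.+ ℤ.- + a ℤ.≤_) (ℤ.+-identityˡ (ℤ.- + a)) (ℤ.+-monoˡ-≤ (ℤ.- + a) (ℤ.i≤j⇒i-j≤0 (ℤ.+≤+ le))))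
  where lemma : ∀ a p q → (a ℤ.+ p ℤ.- q) ℤ.+ ℤ.- a ≡ p ℤ.- q
        lemma = solve-∀

<-difference : ∀ {p q b} → p < b + q → 1ℤ ℤ.+ (+ p ℤ.- + q) ℤ.≤ + b
<-difference {p} {q} {b} lt = subst₂ ℤ._≤_ (lemma₁ (+ p) (+ q)) (lemma₂ (+ b) (+ q)) (ℤ.+-monoˡ-≤ (ℤ.- + q) (ℤ.+≤+ lt))
  where
  lemma₁ : ∀ p q → (1ℤ ℤ.+ p) ℤ.+ ℤ.- q ≡ 1ℤ ℤ.+ (p ℤ.- q)
  lemma₁ = solve-∀
  lemma₂ : ∀ b q → (b ℤ.+ q) ℤ.+ ℤ.- q ≡ b
  lemma₂ = solve-∀

lp-case-sound : ∀ M t k {n w d₁ d₂ d₃ d₄ supports} {X : List (Vec Bool n)} →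
  T (lp-case M t n w (hahn-table k n w) (⟨ d₁ , d₂ , d₃ , d₄ ⟩ ∶ supports)) →
  Code n w (d₁ ∷ d₂ ∷ d₃ ∷ d₄ ∷ []) X → length X ≤ t
lp-case-sound M t k {n} {w} {d₁} {d₂} {d₃} {d₄} {supports} {X} ok code = from-support (any-T _ supports ok)
  where
  q : ℕ → ℕ → ℤ
  q d = entry n w d (row-at (hahn-table k n w) d)
  at-row : ∀ L d → L ∙ (λ j → Q n w j d) ≡ L ∙ q d
  at-row L d = ∙-cong L (λ {p} _ → sym (entry-correct k n w d (proj₂ p)))

  from-multipliers : ∀ js l₁ l₂ l₃ l₄ A → T (valid t l₁ l₂ l₃ l₄ A (values (q 0) js)
    (values (q d₁) js ∷ values (q d₂) js ∷ values (q d₃) js ∷ values (q d₄) js ∷ [])) → length X ≤ t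
  -- A = 0 fails the first test in `valid`, hence the single clause.
  from-multipliers js l₁ l₂ l₃ l₄ (suc A) ok = conclude (∧-T {P 0 <ᵇ suc A * t + N 0} {all test vs} ok)
    where
    L = combination l₁ l₂ l₃ l₄ js
    P N : ℕ → ℕ
    P d = combine positive-part l₁ l₂ l₃ l₄ (values (q d) js)
    N d = combine negative-part l₁ l₂ l₃ l₄ (values (q d) js)
    expand : ∀ d → L ∙ (λ j → Q n w j d) ≡ + P d ℤ.- + N d
    expand d = trans (at-row L d) (combination-∙ l₁ l₂ l₃ l₄ js (q d))
    nonnegative : ∀ js → All (λ p → 0ℤ ℤ.≤ proj₁ p) (combination l₁ l₂ l₃ l₄ js)
    nonnegative ⟨ _ , _ , _ , _ ⟩ = ℤ.+≤+ z≤n ∷ ℤ.+≤+ z≤n ∷ ℤ.+≤+ z≤n ∷ ℤ.+≤+ z≤n ∷ []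
    off : ∀ {d} → T (suc A + P d ≤ᵇ N d) → L ∙ (λ j → Q n w j d) ℤ.≤ ℤ.- (+ suc A)
    off {d} le = subst (ℤ._≤ ℤ.- (+ suc A)) (sym (expand d)) (≤-difference (≤ᵇ⇒≤ (suc A + P d) (N d) le))
    on : T (P 0 <ᵇ suc A * t + N 0) → 1ℤ ℤ.+ L ∙ (λ j → Q n w j 0) ℤ.≤ + suc A ℤ.* + t
    on lt = subst₂ (λ a b → 1ℤ ℤ.+ a ℤ.≤ b) (sym (expand 0)) (ℤ.pos-* (suc A) t) (<-difference (<ᵇ⇒< (P 0) (suc A * t + N 0) lt))
    test : Values → Bool
    test v = suc A + combine positive-part l₁ l₂ l₃ l₄ v ≤ᵇ combine negative-part l₁ l₂ l₃ l₄ v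
    vs : List Values
    vs = values (q d₁) js ∷ values (q d₂) js ∷ values (q d₃) js ∷ values (q d₄) js ∷ []
    finish : T (P 0 <ᵇ suc A * t + N 0) → All (T ∘ test) vs → length X ≤ t
    finish lt (o₁ ∷ o₂ ∷ o₃ ∷ o₄ ∷ []) = lp-bound L A t code (nonnegative js)
      (off {d₁} o₁ ∷ off {d₂} o₂ ∷ off {d₃} o₃ ∷ off {d₄} o₄ ∷ []) (on lt)
    conclude : T (P 0 <ᵇ suc A * t + N 0) × T (all test vs) → length X ≤ t
    conclude (lt , offs) = finish lt (All.all⁺ test vs offs)

  from-support : (∃ λ js → js ∈ supports × T (Search.search M t (values (q 0) js) (values (q d₁) js) (values (q d₂) js)
                   (values (q d₃) js) (values (q d₄) js))) → length X ≤ t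
  from-support (js , _ , found) = go (search-sound M t (values (q 0) js) (values (q d₁) js) (values (q d₂) js) (values (q d₃) js) (values (q d₄) js) found)
    where
    go : Found M t (values (q 0) js) (values (q d₁) js ∷ values (q d₂) js ∷ values (q d₃) js ∷ values (q d₄) js ∷ []) → length X ≤ t
    go (l₁ , l₂ , l₃ , l₄ , A , ok) = from-multipliers js l₁ l₂ l₃ l₄ A ok

pad : ∀ {n w ds} {X : List (Vec Bool n)} → Code n w ds X → Code (suc n) w ds (map (false ∷_) X)
pad {n} {w} {ds} {X} code = record
  { unique   = Unique.map⁺ Vec.∷-injectiveʳ unique
  ; weights  = λ x∈ → weights′ (∈-map⁻ (false ∷_) x∈)
  ; distance = λ x∈ y∈ → distance′ (∈-map⁻ (false ∷_) x∈) (∈-map⁻ (false ∷_) y∈)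
  }
  where
  open Code code
  weights′ : ∀ {x} → (∃ λ y → y ∈ X × x ≡ false ∷ y) → weight x ≡ w
  weights′ (_ , y∈ , refl) = weights y∈
  distance′ : ∀ {x y} → (∃ λ x′ → x′ ∈ X × x ≡ false ∷ x′) → (∃ λ y′ → y′ ∈ X × y ≡ false ∷ y′) → x ≢ y → τ x y ∈ ds
  distance′ (_ , x∈ , refl) (_ , y∈ , refl) x≢y = Code.distance code x∈ y∈ (x≢y ∘ cong (false ∷_))

pad-bound : ∀ {n n₁ w ds t} → n ≤′ n₁ → (∀ {X} → Code n₁ w ds X → length X ≤ t) → ∀ {X} → Code n w ds X → length X ≤ t
pad-bound ≤′-refl bound code = bound code
pad-bound {n} (≤′-step le) bound {X} code = pad-bound le
  (λ {Y} c → subst (_≤ _) (length-map (false ∷_) Y) (bound (pad c))) code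

cubic-sound : ∀ m b {d₁ d₂ d₃ d₄} → d₁ ≤ 5 + b → d₂ ≤ 5 + b → d₃ ≤ 5 + b → d₄ ≤ 5 + b →
              T (cubic-test (7 + m) (5 + b) d₁ d₂ d₃ d₄) → NonpositiveCubic (7 + m) (5 + b) (d₁ ∷ d₂ ∷ d₃ ∷ d₄ ∷ [])
cubic-sound m b {d₁} {d₂} {d₃} {d₄} l₁ l₂ l₃ l₄ ok = subst (ℤ._≤ 0ℤ) eq (ℤ.i≤j⇒i-j≤0 (ℤ.+≤+ le))
  where
  w = 5 + b
  W = 2 + b
  S = (w ∸ d₁) + (w ∸ d₂) + (w ∸ d₃) + (w ∸ d₄)
  le : 4 * (W * W) ≤ suc m * (S ∸ 6)
  le = ≤ᵇ⇒≤ _ _ ok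
  -- The truncated `S ∸ 6` is exact: otherwise the right side of `le` would be 0, whereas the left
  -- side is at least 16 because W ≥ 2.
  6≤S : 6 ≤ S
  6≤S with 6 ≤? S
  ... | yes p = p
  ... | no ¬p = contradiction (subst (λ k → 4 * (W * W) ≤ suc m * k) (m≤n⇒m∸n≡0 (<⇒≤ (≰⇒> ¬p))) le)
      λ l → contradiction (≤-trans l (≤-reflexive (*-zeroʳ (suc m)))) λ ()
  cast : ∀ {d} → d ≤ w → + w ℤ.- + d ≡ + (w ∸ d)
  cast {d} l = trans (cong (λ v → + v ℤ.- + d) (sym (m∸n+n≡m l))) (lemma (+ (w ∸ d)) (+ d))
    where lemma : ∀ a d → (a ℤ.+ d) ℤ.- d ≡ a
          lemma = solve-∀
  eq : + (4 * (W * W)) ℤ.- + (suc m * (S ∸ 6)) ≡ + 4 ℤ.* (+ W ℤ.* + W) ℤ.+ + suc m ℤ.* (+ 6 ℤ.- ((+ w ℤ.- + d₁) ℤ.+ (+ w ℤ.- + d₂) ℤ.+ (+ w ℤ.- + d₃) ℤ.+ (+ w ℤ.- + d₄)))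
  eq = begin
    + (4 * (W * W)) ℤ.- + (suc m * (S ∸ 6))
      ≡⟨ cong₂ ℤ._-_ (trans (ℤ.pos-* 4 (W * W)) (cong (+ 4 ℤ.*_) (ℤ.pos-* W W))) (ℤ.pos-* (suc m) (S ∸ 6)) ⟩
    + 4 ℤ.* (+ W ℤ.* + W) ℤ.- + suc m ℤ.* + (S ∸ 6)
      ≡⟨ lemma (+ 4 ℤ.* (+ W ℤ.* + W)) (+ suc m) (+ (S ∸ 6)) ⟩
    + 4 ℤ.* (+ W ℤ.* + W) ℤ.+ + suc m ℤ.* (+ 6 ℤ.- (+ (S ∸ 6) ℤ.+ + 6))
      ≡⟨ cong (λ s → + 4 ℤ.* (+ W ℤ.* + W) ℤ.+ + suc m ℤ.* (+ 6 ℤ.- s)) (trans (cong +_ (m∸n+n≡m 6≤S))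
           (sym (cong₂ ℤ._+_ (cong₂ ℤ._+_ (cong₂ ℤ._+_ (cast l₁) (cast l₂)) (cast l₃)) (cast l₄)))) ⟩
    + 4 ℤ.* (+ W ℤ.* + W) ℤ.+ + suc m ℤ.* (+ 6 ℤ.- ((+ w ℤ.- + d₁) ℤ.+ (+ w ℤ.- + d₂) ℤ.+ (+ w ℤ.- + d₃) ℤ.+ (+ w ℤ.- + d₄))) ∎
    where
    open ≡-Reasoning
    lemma : ∀ a n k → a ℤ.- n ℤ.* k ≡ a ℤ.+ n ℤ.* (+ 6 ℤ.- (k ℤ.+ + 6))
    lemma = solve-∀

cubic-mono : ∀ {m n w d₁ d₂ d₃ d₄} → m ≤ n → T (cubic-test m w d₁ d₂ d₃ d₄) → T (cubic-test n w d₁ d₂ d₃ d₄)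
cubic-mono {m} {n} {w} m≤n ok = ≤⇒≤ᵇ (≤-trans (≤ᵇ⇒≤ (4 * ((w ∸ 3) * (w ∸ 3))) _ ok) (*-monoˡ-≤ _ (∸-monoˡ-≤ 6 m≤n)))

-- Sorting the distances and finding them in the table

τ≡0 : ∀ {n w} (x y : Vec Bool n) → weight x ≡ w → weight y ≡ w → τ x y ≡ 0 → x ≡ y
τ≡0 {w = w} x y wx wy eq = hamming≡0 x y (+-cancelʳ-≡ (meet x y * 2) (hamming x y) 0 (trans (hamming+2meet x y)
  (trans (cong₂ _+_ (trans wx (sym m≡w)) (trans wy (sym m≡w))) (trans (cong (_+_ (meet x y)) (sym (+-identityʳ _))) (*-comm 2 (meet x y))))))
  where
  m≡w : meet x y ≡ w
  m≡w = trans (cong (_+ meet x y) (sym eq)) (τ+meet x y wx wy)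
  hamming≡0 : ∀ {n} (x y : Vec Bool n) → hamming x y ≡ 0 → x ≡ y
  hamming≡0 []          []          _  = refl
  hamming≡0 (true ∷ x)  (true ∷ y)  eq = cong (true ∷_) (hamming≡0 x y eq)
  hamming≡0 (false ∷ x) (false ∷ y) eq = cong (false ∷_) (hamming≡0 x y eq)

τ≤weight : ∀ {n w} (x y : Vec Bool n) → weight x ≡ w → weight y ≡ w → τ x y ≤ w
τ≤weight x y wx wy = subst (τ x y ≤_) (τ+meet x y wx wy) (m≤m+n (τ x y) (meet x y))

-- 0 < d₁ because distance 0 forces equal vectors, and d₄ ≤ w because τ + meet = w. With the strict
-- order this makes the quadruple one of those that `complete` enumerates.
record Sorted (n w : ℕ) (X : List (Vec Bool n)) : Set where
  field
    {d₁ d₂ d₃ d₄} : ℕ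
    0<d₁  : 0 < d₁
    d₁<d₂ : d₁ < d₂
    d₂<d₃ : d₂ < d₃
    d₃<d₄ : d₃ < d₄
    d₄≤w  : d₄ ≤ w
    code  : Code n w (d₁ ∷ d₂ ∷ d₃ ∷ d₄ ∷ []) X

sorted : ∀ {n w X} → IsSDistanceSet n w 4 X → Sorted n w X
sorted {n} {w} {X} ((uniqueX , weightsX) , D , uniqueD , lengthD , distances) =
  go (sort D) (sort-↗ D) (Permutation.Unique-resp-↭ (↭⇒↭ₛ (↭-sym (sort-↭ D))) uniqueD)
     (trans (↭-length (sort-↭ D)) lengthD) (∈-resp-↭ (sort-↭ D)) (∈-resp-↭ (↭-sym (sort-↭ D)))
  where
  weight≡ : ∀ {x} → x ∈ X → weight x ≡ w
  weight≡ = All.lookup weightsX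
  within : ∀ {d} → d ∈ D → 0 < d × d ≤ w
  within d∈ with Equivalence.to (distances _) d∈
  ... | x , y , x∈ , y∈ , x≢y , refl =
    n≢0⇒n>0 (λ eq → x≢y (τ≡0 x y (weight≡ x∈) (weight≡ y∈) eq)) , τ≤weight x y (weight≡ x∈) (weight≡ y∈)
  go : ∀ E → Linked _≤_ E → Unique E → length E ≡ 4 → (∀ {d} → d ∈ E → d ∈ D) → (∀ {d} → d ∈ D → d ∈ E) → Sorted n w X
  go (d₁ ∷ d₂ ∷ d₃ ∷ d₄ ∷ []) (l₁ ∷ l₂ ∷ l₃ ∷ [-]) ((u₁ ∷ _) ∷ (u₂ ∷ _) ∷ (u₃ ∷ _) ∷ _) refl ⊆D ⊇D = record
    { 0<d₁  = proj₁ (within (⊆D (here refl)))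
    ; d₁<d₂ = ≤∧≢⇒< l₁ u₁
    ; d₂<d₃ = ≤∧≢⇒< l₂ u₂
    ; d₃<d₄ = ≤∧≢⇒< l₃ u₃
    ; d₄≤w  = proj₂ (within (⊆D (there (there (there (here refl))))))
    ; code  = record
      { unique   = uniqueX
      ; weights  = weight≡
      ; distance = λ x∈ y∈ x≢y → ⊇D (Equivalence.from (distances _) (_ , _ , x∈ , y∈ , x≢y , refl))
      }
    }

reorder : ∀ {n w ds es} {X : List (Vec Bool n)} → (∀ {d} → d ∈ ds → d ∈ es) → Code n w ds X → Code n w es X
reorder ⊆ code = record { unique = unique ; weights = weights ; distance = λ x∈ y∈ x≢y → ⊆ (Code.distance code x∈ y∈ x≢y) }
  where open Code code

∣-∣≡separation : ∀ a e → ∣ + a ℤ.- + e ∣ ≡ separation a e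
∣-∣≡separation a e with ≤-total e a
... | inj₁ e≤a = trans (cong ∣_∣ (trans (cong (λ v → + v ℤ.- + e) (sym (m∸n+n≡m e≤a))) (lemma (+ (a ∸ e)) (+ e))))
    (trans (sym (+-identityʳ (a ∸ e))) (cong (λ z → a ∸ e + z) (sym (m≤n⇒m∸n≡0 e≤a))))
  where lemma : ∀ a d → (a ℤ.+ d) ℤ.- d ≡ a
        lemma = solve-∀
... | inj₂ a≤e = trans (cong ∣_∣ (trans (cong (λ v → + a ℤ.- + v) (sym (m∸n+n≡m a≤e))) (lemma (+ (e ∸ a)) (+ a))))
    (trans (ℤ.∣-i∣≡∣i∣ (+ (e ∸ a))) (cong (_+ (e ∸ a)) (sym (m≤n⇒m∸n≡0 a≤e))))
  where lemma : ∀ a d → d ℤ.- (a ℤ.+ d) ≡ ℤ.- a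
        lemma = solve-∀

∣gap∣ : ∀ a b c e → ∣ gap (a ∷ b ∷ c ∷ []) e ∣ ≡ separation a e * (separation b e * separation c e)
∣gap∣ a b c e = trans (ℤ.abs-* (+ a ℤ.- + e) (gap (b ∷ c ∷ []) e)) (cong₂ _*_ (∣-∣≡separation a e)
  (trans (ℤ.abs-* (+ b ℤ.- + e) (gap (c ∷ []) e)) (cong₂ _*_ (∣-∣≡separation b e)
    (trans (ℤ.abs-* (+ c ℤ.- + e) 1ℤ) (trans (*-identityʳ _) (∣-∣≡separation c e))))))

separation-0 : ∀ a → separation a 0 ≡ a
separation-0 a = trans (cong (_+_ a) (0∸n≡0 a)) (+-identityʳ a)

divides-complete : ∀ b a → b ∣ a → T (divides-test b a)
divides-complete zero    a b∣a = ≡⇒≡ᵇ a 0 (0∣⇒≡0 b∣a)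
divides-complete (suc b) a b∣a = ≡⇒≡ᵇ (a % suc b) 0 (n∣m⇒m%n≡0 a (suc b) b∣a)

integral-complete : ∀ {n w e a b c} {X : List (Vec Bool n)} → low-dimensions n < length X →
                    Code n w (e ∷ a ∷ b ∷ c ∷ []) X → T (integral-test e a b c)
integral-complete {e = e} {a} {b} {c} large code = divides-complete (separation a e * (separation b e * separation c e)) (a * (b * c)) (subst₂ _∣_ (∣gap∣ a b c e)
  (trans (∣gap∣ a b c 0) (cong₂ _*_ (separation-0 a) (cong₂ _*_ (separation-0 b) (separation-0 c)))) (integrality code large))

T-∧-intro : ∀ {a b} → T a → T b → T (a ∧ b)
T-∧-intro {true} _ tb = tb

module _ {n w k : ℕ} {X : List (Vec Bool n)} (s : Sorted n w X) (large : low-dimensions n < length X) (w<k : w < k) where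
  open Sorted s

  -- Integrality is applied four times, each distance being brought to the front by `reorder`; so
  -- the quadruple passes the filter in `complete` and must be listed.
  listed-case : ∀ {cs} → T (complete k cs) → ∃ λ supports → (⟨ d₁ , d₂ , d₃ , d₄ ⟩ ∶ supports) ∈ cs
  listed-case {cs} ok = identify (any-T (same d₁ d₂ d₃ d₄) cs (if-T
      (below-sound d₂ _ (below-sound d₃ _ (below-sound d₄ _ (below-sound k _ ok (≤-<-trans d₄≤w w<k)) d₃<d₄) d₂<d₃) d₁<d₂)
      (T-∧-intro (<⇒<ᵇ 0<d₁) (T-∧-intro (integral-complete large code)
        (T-∧-intro (integral-complete large (reorder swap₂ code)) (T-∧-intro (integral-complete large (reorder swap₃ code))
          (integral-complete large (reorder swap₄ code))))))))
    where
    swap₂ : ∀ {d} → d ∈ d₁ ∷ d₂ ∷ d₃ ∷ d₄ ∷ [] → d ∈ d₂ ∷ d₁ ∷ d₃ ∷ d₄ ∷ []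
    swap₂ (here e)         = there (here e)
    swap₂ (there (here e)) = here e
    swap₂ (there (there d∈)) = there (there d∈)
    swap₃ : ∀ {d} → d ∈ d₁ ∷ d₂ ∷ d₃ ∷ d₄ ∷ [] → d ∈ d₃ ∷ d₁ ∷ d₂ ∷ d₄ ∷ []
    swap₃ (here e)                   = there (here e)
    swap₃ (there (here e))           = there (there (here e))
    swap₃ (there (there (here e)))   = here e
    swap₃ (there (there (there d∈))) = there (there (there d∈))
    swap₄ : ∀ {d} → d ∈ d₁ ∷ d₂ ∷ d₃ ∷ d₄ ∷ [] → d ∈ d₄ ∷ d₁ ∷ d₂ ∷ d₃ ∷ []
    swap₄ (here e)                         = there (here e)
    swap₄ (there (here e))                 = there (there (here e))
    swap₄ (there (there (here e)))         = there (there (there (here e)))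
    swap₄ (there (there (there (here e)))) = here e
    identify : (∃ λ c → c ∈ cs × T (same d₁ d₂ d₃ d₄ c)) → ∃ λ supports → (⟨ d₁ , d₂ , d₃ , d₄ ⟩ ∶ supports) ∈ cs
    identify ((⟨ a , b , c , d ⟩ ∶ supports) , c∈ , eq)
      with ∧-T {d₁ ≡ᵇ a} eq
    ... | e₁ , eq₁ with ∧-T {d₂ ≡ᵇ b} eq₁
    ... | e₂ , eq₂ with ∧-T {d₃ ≡ᵇ c} eq₂
    ... | e₃ , e₄ with ≡ᵇ⇒≡ d₁ a e₁ | ≡ᵇ⇒≡ d₂ b e₂ | ≡ᵇ⇒≡ d₃ c e₃ | ≡ᵇ⇒≡ d₄ d e₄
    ... | refl | refl | refl | refl = supports , c∈

rank-bound′ : ∀ {n w} {X : List (Vec Bool n)} (s : Sorted n w X) → 7 ≤ n → 5 ≤ w →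
              T (cubic-test n w (Sorted.d₁ s) (Sorted.d₂ s) (Sorted.d₃ s) (Sorted.d₄ s)) → length X + n C 3 ≤ n C 4 + n C 2
rank-bound′ s 7≤n 5≤w ok with m≤n⇒∃[o]m+o≡n 7≤n | m≤n⇒∃[o]m+o≡n 5≤w
... | m , refl | b , refl = rank-bound m b code (0<d₁ ∷ 0<d₂ ∷ 0<d₃ ∷ <-trans 0<d₃ d₃<d₄ ∷ [])
    (cubic-sound m b (≤-trans (<⇒≤ d₁<d₂) d₂≤w) d₂≤w d₃≤w d₄≤w ok)
  where
  open Sorted s
  0<d₂ = <-trans 0<d₁ d₁<d₂
  0<d₃ = <-trans 0<d₂ d₂<d₃
  d₃≤w = ≤-trans (<⇒≤ d₃<d₄) d₄≤w
  d₂≤w = ≤-trans (<⇒≤ d₂<d₃) d₃≤w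

in-range-T : ∀ n a b → T (in-range n a b) → a ≤ n × n ≤ b
in-range-T n a b ok with ∧-T {a ≤ᵇ n} ok
... | p , q = ≤ᵇ⇒≤ a n p , ≤ᵇ⇒≤ n b q

-- The two upper bounds

module _ (M k l : ℕ) (cs : List Case) (bs : List Range)
         (is-complete : complete l cs ≡ true) (is-checked : checked₁ M l cs bs ≡ true) (is-covered : covered₁ k l bs ≡ true) where

  -- If X exceeds `T₁ n`, its distances are listed. In a range that covers n, either the cubic test
  -- passes at the shortest length, hence at n, and the rank bound applies, or the linear
  -- programming bound for the padded code contradicts the excess.
  upper₁ : ∀ {n w X} → 14 ≤ n → n < k → 5 ≤ w → w < l → 2 * w ≤ n → IsSDistanceSet n w 4 X → length X + n C 3 ≤ n C 4 + n C 2
  upper₁ {n} {w} {X} 14≤n n<k 5≤w w<l 2w≤n distance-set = decide (length X + n C 3 ≤? n C 4 + n C 2)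
    where
    Bound = length X + n C 3 ≤ n C 4 + n C 2
    covered : T (low-dimensions n ≤ᵇ T₁ n) × T (any (covers₁ n w) bs)
    covered = ∧-T {low-dimensions n ≤ᵇ T₁ n} (if-T {(14 ≤ᵇ n) ∧ (2 * w ≤ᵇ n)}
      (below-sound l (covered-pair₁ bs n) (below-sound k (λ n → below l (covered-pair₁ bs n)) (≡true⇒T is-covered) n<k) w<l)
      (T-∧-intro {14 ≤ᵇ n} (≤⇒≤ᵇ 14≤n) (≤⇒≤ᵇ 2w≤n)))
    low≤T₁ : low-dimensions n ≤ T₁ n
    low≤T₁ = ≤ᵇ⇒≤ (low-dimensions n) (T₁ n) (proj₁ covered)
    s = sorted distance-set
    open Sorted s

    module Large (exceeds : T₁ n < length X) where
      case = listed-case s (≤-<-trans low≤T₁ exceeds) w<l {cs} (≡true⇒T is-complete)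
      c : Case
      c = ⟨ d₁ , d₂ , d₃ , d₄ ⟩ ∶ proj₁ case

      module _ (n₀ n₁ : ℕ) (b∈ : (n₀ ⋯ n₁) ∈ bs) (n₀≤n : n₀ ≤ n) (n≤n₁ : n ≤ n₁) (mono : T₁ (n₀ ⊔ 2 * w) ≤ T₁ n) where
        m = n₀ ⊔ 2 * w
        tests : T (cubic-case m w c ∨ lp-case M (T₁ m) n₁ w (hahn-table 16 n₁ w) c)
        tests = if-T {relevant w c} (all-T (case₁ M (T₁ m) m n₁ w (hahn-table 16 n₁ w)) cs
          (if-T {(5 ≤ᵇ w) ∧ (2 * w ≤ᵇ n₁)} (below-sound l (block₁ M cs (n₀ ⋯ n₁)) (all-T (weights₁ M l cs) bs (≡true⇒T is-checked) b∈) w<l)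
            (T-∧-intro {5 ≤ᵇ w} (≤⇒≤ᵇ 5≤w) (≤⇒≤ᵇ (≤-trans 2w≤n n≤n₁)))) (proj₂ case)) (≤⇒≤ᵇ d₄≤w)
        by-test : T (cubic-case m w c) ⊎ T (lp-case M (T₁ m) n₁ w (hahn-table 16 n₁ w) c) → Bound
        by-test (inj₁ cubic) = rank-bound′ s (≤-trans (m≤m+n 7 7) 14≤n) 5≤w
          (cubic-mono {m} {n} {w} {d₁} {d₂} {d₃} {d₄} (⊔-lub n₀≤n 2w≤n) cubic)
        by-test (inj₂ lp) = contradiction (≤-trans (pad-bound (≤⇒≤′ n≤n₁) (lp-case-sound M (T₁ m) 16 {supports = proj₁ case} lp) code) mono) (<⇒≱ exceeds)
        by-block : Bound
        by-block = by-test (Equivalence.to (T-∨ {cubic-case m w c}) tests)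

      conclude : (∃ λ b → b ∈ bs × T (covers₁ n w b)) → Bound
      conclude ((n₀ ⋯ n₁) , b∈ , cov) = go (∧-T {in-range n n₀ n₁} cov)
        where
        go : T (in-range n n₀ n₁) × T (T₁ (n₀ ⊔ 2 * w) ≤ᵇ T₁ n) → Bound
        go (range , mono) = by-block n₀ n₁ b∈ (proj₁ (in-range-T n n₀ n₁ range)) (proj₂ (in-range-T n n₀ n₁ range))
          (≤ᵇ⇒≤ (T₁ (n₀ ⊔ 2 * w)) (T₁ n) mono)

    positive : ∀ a b → 0 < a ∸ b → b ≤ a
    positive a b lt = ≮⇒≥ λ a<b → <-irrefl refl (subst (0 <_) (m≤n⇒m∸n≡0 (<⇒≤ a<b)) lt)
    -- `T₁ n` is positive, being at least `low-dimensions n`; so its truncated subtraction is exact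
    -- and the two forms of the bound agree.
    exceeds : ¬ Bound → T₁ n < length X
    exceeds large = ≰⇒> λ le → large (≤-trans (+-monoˡ-≤ (n C 3) le)
      (≤-reflexive (m∸n+n≡m (positive (n C 4 + n C 2) (n C 3) (≤-trans (s≤s z≤n) low≤T₁)))))
    decide : Dec Bound → Bound
    decide (yes bound) = bound
    decide (no  large) = Large.conclude (exceeds large) (any-T (covers₁ n w) bs (proj₂ covered))

module _ (M l : ℕ) (c₀ : Case) (cs : List Case) (bs rs : List Block)
         (is-complete : complete l (c₀ ∷ cs) ≡ true) (is-checked : checked₂ M cs bs ≡ true) (star-checked : checked-star M c₀ bs rs ≡ true) where

  -- Every quadruple goes through the linear programming bound here: 1, 2, 3, 4 at the length n, any
  -- other after padding to the end of a block of the same weight.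
  upper₂ : ∀ {n w v n₀ n₁ X} → (v ∋ n₀ ⋯ n₁) ∈ rs → n₀ ≤ n → n ≤ n₁ → 5 ≤ w → w ≤ v → w < l →
           IsSDistanceSet n w 4 X → length X ≤ T₂ n w
  upper₂ {n} {w} {v} {n₀} {n₁} {X} r∈ n₀≤n n≤n₁ 5≤w w≤v w<l distance-set = decide (length X ≤? T₂ n w)
    where
    star : T (star₂ M c₀ bs n w)
    star = if-T {5 ≤ᵇ w} (below-sound (suc v) (weight₂ M c₀ bs n) (if-T {n₀ ≤ᵇ n}
      (below-sound (suc n₁) (length₂ M c₀ bs v n₀) (all-T (region₂ M c₀ bs) rs (≡true⇒T star-checked) r∈) (s≤s n≤n₁)) (≤⇒≤ᵇ n₀≤n)) (s≤s w≤v)) (≤⇒≤ᵇ 5≤w)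
    low : T (low-dimensions n ≤ᵇ T₂ n w) × T (any (covers n w) bs ∧ lp-case M (T₂ n w) n w (hahn-table 16 n w) c₀)
    low = ∧-T {low-dimensions n ≤ᵇ T₂ n w} star
    covered : T (any (covers n w) bs) × T (lp-case M (T₂ n w) n w (hahn-table 16 n w) c₀)
    covered = ∧-T {any (covers n w) bs} (proj₂ low)
    s = sorted distance-set
    open Sorted s

    module Large (exceeds : T₂ n w < length X) where
      case = listed-case s (≤-<-trans (≤ᵇ⇒≤ (low-dimensions n) (T₂ n w) (proj₁ low)) exceeds) w<l {c₀ ∷ cs} (≡true⇒T is-complete)
      c : Case
      c = ⟨ d₁ , d₂ , d₃ , d₄ ⟩ ∶ proj₁ case
      by-block : c ∈ cs → ∀ u m₀ m₁ → (u ∋ m₀ ⋯ m₁) ∈ bs → w ≡ u → m₀ ≤ n × n ≤ m₁ → T₂ m₀ w ≤ T₂ n w → length X ≤ T₂ n w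
      by-block c∈ u m₀ m₁ b∈ refl (_ , n≤m₁) mono = ≤-trans (pad-bound (≤⇒≤′ n≤m₁) (lp-case-sound M (T₂ m₀ w) 16 {supports = proj₁ case}
        (if-T {relevant w c} (all-T (case₂ M (T₂ m₀ w) m₁ w (hahn-table 16 m₁ w)) cs (all-T (block₂ M cs) bs (≡true⇒T is-checked) b∈) c∈) (≤⇒≤ᵇ d₄≤w))) code) mono
      find-block : c ∈ cs → (∃ λ b → b ∈ bs × T (covers n w b)) → length X ≤ T₂ n w
      find-block c∈ ((u ∋ m₀ ⋯ m₁) , b∈ , cov) = go (∧-T {w ≡ᵇ u} cov)
        where
        go : T (w ≡ᵇ u) × T (in-range n m₀ m₁ ∧ (T₂ m₀ w ≤ᵇ T₂ n w)) → length X ≤ T₂ n w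
        go (w≡u , rest) = by-block c∈ u m₀ m₁ b∈ (≡ᵇ⇒≡ w u w≡u) (in-range-T n m₀ m₁ (proj₁ (∧-T {in-range n m₀ m₁} rest)))
          (≤ᵇ⇒≤ (T₂ m₀ w) (T₂ n w) (proj₂ (∧-T {in-range n m₀ m₁} rest)))
      by-case : c ∈ c₀ ∷ cs → length X ≤ T₂ n w
      by-case (there c∈) = find-block c∈ (any-T (covers n w) bs (proj₁ covered))
      by-case (here eq)  = lp-case-sound M (T₂ n w) 16 {supports = proj₁ case} (subst (λ c → T (lp-case M (T₂ n w) n w (hahn-table 16 n w) c)) (sym eq) (proj₂ covered)) code
      conclude : length X ≤ T₂ n w
      conclude = by-case (proj₂ case)

    decide : Dec (length X ≤ T₂ n w) → length X ≤ T₂ n w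
    decide (yes bound) = bound
    decide (no  large) = Large.conclude (≰⇒> large)

-- The extremal example.

∈-layer : ∀ {n k} (x : Vec Bool n) → weight x ≡ k → x ∈ layer n k
∈-layer         []          refl = here refl
∈-layer {suc n} (true ∷ x)  refl = ∈-++⁺ˡ (∈-map⁺ (true ∷_) (∈-layer x refl))
∈-layer {suc n} {zero}  (false ∷ x) eq = ∈-map⁺ (false ∷_) (∈-layer x eq)
∈-layer {suc n} {suc k} (false ∷ x) eq = ∈-++⁺ʳ (map (true ∷_) (layer n k)) (∈-map⁺ (false ∷_) (∈-layer x eq))

weight-zeros : ∀ m → weight (replicate m false) ≡ 0
weight-zeros zero    = refl
weight-zeros (suc m) = weight-zeros m

hamming-zeros : ∀ m → hamming (replicate m false) (replicate m false) ≡ 0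
hamming-zeros zero    = refl
hamming-zeros (suc m) = hamming-zeros m

-- Length 8 leaves room for two disjoint quadruples, hence for distance 4.
layer-4-distance : ∀ m → IsSDistanceSet (8 + m) 4 4 (layer (8 + m) 4)
layer-4-distance m = (unique-layer (8 + m) 4 , All.tabulate (weight-layer (8 + m) 4)) ,
  1 ∷ 2 ∷ 3 ∷ 4 ∷ [] , (((λ ()) ∷ (λ ()) ∷ (λ ()) ∷ []) ∷ ((λ ()) ∷ (λ ()) ∷ []) ∷ ((λ ()) ∷ []) ∷ [] ∷ []) , refl ,
  λ d → mk⇔ realised occurring
  where
  zs = replicate m false
  -- A window of four ones moved by i places: for i ≤ 4, `shifted 0` and `shifted i` share 4 - i
  -- ones and so are at distance i.
  shifted : ℕ → Vec Bool (8 + m)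
  shifted 0 = true  ∷ true  ∷ true  ∷ true  ∷ false ∷ false ∷ false ∷ false ∷ zs
  shifted 1 = false ∷ true  ∷ true  ∷ true  ∷ true  ∷ false ∷ false ∷ false ∷ zs
  shifted 2 = false ∷ false ∷ true  ∷ true  ∷ true  ∷ true  ∷ false ∷ false ∷ zs
  shifted 3 = false ∷ false ∷ false ∷ true  ∷ true  ∷ true  ∷ true  ∷ false ∷ zs
  shifted _ = false ∷ false ∷ false ∷ false ∷ true  ∷ true  ∷ true  ∷ true  ∷ zs
  four : 4 + weight zs ≡ 4
  four = cong (_+_ 4) (weight-zeros m)
  halve : ∀ d → (d + hamming zs zs) / 2 ≡ d / 2
  halve d = cong (_/ 2) (trans (cong (_+_ d) (hamming-zeros m)) (+-identityʳ d))
  Pair : ℕ → Set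
  Pair d = Σ (Vec Bool (8 + m)) λ x → Σ (Vec Bool (8 + m)) λ y →
             x ∈ layer (8 + m) 4 × y ∈ layer (8 + m) 4 × x ≢ y × τ x y ≡ d
  realised : ∀ {d} → d ∈ 1 ∷ 2 ∷ 3 ∷ 4 ∷ [] → Pair d
  realised (here refl)                         = shifted 0 , shifted 1 , ∈-layer (shifted 0) four , ∈-layer (shifted 1) four , (λ ()) , halve 2
  realised (there (here refl))                 = shifted 0 , shifted 2 , ∈-layer (shifted 0) four , ∈-layer (shifted 2) four , (λ ()) , halve 4
  realised (there (there (here refl)))         = shifted 0 , shifted 3 , ∈-layer (shifted 0) four , ∈-layer (shifted 3) four , (λ ()) , halve 6
  realised (there (there (there (here refl)))) = shifted 0 , shifted 4 , ∈-layer (shifted 0) four , ∈-layer (shifted 4) four , (λ ()) , halve 8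
  small : ∀ d → d ≢ 0 → d ≤ 4 → d ∈ 1 ∷ 2 ∷ 3 ∷ 4 ∷ []
  small 0 ≢0 _ = contradiction refl ≢0
  small 1 _  _ = here refl
  small 2 _  _ = there (here refl)
  small 3 _  _ = there (there (here refl))
  small 4 _  _ = there (there (there (here refl)))
  small (suc (suc (suc (suc (suc _))))) _ (s≤s (s≤s (s≤s (s≤s ()))))
  occurring : ∀ {d} → Pair d → d ∈ 1 ∷ 2 ∷ 3 ∷ 4 ∷ []
  occurring (x , y , x∈ , y∈ , x≢y , refl) = small (τ x y) (x≢y ∘ τ≡0 x y wx wy) (τ≤weight x y wx wy)
    where
    wx = weight-layer (8 + m) 4 x∈
    wy = weight-layer (8 + m) 4 y∈

-- A common one contributes nothing to `hamming`, so the equations for the distances carry over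
-- unchanged.
prepend-one : ∀ {n w s X} → IsSDistanceSet n w s X → IsSDistanceSet (suc n) (suc w) s (map (true ∷_) X)
prepend-one {n} {X = X} ((un , ws) , D , unD , len , iff) =
  (Unique.map⁺ Vec.∷-injectiveʳ un , All.map⁺ (All.map (cong suc) ws)) , D , unD , len , λ d → mk⇔ (up ∘ Equivalence.to (iff d)) (Equivalence.from (iff d) ∘ down)
  where
  up : ∀ {d} → (Σ (Vec Bool n) λ x → Σ (Vec Bool n) λ y → x ∈ X × y ∈ X × x ≢ y × τ x y ≡ d) →
       Σ (Vec Bool (suc n)) λ x → Σ (Vec Bool (suc n)) λ y → x ∈ map (true ∷_) X × y ∈ map (true ∷_) X × x ≢ y × τ x y ≡ d
  up (x , y , x∈ , y∈ , x≢y , eq) = true ∷ x , true ∷ y , ∈-map⁺ (true ∷_) x∈ , ∈-map⁺ (true ∷_) y∈ , x≢y ∘ Vec.∷-injectiveʳ , eq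
  down : ∀ {d} → (Σ (Vec Bool (suc n)) λ x → Σ (Vec Bool (suc n)) λ y → x ∈ map (true ∷_) X × y ∈ map (true ∷_) X × x ≢ y × τ x y ≡ d) →
         Σ (Vec Bool n) λ x → Σ (Vec Bool n) λ y → x ∈ X × y ∈ X × x ≢ y × τ x y ≡ d
  down (_ , _ , x∈ , y∈ , x≢y , eq) with ∈-map⁻ (true ∷_) x∈ | ∈-map⁻ (true ∷_) y∈
  ... | x , x∈X , refl | y , y∈X , refl = x , y , x∈X , y∈X , x≢y ∘ cong (true ∷_) , eq

Attained : (n w s N : ℕ) → Set
Attained n w s N = Σ (List (Vec Bool n)) λ X → IsSDistanceSet n w s X × length X ≡ N

star : ∀ k m → Attained (k + (8 + m)) (k + 4) 4 ((8 + m) C 4)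
star zero    m = layer (8 + m) 4 , layer-4-distance m , length-layer (8 + m) 4
star (suc k) m with star k m
... | X , set , len = map (true ∷_) X , prepend-one set , trans (length-map (true ∷_) X) len

lower₂ : ∀ {n w} → 5 ≤ w → 2 * w ≤ n → Attained n w 4 ((n ∸ w + 4) C 4)
lower₂ {n} {w} 5≤w 2w≤n = subst₂ (λ n′ w′ → Attained n′ w′ 4 ((n ∸ w + 4) C 4)) n-eq (m∸n+n≡m 4≤w)
  (subst (λ m → Attained (w ∸ 4 + m) (w ∸ 4 + 4) 4 (m C 4)) (m+[n∸m]≡n 8≤m) (star (w ∸ 4) (n ∸ w + 4 ∸ 8)))
  where
  4≤w : 4 ≤ w
  4≤w = ≤-trans (n≤1+n 4) 5≤w
  w≤n-w : w ≤ n ∸ w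
  w≤n-w = m+n≤o⇒m≤o∸n w (subst (_≤ n) (cong (_+_ w) (+-identityʳ w)) 2w≤n)
  -- n - w ≥ w ≥ 4, so at least 8 coordinates remain free, as `layer-4-distance` requires.
  8≤m : 8 ≤ n ∸ w + 4
  8≤m = +-monoˡ-≤ 4 (≤-trans 4≤w w≤n-w)
  n-eq : w ∸ 4 + (n ∸ w + 4) ≡ n
  n-eq = begin
    w ∸ 4 + (n ∸ w + 4)   ≡⟨ cong (_+_ (w ∸ 4)) (+-comm (n ∸ w) 4) ⟩
    w ∸ 4 + (4 + (n ∸ w)) ≡⟨ sym (+-assoc (w ∸ 4) 4 (n ∸ w)) ⟩
    w ∸ 4 + 4 + (n ∸ w)   ≡⟨ cong (_+ (n ∸ w)) (m∸n+n≡m 4≤w) ⟩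
    w + (n ∸ w)           ≡⟨ m+[n∸m]≡n (≤-trans w≤n-w (m∸n≤m n w)) ⟩
    n                     ∎
    where open ≡-Reasoning

-- The regions of the second statement and the theorem

record InRegion (n w : ℕ) : Set where
  constructor in-region
  field
    {v n₀ n₁} : ℕ
    region∈ : (v ∋ n₀ ⋯ n₁) ∈ regions₂
    n₀≤n    : n₀ ≤ n
    n≤n₁    : n ≤ n₁
    5≤w     : 5 ≤ w
    w≤v     : w ≤ v
    v<30    : v < 30

Cond2⇒InRegion : ∀ {n w} → Cond2 n w → InRegion n w
Cond2⇒InRegion (inj₁ (a , b , c , d)) = in-region (here refl) a b c d (from-yes (6 ≤? 30))
Cond2⇒InRegion (inj₂ (inj₁ (a , b , c , d))) = in-region (there (here refl)) a b c d (from-yes (7 ≤? 30))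
Cond2⇒InRegion (inj₂ (inj₂ (inj₁ (a , b , c , d)))) = in-region (there (there (here refl))) a b c d (from-yes (8 ≤? 30))
Cond2⇒InRegion (inj₂ (inj₂ (inj₂ (inj₁ (a , b , c , d))))) = in-region (there (there (there (here refl)))) a b c d (from-yes (9 ≤? 30))
Cond2⇒InRegion (inj₂ (inj₂ (inj₂ (inj₂ (inj₁ (inj₁ (a , b) , c , d)))))) =
  in-region (there (there (there (there (here refl))))) a b c d (from-yes (10 ≤? 30))
Cond2⇒InRegion (inj₂ (inj₂ (inj₂ (inj₂ (inj₁ (inj₂ (a , b) , c , d)))))) =
  in-region (there (there (there (there (there (here refl)))))) a b c d (from-yes (10 ≤? 30))
Cond2⇒InRegion (inj₂ (inj₂ (inj₂ (inj₂ (inj₂ (inj₁ (inj₁ (a , b) , c , d))))))) =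
  in-region (there (there (there (there (there (there (here refl))))))) a b c d (from-yes (11 ≤? 30))
Cond2⇒InRegion (inj₂ (inj₂ (inj₂ (inj₂ (inj₂ (inj₁ (inj₂ (a , b) , c , d))))))) =
  in-region (there (there (there (there (there (there (there (here refl)))))))) a b c d (from-yes (11 ≤? 30))
Cond2⇒InRegion (inj₂ (inj₂ (inj₂ (inj₂ (inj₂ (inj₂ (a , b , c , d))))))) =
  in-region (there (there (there (there (there (there (there (there (here refl))))))))) a b c d (from-yes (12 ≤? 30))

theorem3p6 : ((n w : ℕ) → 14 ≤ n → n ≤ 58 → 5 ≤ w → 2 * w ≤ n →
    (X : List (Vec Bool n)) → IsSDistanceSet n w 4 X →
    length X + n C 3 ≤ n C 4 + n C 2)
    ×
    ((n w : ℕ) → 2 * w ≤ n → Cond2 n w →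
    IsA n w 4 ((n ∸ w + 4) C 4))
theorem3p6 =
  (λ n w 14≤n n≤58 5≤w 2w≤n X → upper₁ modulus 59 30 table blocks₁ complete-ok checked₁-ok covered₁-ok
    -- 2w ≤ n ≤ 58 < 60 gives w < 30, the limit of the table.
    14≤n (s≤s n≤58) 5≤w (*-cancelˡ-< 2 w 30 (≤-<-trans (≤-trans 2w≤n n≤58) (from-yes (59 ≤? 60)))) 2w≤n) ,
  (λ n w 2w≤n cond → let open InRegion (Cond2⇒InRegion cond) in
    lower₂ 5≤w 2w≤n ,
    λ X → upper₂ modulus 30 star-case other-cases blocks₂ regions₂ complete-ok checked₂-ok checked-star-ok
      region∈ n₀≤n n≤n₁ 5≤w w≤v (≤-<-trans w≤v v<30))
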